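{- Let $G$ be the $xy$-sum of connected graphs $G_1,G_2\in\mathcal{G}^\circ_{xy}$. The subgraph $G_1$ is $\widehat{g}^+$-tight in $G$ if and only if $G_1\in\mathcal{C}^\circ(\widehat{g}^+)$.
   Context: All graphs are finite and simple. The Euler genus $\widehat{g}(G)$ is the minimum Euler genus of a surface in which $G$ embeds. $\mathcal{G}_{xy}$ is the class of graphs with two distinguished vertices $x,y$ (terminals). The set $\mathcal{M}(G)$ of minor-operations consists of deleting any edge, or contracting any edge other than $xy$ (a vertex obtained by contracting an edge incident with a terminal becomes a terminal; parallel edges are removed); $\mu G$ is the result of $\mu\in\mathcal{M}(G)$. $\mathcal{G}^\circ_{xy}$ is the subclass of graphs not containing the edge $xy$. $G^+$ is $G$ with the edge $xy$ added (if absent); $\widehat{g}^+(G)=\widehat{g}(G^+)$. For $G_1,G_2\in\mathcal{G}_{xy}$ with $V(G_1)\cap V(G_2)=\{x,y\}$, their $xy$-sum is $(V(G_1)\cup V(G_2),E(G_1)\cup E(G_2))$. A subgraph $H$ of $G$ is $\widehat{g}^+$-tight if $\widehat{g}^+(\mu G)<\widehat{g}^+(G)$ for every $\mu\in\mathcal{M}(H)$. $\mathcal{C}^\circ(\widehat{g}^+)$ is the class of $G\in\mathcal{G}^\circ_{xy}$ with $\widehat{g}^+(\mu G)<\widehat{g}^+(G)$ for every $\mu\in\mathcal{M}(G)$. -}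

module Defs where

open import Data.Bool using (Bool; true; false; _∧_; _∨_; not; if_then_else_; _xor_)
open import Data.Nat using (ℕ; zero; suc; _+_; _*_; _/_)
open import Data.Fin using (Fin; toℕ; _≟_)
open import Data.List using (List; allFin; upTo; map)
open import Data.Nat.ListAction using (sum)
open import Data.Bool.ListAction using (any; all)
open import Data.Integer as ℤ using (ℤ; +_)
open import Data.Product using (Σ; _×_; _,_; ∃)
open import Data.Sum using (_⊎_)
open import Relation.Nullary using (¬_)
open import Relation.Nullary.Decidable using (⌊_⌋)
open import Relation.Binary.PropositionalEquality using (_≡_)
open import Function using (_⇔_)

-- Graphs with terminals.
-- All graphs live inside a fixed ambient vertex universe Fin N; a graph is a
-- vertex subset V together with an edge relation E (Boolean valued).  The
-- two terminals x, y are fixed elements of Fin N (contractions below always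
-- keep the name of the terminal endpoint, so terminals never get renamed).

record Graph (N : ℕ) : Set where
  field
    V : Fin N → Bool
    E : Fin N → Fin N → Bool
open Graph public

_==_ : ∀ {N} → Fin N → Fin N → Bool
a == b = ⌊ a ≟ b ⌋

samePair : ∀ {N} → Fin N → Fin N → Fin N → Fin N → Bool
samePair a b u v = (a == u ∧ b == v) ∨ (a == v ∧ b == u)

IsGraphXY : ∀ {N} (x y : Fin N) → Graph N → Set
IsGraphXY x y G =
  (¬ x ≡ y) × (V G x ≡ true) × (V G y ≡ true) ×
  (∀ a b → E G a b ≡ E G b a) ×
  (∀ a → E G a a ≡ false) ×
  (∀ a b → E G a b ≡ true → V G a ≡ true)

IsGraphXY° : ∀ {N} (x y : Fin N) → Graph N → Set
IsGraphXY° x y G = IsGraphXY x y G × (E G x y ≡ false)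

-- xy-sum (vertex sets are assumed to meet exactly in {x,y}, see theorem)
xySum : ∀ {N} → Graph N → Graph N → Graph N
xySum G₁ G₂ = record { V = λ a → V G₁ a ∨ V G₂ a
                     ; E = λ a b → E G₁ a b ∨ E G₂ a b }

plus : ∀ {N} (x y : Fin N) → Graph N → Graph N
plus x y G = record { V = V G ; E = λ a b → E G a b ∨ samePair a b x y }

deleteEdge : ∀ {N} → Fin N → Fin N → Graph N → Graph N
deleteEdge u v G = record { V = V G ; E = λ a b → E G a b ∧ not (samePair a b u v) }

contractInto : ∀ {N} → Fin N → Fin N → Graph N → Graph N
contractInto keep gone G = record
  { V = λ a → V G a ∧ not (a == gone)
  ; E = λ a b → not (a == gone) ∧ not (b == gone) ∧ not (a == b) ∧
                (E G a b ∨ (a == keep ∧ E G gone b) ∨ (b == keep ∧ E G a gone)) }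

-- contracting uv: if v is a terminal the merged vertex keeps v's name
-- (so it is a terminal), otherwise it keeps u's name.
contractEdge : ∀ {N} (x y : Fin N) → Fin N → Fin N → Graph N → Graph N
contractEdge x y u v G =
  if (v == x ∨ v == y) then contractInto v u G else contractInto u v G

data MinorOp {N} (x y : Fin N) (H : Graph N) : Set where
  del : (u v : Fin N) → E H u v ≡ true → MinorOp x y H
  con : (u v : Fin N) → E H u v ≡ true → samePair u v x y ≡ false → MinorOp x y H

applyOp : ∀ {N} {x y : Fin N} {H : Graph N} → MinorOp x y H → Graph N → Graph N
applyOp {x = x} {y} (del u v _)   G = deleteEdge u v G
applyOp {x = x} {y} (con u v _ _) G = contractEdge x y u v G

-- Euler genus via generalized (signed) rotation systems
-- (Mohar–Thomassen, Graphs on Surfaces, Ch. 3).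

iter : ∀ {A : Set} → (A → A) → ℕ → A → A
iter f zero    a = a
iter f (suc k) a = f (iter f k a)

record Embedding {N} (G : Graph N) : Set where
  field
    rot    : Fin N → Fin N → Fin N   -- rot u v : successor of neighbour v in the local rotation at u
    rotInv : Fin N → Fin N → Fin N
    sig    : Fin N → Fin N → Bool    -- edge signature; true = -1 (twisted edge)
    rot-nb    : ∀ u v → E G u v ≡ true → E G u (rot u v) ≡ true
    rotInv-nb : ∀ u v → E G u v ≡ true → E G u (rotInv u v) ≡ true
    inv₁      : ∀ u v → E G u v ≡ true → rotInv u (rot u v) ≡ v
    inv₂      : ∀ u v → E G u v ≡ true → rot u (rotInv u v) ≡ v
    cyclic    : ∀ u v w → E G u v ≡ true → E G u w ≡ true →
                ∃ λ k → iter (rot u) k v ≡ w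
    sig-sym   : ∀ u v → sig u v ≡ sig v u
open Embedding public

count : ∀ {N} → (Fin N → Bool) → ℕ
count {N} p = sum (map (λ i → if p i then 1 else 0) (allFin N))

-- face-tracing states: (u , v , s) = traversing dart u→v with local
-- orientation s (false = use rot, true = use rotInv)
State : ℕ → Set
State N = Fin N × Fin N × Bool

step : ∀ {N} {G : Graph N} → Embedding G → State N → State N
step emb (u , v , s) =
  let s' = s xor sig emb u v in
  (v , (if s' then rotInv emb v u else rot emb v u) , s')

code : ∀ {N} → State N → ℕ
code {N} (u , v , s) = toℕ u * (2 * N) + toℕ v * 2 + (if s then 1 else 0)

_≤ᵇ'_ : ℕ → ℕ → Bool
zero  ≤ᵇ' _     = true
suc m ≤ᵇ' zero  = false
suc m ≤ᵇ' suc n = m ≤ᵇ' n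

-- t is the representative (code-minimal element) of its orbit under step;
-- orbits have size ≤ number of states ≤ 2N².
isRep : ∀ {N} {G : Graph N} → Embedding G → State N → Bool
isRep {N} emb t = all (λ k → code t ≤ᵇ' code (iter (step emb) k t)) (upTo (2 * N * N))

-- number of orbits of the face-tracing permutation on states (u,v,s) with uv ∈ E;
-- every face is traced exactly twice (once in each direction).
numOrbits : ∀ {N} {G : Graph N} → Embedding G → ℕ
numOrbits {N} {G} emb =
  sum (map (λ u → sum (map (λ v → (if E G u v ∧ isRep emb (u , v , false) then 1 else 0)
                                 + (if E G u v ∧ isRep emb (u , v , true) then 1 else 0))
                           (allFin N)))
           (allFin N))

numVertices : ∀ {N} → Graph N → ℕ
numVertices G = count (V G)

numEdges : ∀ {N} → Graph N → ℕ
numEdges {N} G = sum (map (λ u → count (E G u)) (allFin N)) / 2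

isolated : ∀ {N} → Graph N → Fin N → Bool
isolated {N} G u = V G u ∧ not (any (E G u) (allFin N))

reach : ∀ {N} → Graph N → ℕ → Fin N → Fin N → Bool
reach G zero    u v = u == v
reach {N} G (suc k) u v = reach G k u v ∨ any (λ w → reach G k u w ∧ E G w v) (allFin N)

connectedTo : ∀ {N} → Graph N → Fin N → Fin N → Bool
connectedTo {N} G = reach G N

-- number of connected components (count least-index vertex of each component)
numComponents : ∀ {N} → Graph N → ℕ
numComponents {N} G =
  count (λ u → V G u ∧ not (any (λ w → V G w ∧ (toℕ w ≤ᵇ' toℕ u) ∧ not (w == u) ∧ connectedTo G u w) (allFin N)))

numFaces : ∀ {N} {G : Graph N} → Embedding G → ℕ
numFaces {G = G} emb = numOrbits emb / 2 + count (isolated G)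

eulerGenusOf : ∀ {N} {G : Graph N} → Embedding G → ℤ
eulerGenusOf {G = G} emb =
  ((+ (2 * numComponents G) ℤ.- + numVertices G) ℤ.+ + numEdges G) ℤ.- + numFaces emb

-- ĝ(G) < ĝ(H), where ĝ is the minimum Euler genus over all embeddings
genusLT : ∀ {N} → Graph N → Graph N → Set
genusLT G H = Σ (Embedding G) λ e → ∀ (e' : Embedding H) → eulerGenusOf e ℤ.< eulerGenusOf e'

genusPlusLT : ∀ {N} (x y : Fin N) → Graph N → Graph N → Set
genusPlusLT x y A B = genusLT (plus x y A) (plus x y B)

Connected : ∀ {N} → Graph N → Set
Connected G = ∀ u v → V G u ≡ true → V G v ≡ true → connectedTo G u v ≡ true

Tight : ∀ {N} (x y : Fin N) (G H : Graph N) → Set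
Tight x y G H = ∀ (μ : MinorOp x y H) → genusPlusLT x y (applyOp μ G) G

InC° : ∀ {N} (x y : Fin N) (G : Graph N) → Set
InC° x y G = IsGraphXY° x y G ×
  (∀ (μ : MinorOp x y G) → genusPlusLT x y (applyOp μ G) G)

{-# OPTIONS --safe #-}

-- The theorem follows from the additivity of the Euler genus over edge amalgamations:
-- if H and K share exactly the edge xy, then ĝ(H ∪ K) = ĝ(H) + ĝ(K).  It is applied to
-- H = G₁⁺ and to H = (μG₁)⁺, always with K = G₂⁺.
--
-- A signed rotation system is encoded by three perfect matchings on flags: κ turns around a
-- corner, ε crosses an edge and θ changes the side of a dart.  Faces are the cycles of κ ∪ ε
-- and vertices those of κ ∪ θ; the permutation κ ∘ ε runs through each cycle once in each
-- direction.  Re-pairing two κ-edges changes the number of cycles by at most one.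
--
-- Doubling the edge xy separates H from K except for the corners at x and y where flags of H
-- and K are paired by κ.  These mixed corners are removed without losing faces, relative to the
-- number of vertex cycles.  κ-edges inside one part are contracted, so that every κ-edge is
-- mixed.  An ε-edge with both ends at one vertex is closed off as a face of its own.  Once every
-- ε-edge runs from x to y, any pure κ commuting with ε makes all faces of κ ∪ ε as short as
-- possible, and such a κ can be merged greedily into a single cycle for each part at each of x
-- and y.
module Submission where

open import Defs
open import Data.Bool using (Bool; true; false; _∧_; _∨_; _xor_; not; if_then_else_) renaming (_≟_ to _≟ᵇ_)
open import Data.Bool.ListAction using (any; all)
import Data.Bool.Properties as Boolₚ
open import Data.Empty using (⊥; ⊥-elim)
open import Data.Fin as Fin using (Fin; zero; suc; toℕ; _≟_; fromℕ<; combine; remQuot; finToFun; funToFin)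
import Data.Fin.Properties as Finₚ
import Data.Integer as ℤ
import Data.Integer.Properties as ℤₚ
import Data.Integer.Solver as ℤ-Solver
open import Data.List using (map; allFin; tabulate; applyUpTo)
import Data.List.Properties as Listₚ
open import Data.Nat as ℕ using (ℕ; zero; suc; _+_; _*_; _∸_; _≤_; _<_; z≤n; s≤s)
import Data.Nat.DivMod as DivMod
open import Data.Nat.ListAction using (sum)
import Data.Nat.Properties as ℕₚ
import Data.Nat.Solver as ℕ-Solver
open import Data.Product using (Σ; _×_; _,_; ∃; proj₁; proj₂)
import Data.Product.Properties as Productₚ
open import Data.Sum using (_⊎_; inj₁; inj₂)
open import Data.Unit using (⊤; tt)
open import Function using (_∘_; id; _⇔_; mk⇔)
open import Relation.Binary.Definitions using (tri<; tri≈; tri>)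
open import Relation.Binary.PropositionalEquality using (_≡_; _≢_; refl; sym; trans; cong; cong₂; subst; subst₂; module ≡-Reasoning)
open import Relation.Nullary using (¬_; Dec; yes; no; contradiction)
open import Relation.Nullary.Decidable using (⌊_⌋; _×-dec_; _→-dec_; _⊎-dec_; map′; ¬?)

-- Counting

-- The hard direction bounds the genus of the union from below: separating mixed corners of an
-- arbitrary embedding may destroy faces. What can be controlled is the number of face orbits minus
-- that of vertex orbits. It may drop by 4, and these 4 are regained because the separated matching
-- has two vertex cycles instead of one at each of x and y. Vertex cycles may break up meanwhile;
-- merging them afterwards costs no more face orbits than vertex orbits. Orbits are counted on the
-- set of all states, with inert pairs in place of missing flags, so that graphs with different
-- edges are compared on one set. A face gives two orbits. The union has two vertices, one edge and
-- one component fewer than H and K taken separately, so equality of genera means one face fewer: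
-- `numOrbits eH + numOrbits eK` against `2 + numOrbits eU`. In one direction of the theorem the
-- genus of one and the same embedding of G₂⁺ cancels. In the other that embedding has to be
-- minimal, which is why embeddings of minimum genus are constructed.

Sum : ∀ {n} → (Fin n → ℕ) → ℕ
Sum {zero}  f = 0
Sum {suc n} f = f zero + Sum (f ∘ suc)

bit : Bool → ℕ
bit b = if b then 1 else 0

cnt : ∀ {n} → (Fin n → Bool) → ℕ
cnt p = Sum (λ i → bit (p i))

sum-allFin : ∀ {n} (f : Fin n → ℕ) → sum (map f (allFin n)) ≡ Sum f
sum-allFin {n} f = trans (cong sum (Listₚ.map-tabulate id f)) (go f)
  where
  go : ∀ {n} (f : Fin n → ℕ) → sum (tabulate f) ≡ Sum f
  go {zero}  f = refl
  go {suc n} f = cong (f zero +_) (go (f ∘ suc))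

count≡cnt : ∀ {n} (p : Fin n → Bool) → count p ≡ cnt p
count≡cnt p = sum-allFin (λ i → if p i then 1 else 0)

Sum-cong : ∀ {n} {f g : Fin n → ℕ} → (∀ i → f i ≡ g i) → Sum f ≡ Sum g
Sum-cong {zero}  h = refl
Sum-cong {suc n} h = cong₂ _+_ (h zero) (Sum-cong (h ∘ suc))

interchange : ∀ a b c d → (a + b) + (c + d) ≡ (a + c) + (b + d)
interchange a b c d = begin
  (a + b) + (c + d) ≡⟨ ℕₚ.+-assoc a b (c + d) ⟩
  a + (b + (c + d)) ≡⟨ cong (a +_) (ℕₚ.+-assoc b c d) ⟨
  a + ((b + c) + d) ≡⟨ cong (λ z → a + (z + d)) (ℕₚ.+-comm b c) ⟩
  a + ((c + b) + d) ≡⟨ cong (a +_) (ℕₚ.+-assoc c b d) ⟩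
  a + (c + (b + d)) ≡⟨ ℕₚ.+-assoc a c (b + d) ⟨
  (a + c) + (b + d) ∎
  where open ≡-Reasoning

Sum-+ : ∀ {n} (f g : Fin n → ℕ) → Sum (λ i → f i + g i) ≡ Sum f + Sum g
Sum-+ {zero}  f g = refl
Sum-+ {suc n} f g = trans (cong (f zero + g zero +_) (Sum-+ (f ∘ suc) (g ∘ suc)))
                          (interchange (f zero) (g zero) _ _)

Sum-0 : ∀ {n} → Sum {n} (λ _ → 0) ≡ 0
Sum-0 {zero}  = refl
Sum-0 {suc n} = Sum-0 {n}

Sum-swap : ∀ {m n} (f : Fin m → Fin n → ℕ) →
           Sum (λ i → Sum (f i)) ≡ Sum (λ j → Sum (λ i → f i j))
Sum-swap {zero}  {n} f = sym (Sum-0 {n})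
Sum-swap {suc m} f = trans (cong (Sum (f zero) +_) (Sum-swap (f ∘ suc)))
                           (sym (Sum-+ (f zero) _))

cnt-cong : ∀ {n} {p q : Fin n → Bool} → (∀ i → p i ≡ q i) → cnt p ≡ cnt q
cnt-cong h = Sum-cong (λ i → cong bit (h i))

_∖_ : ∀ {n} → (Fin n → Bool) → Fin n → Fin n → Bool
(q ∖ j) i = q i ∧ not ⌊ i ≟ j ⌋

∧-true : ∀ {a b} → a ≡ true → b ≡ true → a ∧ b ≡ true
∧-true refl refl = refl

∧-true⁻ : ∀ {a b} → a ∧ b ≡ true → a ≡ true × b ≡ true
∧-true⁻ {true} {true} _ = refl , refl

true≢false : true ≢ false
true≢false ()

not-false : ∀ {a} → not a ≡ true → a ≡ false
not-false {false} _ = refl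

⌊⌋-true : ∀ {A : Set} {a? : Dec A} → A → ⌊ a? ⌋ ≡ true
⌊⌋-true {a? = yes _} _ = refl
⌊⌋-true {a? = no ¬a} a = contradiction a ¬a

⌊⌋-true⁻ : ∀ {A : Set} {a? : Dec A} → ⌊ a? ⌋ ≡ true → A
⌊⌋-true⁻ {a? = yes a} _ = a

⌊⌋-false : ∀ {A : Set} {a? : Dec A} → ¬ A → ⌊ a? ⌋ ≡ false
⌊⌋-false {a? = yes a} ¬a = contradiction a ¬a
⌊⌋-false {a? = no _} _ = refl

∖-true : ∀ {n} {q : Fin n → Bool} {j i} → q i ≡ true → i ≢ j → (q ∖ j) i ≡ true
∖-true {j = j} {i} qi i≢j = ∧-true qi (cong not (⌊⌋-false {a? = i ≟ j} i≢j))

∖-true⁻ : ∀ {n} {q : Fin n → Bool} {j i} → (q ∖ j) i ≡ true → q i ≡ true × i ≢ j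
∖-true⁻ {q = q} {j} {i} h with q i | i ≟ j
... | true | no i≢j = refl , i≢j

cnt-∖ : ∀ {n} (q : Fin n → Bool) j → q j ≡ true → cnt q ≡ suc (cnt (q ∖ j))
cnt-∖ q zero qj rewrite qj = cong suc (cnt-cong (λ i → sym (∧-identity (q (suc i)))))
  where
  ∧-identity : ∀ b → b ∧ true ≡ b
  ∧-identity true = refl
  ∧-identity false = refl
cnt-∖ {suc n} q (suc j) qj = begin
  bit (q zero) + cnt (q ∘ suc)               ≡⟨ cong (bit (q zero) +_) (cnt-∖ (q ∘ suc) j qj) ⟩
  bit (q zero) + suc (cnt ((q ∘ suc) ∖ j))   ≡⟨ ℕₚ.+-suc _ _ ⟩
  suc (bit (q zero) + cnt ((q ∘ suc) ∖ j))   ≡⟨ cong₂ (λ a b → suc (bit a + b)) (e (q zero)) (cnt-cong λ i → cong (λ b → q (suc i) ∧ not b) (f i)) ⟩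
  suc (bit (q zero ∧ true) + cnt ((q ∖ suc j) ∘ suc)) ∎
  where
  open ≡-Reasoning
  e : ∀ b → b ≡ b ∧ true
  e true = refl
  e false = refl
  f : ∀ i → ⌊ i ≟ j ⌋ ≡ ⌊ suc i ≟ suc j ⌋
  f i with i ≟ j
  ... | yes _ = refl
  ... | no _ = refl

cnt-inj : ∀ {m n} (p : Fin m → Bool) (q : Fin n → Bool) (f : Fin m → Fin n) →
          (∀ i → p i ≡ true → q (f i) ≡ true) →
          (∀ i j → p i ≡ true → p j ≡ true → f i ≡ f j → i ≡ j) → cnt p ≤ cnt q
cnt-inj {zero} p q f _ _ = z≤n
cnt-inj {suc m} p q f h inj with p zero in p0
... | false = cnt-inj (p ∘ suc) q (f ∘ suc) (h ∘ suc)
                (λ i j pi pj e → Finₚ.suc-injective (inj (suc i) (suc j) pi pj e))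
... | true = subst (suc (cnt (p ∘ suc)) ≤_) (sym (cnt-∖ q (f zero) (h zero p0)))
    (s≤s (cnt-inj (p ∘ suc) (q ∖ f zero) (f ∘ suc)
       (λ i pi → ∖-true {q = q} (h (suc i) pi) (λ e → Finₚ.0≢1+n (sym (inj (suc i) zero pi p0 e))))
       (λ i j pi pj e → Finₚ.suc-injective (inj (suc i) (suc j) pi pj e))))

cnt-inj-< : ∀ {m n} (p : Fin m → Bool) (q : Fin n → Bool) (f : Fin m → Fin n) (k : Fin n) →
          (∀ i → p i ≡ true → q (f i) ≡ true) →
          (∀ i j → p i ≡ true → p j ≡ true → f i ≡ f j → i ≡ j) →
          q k ≡ true → (∀ i → p i ≡ true → f i ≢ k) → suc (cnt p) ≤ cnt q
cnt-inj-< p q f k h inj qk miss = subst (suc (cnt p) ≤_) (sym (cnt-∖ q k qk))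
  (s≤s (cnt-inj p (q ∖ k) f (λ i pi → ∖-true {q = q} (h i pi) (miss i pi)) inj))

cnt-mono : ∀ {n} (p q : Fin n → Bool) → (∀ i → p i ≡ true → q i ≡ true) → cnt p ≤ cnt q
cnt-mono p q h = cnt-inj p q id h (λ _ _ _ _ e → e)

cnt-mono-< : ∀ {n} (p q : Fin n → Bool) k → (∀ i → p i ≡ true → q i ≡ true) →
             q k ≡ true → p k ≡ false → cnt p < cnt q
cnt-mono-< p q k h qk pk = cnt-inj-< p q id k h (λ _ _ _ _ e → e) qk
  (λ i pi e → true≢false (trans (sym pi) (trans (cong p e) pk)))

cnt-≤ : ∀ {n} (p : Fin n → Bool) → cnt p ≤ n
cnt-≤ {zero} p = z≤n
cnt-≤ {suc n} p = ℕₚ.+-mono-≤ {y = 1} (bit≤1 (p zero)) (cnt-≤ (p ∘ suc))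
  where
  bit≤1 : ∀ b → bit b ≤ 1
  bit≤1 true = ℕₚ.≤-refl
  bit≤1 false = z≤n

bool-ext : ∀ {a b} → (a ≡ true → b ≡ true) → (b ≡ true → a ≡ true) → a ≡ b
bool-ext {true}  {true}  _ _ = refl
bool-ext {true}  {false} f _ = sym (f refl)
bool-ext {false} {true}  _ g = g refl
bool-ext {false} {false} _ _ = refl

¬true⇒false : ∀ {a} → ¬ (a ≡ true) → a ≡ false
¬true⇒false {true} h = contradiction refl h
¬true⇒false {false} h = refl

-- f exchanges {i | i < f i} and {i | f i < i}.
cnt-even : ∀ {n} (q : Fin n → Bool) (f : Fin n → Fin n) →
  (∀ i → q i ≡ true → q (f i) ≡ true) → (∀ i → q i ≡ true → f (f i) ≡ i) →
  (∀ i → q i ≡ true → f i ≢ i) → ∃ λ k → cnt q ≡ k + k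
cnt-even q f qf ff f≢ = cnt lo , trans (trans (Sum-cong split) (Sum-+ (bit ∘ lo) (bit ∘ hi))) (cong (cnt lo +_) (ℕₚ.≤-antisym hi≤lo lo≤hi))
  where
  lo hi : _ → Bool
  lo i = q i ∧ ⌊ i Finₚ.<? f i ⌋
  hi i = q i ∧ ⌊ f i Finₚ.<? i ⌋
  split : ∀ i → bit (q i) ≡ bit (lo i) + bit (hi i)
  split i with q i in qi
  ... | false = refl
  ... | true with i Finₚ.<? f i | f i Finₚ.<? i
  ... | yes a | yes b = contradiction b (ℕₚ.<-asym a)
  ... | yes a | no b = refl
  ... | no a | yes b = refl
  ... | no a | no b with Finₚ.<-cmp i (f i)
  ... | tri< c _ _ = contradiction c a
  ... | tri≈ _ c _ = contradiction (sym c) (f≢ i qi)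
  ... | tri> _ _ c = contradiction c b
  inj : ∀ i j → q i ≡ true → q j ≡ true → f i ≡ f j → i ≡ j
  inj i j a b e = trans (sym (ff i a)) (trans (cong f e) (ff j b))
  lo≤hi : cnt lo ≤ cnt hi
  lo≤hi = cnt-inj lo hi f
    (λ i h → let a , b = ∧-true⁻ {q i} h in
       ∧-true (qf i a) (⌊⌋-true {a? = f (f i) Finₚ.<? f i} (subst (Fin._< f i) (sym (ff i a)) (⌊⌋-true⁻ {a? = i Finₚ.<? f i} b))))
    (λ i j a b → inj i j (proj₁ (∧-true⁻ a)) (proj₁ (∧-true⁻ b)))
  hi≤lo : cnt hi ≤ cnt lo
  hi≤lo = cnt-inj hi lo f
    (λ i h → let a , b = ∧-true⁻ {q i} h in
       ∧-true (qf i a) (⌊⌋-true {a? = f i Finₚ.<? f (f i)} (subst (f i Fin.<_) (sym (ff i a)) (⌊⌋-true⁻ {a? = f i Finₚ.<? i} b))))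
    (λ i j a b → inj i j (proj₁ (∧-true⁻ a)) (proj₁ (∧-true⁻ b)))

findLeast : ∀ {n} {P : Fin n → Set} → (∀ i → Dec (P i)) → ∃ P →
            ∃ λ i → P i × (∀ j → P j → toℕ i ≤ toℕ j)
findLeast {suc n} {P} P? (i , pi) with P? zero
... | yes p0 = zero , p0 , λ _ _ → z≤n
... | no ¬p0 with i | pi
... | zero | p0 = contradiction p0 ¬p0
... | suc i′ | pi′ with findLeast {P = P ∘ suc} (P? ∘ suc) (i′ , pi′)
... | k , pk , least = suc k , pk , λ { zero pj → contradiction pj ¬p0 ; (suc j) pj → s≤s (least j pj) }

-- Equivalence classes of a decidable equivalence on part of Fin n

record Part (n : ℕ) : Set₁ where
  field
    P     : Fin n → Bool
    _≈_   : Fin n → Fin n → Set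
    _≈?_  : ∀ i j → Dec (i ≈ j)
    ≈refl  : ∀ {i} → i ≈ i
    ≈sym   : ∀ {i j} → i ≈ j → j ≈ i
    ≈trans : ∀ {i j k} → i ≈ j → j ≈ k → i ≈ k

  IsRep : Fin n → Set
  IsRep i = P i ≡ true × (∀ j → P j ≡ true → i ≈ j → toℕ i ≤ toℕ j)

  isRep? : ∀ i → Dec (IsRep i)
  isRep? i = (P i ≟ᵇ true) ×-dec
    Finₚ.all? (λ j → (P j ≟ᵇ true) →-dec ((i ≈? j) →-dec (toℕ i ℕ.≤? toℕ j)))

  classes : ℕ
  classes = cnt (λ i → ⌊ isRep? i ⌋)

  rep : ∀ i → P i ≡ true → ∃ λ r → IsRep r × i ≈ r
  rep i pi with findLeast {P = λ j → P j ≡ true × i ≈ j} (λ j → (P j ≟ᵇ true) ×-dec (i ≈? j)) (i , pi , ≈refl)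
  ... | r , (pr , i≈r) , least = r , (pr , λ j pj r≈j → least j (pj , ≈trans i≈r r≈j)) , i≈r

  private
    choose : ∀ i b → P i ≡ b → Fin n
    choose i true  e = proj₁ (rep i e)
    choose i false e = i

    choose-rep : ∀ i b (e : P i ≡ b) → b ≡ true → IsRep (choose i b e) × i ≈ choose i b e
    choose-rep i true e _ = proj₂ (rep i e)

  -- Junk outside P.
  repOf : Fin n → Fin n
  repOf i = choose i (P i) refl

  repOf-rep : ∀ i → P i ≡ true → IsRep (repOf i) × i ≈ repOf i
  repOf-rep i = choose-rep i (P i) refl

  rep-unique : ∀ {i j} → IsRep i → IsRep j → i ≈ j → i ≡ j
  rep-unique (pi , li) (pj , lj) e = Finₚ.toℕ-injective (ℕₚ.≤-antisym (li _ pj e) (lj _ pi (≈sym e)))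

  classes-spec : (p : Fin n → Bool) → (∀ i → p i ≡ true → IsRep i) → (∀ i → IsRep i → p i ≡ true) →
                 cnt p ≡ classes
  classes-spec p f g = cnt-cong (λ i → bool-ext (λ h → ⌊⌋-true {a? = isRep? i} (f i h))
                                                (λ h → g i (⌊⌋-true⁻ {a? = isRep? i} h)))

open Part

-- Followed by the choice of representatives, `g` is injective on representatives because it
-- reflects equivalence.
classes-≤ : ∀ {m n} (C : Part m) (D : Part n) (g : Fin m → Fin n) →
  (∀ i → P C i ≡ true → P D (g i) ≡ true) →
  (∀ i j → P C i ≡ true → P C j ≡ true → _≈_ D (g i) (g j) → _≈_ C i j) → classes C ≤ classes D
classes-≤ {m} {n} C D g gP gR = cnt-inj _ _ f
    (λ i h → let c = ⌊⌋-true⁻ {a? = isRep? C i} h in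
       ⌊⌋-true {a? = isRep? D (f i)} (proj₁ (f-rep i (proj₁ c))))
    (λ i j hi hj e →
      let ci = ⌊⌋-true⁻ {a? = isRep? C i} hi
          cj = ⌊⌋-true⁻ {a? = isRep? C j} hj
      in rep-unique C ci cj (gR i j (proj₁ ci) (proj₁ cj)
           (≈trans D (proj₂ (f-rep i (proj₁ ci)))
             (≈sym D (subst (_≈_ D (g j)) (sym e) (proj₂ (f-rep j (proj₁ cj))))))))
  where
  f : Fin m → Fin n
  f i = repOf D (g i)
  f-rep : ∀ i → P C i ≡ true → IsRep D (f i) × _≈_ D (g i) (f i)
  f-rep i pi = repOf-rep D (g i) (gP i pi)

classes-≡ : ∀ {n} (C D : Part n) → (∀ i → P C i ≡ P D i) →
  (∀ i j → _≈_ C i j → _≈_ D i j) → (∀ i j → _≈_ D i j → _≈_ C i j) → classes C ≡ classes D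
classes-≡ C D p f g = ℕₚ.≤-antisym
  (classes-≤ C D id (λ i h → trans (sym (p i)) h) (λ i j _ _ → g i j))
  (classes-≤ D C id (λ i h → trans (p i) h) (λ i j _ _ → f i j))

restrict : ∀ {n} (C : Part n) → (Fin n → Bool) → Part n
restrict C Q = record { P = λ i → P C i ∧ Q i ; _≈_ = _≈_ C ; _≈?_ = _≈?_ C
                      ; ≈refl = ≈refl C ; ≈sym = ≈sym C ; ≈trans = ≈trans C }

removeClass : ∀ {n} → Part n → Fin n → Part n
removeClass C k = restrict C (λ i → not ⌊ _≈?_ C i k ⌋)

classes-remove : ∀ {n} (C : Part n) k → classes C ≤ suc (classes (removeClass C k))
classes-remove {n} C k with Finₚ.any? (λ r → isRep? C r ×-dec (_≈?_ C r k))
... | yes (r , cr , r≈k) =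
  ℕₚ.≤-trans (ℕₚ.≤-reflexive (cnt-∖ _ r (⌊⌋-true {a? = isRep? C r} cr)))
    (s≤s (cnt-mono _ _ λ i h →
      let hi , i≢r = ∖-true⁻ {q = λ i → ⌊ isRep? C i ⌋} {r} {i} h
          pi , li = ⌊⌋-true⁻ {a? = isRep? C i} hi
          i≉k : ¬ _≈_ C i k
          i≉k = λ i≈k → i≢r (rep-unique C (pi , li) cr (≈trans C i≈k (≈sym C r≈k)))
      in ⌊⌋-true {a? = isRep? (removeClass C k) i}
           (∧-true pi (cong not (⌊⌋-false {a? = _≈?_ C i k} i≉k)) , λ j pj → li j (proj₁ (∧-true⁻ pj)))))
-- `k` need not satisfy `P`; its class may be empty, and then nothing is removed.
... | no none = ℕₚ.≤-trans (cnt-mono _ _ λ i hi →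
      let pi , li = ⌊⌋-true⁻ {a? = isRep? C i} hi
          i≉k : ¬ _≈_ C i k
          i≉k = λ i≈k → none (i , (pi , li) , i≈k)
      in ⌊⌋-true {a? = isRep? (removeClass C k) i}
           (∧-true pi (cong not (⌊⌋-false {a? = _≈?_ C i k} i≉k)) , λ j pj → li j (proj₁ (∧-true⁻ pj))))
    (ℕₚ.n≤1+n _)

-- Once the class of `k` is discarded, the identity reflects equivalence: each `D`-equivalence that
-- fails in `C` has an end in that class.
classes-≤-suc : ∀ {n} (C D : Part n) k → (∀ i → P C i ≡ P D i) →
  (∀ i j → _≈_ D i j → _≈_ C i j ⊎ (_≈_ C i k ⊎ _≈_ C j k)) → classes C ≤ suc (classes D)
classes-≤-suc C D k p h = ℕₚ.≤-trans (classes-remove C k)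
  (s≤s (classes-≤ (removeClass C k) D id (λ i pi → trans (sym (p i)) (proj₁ (∧-true⁻ pi)))
    λ i j pi pj e → case i j pi pj (h i j e)))
  where
  far : ∀ i → P (removeClass C k) i ≡ true → ¬ _≈_ C i k
  far i pi i≈k = true≢false (trans (sym (proj₂ (∧-true⁻ {P C i} pi))) (cong not (⌊⌋-true {a? = _≈?_ C i k} i≈k)))
  case : ∀ i j → P (removeClass C k) i ≡ true → P (removeClass C k) j ≡ true →
         _≈_ C i j ⊎ (_≈_ C i k ⊎ _≈_ C j k) → _≈_ C i j
  case i j pi pj (inj₁ e) = e
  case i j pi pj (inj₂ (inj₁ e)) = contradiction e (far i pi)
  case i j pi pj (inj₂ (inj₂ e)) = contradiction e (far j pj)

-- `back` makes `g` an involution on the classes and `away` deprives it of fixed points, so the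
-- classes come in pairs.
classes-even : ∀ {n} (C : Part n) (g : Fin n → Fin n) → (∀ i → P C i ≡ true → P C (g i) ≡ true) →
  (∀ i j → _≈_ C (g i) j → _≈_ C (g j) i) → (∀ i → ¬ _≈_ C (g i) i) → ∃ λ k → classes C ≡ k + k
classes-even {n} C g gP back away = cnt-even (λ i → ⌊ isRep? C i ⌋) f
  (λ i h → ⌊⌋-true {a? = isRep? C (f i)} (proj₁ (f-rep i (un i h))))
  (λ i h → let c = un i h ; c′ , r = f-rep i c in
     rep-unique C (proj₁ (f-rep (f i) c′)) c (≈trans C (≈sym C (proj₂ (f-rep (f i) c′))) (back i (f i) r)))
  (λ i h e → away i (subst (_≈_ C (g i)) e (proj₂ (f-rep i (un i h)))))
  where
  un : ∀ i → ⌊ isRep? C i ⌋ ≡ true → IsRep C i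
  un i = ⌊⌋-true⁻ {a? = isRep? C i}
  f : Fin n → Fin n
  f i = repOf C (g i)
  f-rep : ∀ i → IsRep C i → IsRep C (f i) × _≈_ C (g i) (f i)
  f-rep i c = repOf-rep C (g i) (gP i (proj₁ c))

-- Each `C`-class is sent to the `D`-class of its representative. The class of `a` and `b` breaks up
-- in `D`, and one of its pieces is not hit.
classes-< : ∀ {n} (C D : Part n) a b → (∀ i → P C i ≡ P D i) → (∀ i j → _≈_ D i j → _≈_ C i j) →
  P D a ≡ true → P D b ≡ true → _≈_ C a b → ¬ _≈_ D a b → suc (classes C) ≤ classes D
classes-< {n} C D a b p D⊆C pa pb a≈b a≉b = cnt-inj-< _ _ f miss fwd inj missRep avoid
  where
  f : Fin n → Fin n
  f = repOf D
  f-rep : ∀ i → P D i ≡ true → IsRep D (f i) × _≈_ D i (f i)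
  f-rep = repOf-rep D
  fwd : ∀ i → ⌊ isRep? C i ⌋ ≡ true → ⌊ isRep? D (f i) ⌋ ≡ true
  fwd i h = let pi , _ = ⌊⌋-true⁻ {a? = isRep? C i} h in
    ⌊⌋-true {a? = isRep? D (f i)} (proj₁ (f-rep i (trans (sym (p i)) pi)))
  near : ∀ i → P C i ≡ true → _≈_ D i (f i)
  near i pi = proj₂ (f-rep i (trans (sym (p i)) pi))
  inj : ∀ i j → ⌊ isRep? C i ⌋ ≡ true → ⌊ isRep? C j ⌋ ≡ true → f i ≡ f j → i ≡ j
  inj i j hi hj e =
    let ci = ⌊⌋-true⁻ {a? = isRep? C i} hi
        cj = ⌊⌋-true⁻ {a? = isRep? C j} hj
    in rep-unique C ci cj (D⊆C i j (≈trans D (near i (proj₁ ci)) (≈sym D (subst (_≈_ D j) (sym e) (near j (proj₁ cj))))))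
  r : Fin n
  r = proj₁ (rep C a (trans (p a) pa))
  cr : IsRep C r
  cr = proj₁ (proj₂ (rep C a (trans (p a) pa)))
  a≈r : _≈_ C a r
  a≈r = proj₂ (proj₂ (rep C a (trans (p a) pa)))
  -- The C-class of a and b splits in D; its C-representative r is D-inequivalent to a or to b.
  target : ∃ λ t → P D t ≡ true × _≈_ C t r × ¬ _≈_ D r t
  target with _≈?_ D r a
  ... | yes r≈a = b , pb , ≈trans C (≈sym C a≈b) a≈r , λ r≈b → a≉b (≈trans D (≈sym D r≈a) r≈b)
  ... | no r≉a = a , pa , a≈r , r≉a
  t : Fin n
  t = proj₁ target
  miss : Fin n
  miss = f t
  t≈miss : _≈_ D t miss
  t≈miss = proj₂ (f-rep t (proj₁ (proj₂ target)))
  missRep : ⌊ isRep? D miss ⌋ ≡ true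
  missRep = ⌊⌋-true {a? = isRep? D miss} (proj₁ (f-rep t (proj₁ (proj₂ target))))
  avoid : ∀ i → ⌊ isRep? C i ⌋ ≡ true → f i ≢ miss
  avoid i hi e =
    let ci = ⌊⌋-true⁻ {a? = isRep? C i} hi
        i≈t : _≈_ D i t
        i≈t = ≈trans D (near i (proj₁ ci)) (subst (λ z → _≈_ D z t) (sym e) (≈sym D t≈miss))
        i≡r = rep-unique C ci cr (≈trans C (D⊆C i t i≈t) (proj₁ (proj₂ (proj₂ target))))
    in proj₂ (proj₂ (proj₂ target)) (subst (λ z → _≈_ D z t) i≡r i≈t)

-- The sum of bits says at once that `Q` and `R` cover `P` and are disjoint. Both being closed under
-- equivalence, a representative for one of them is a representative for `P`.
classes-split : ∀ {n} (C : Part n) (Q R : Fin n → Bool) →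
  (∀ i → bit (P C i) ≡ bit (Q i) + bit (R i)) →
  (∀ i j → Q i ≡ true → P C j ≡ true → _≈_ C i j → Q j ≡ true) →
  (∀ i j → R i ≡ true → P C j ≡ true → _≈_ C i j → R j ≡ true) →
  classes C ≡ classes (restrict C Q) + classes (restrict C R)
classes-split C Q R pqr closedQ closedR = trans (Sum-cong eq)
  (Sum-+ (λ i → bit ⌊ isRep? (restrict C Q) i ⌋) (λ i → bit ⌊ isRep? (restrict C R) i ⌋))
  where
  keep : ∀ S i → (∀ i j → S i ≡ true → P C j ≡ true → _≈_ C i j → S j ≡ true) → S i ≡ true →
         ⌊ isRep? C i ⌋ ≡ ⌊ isRep? (restrict C S) i ⌋
  keep S i closed si = bool-ext
    (λ h → let pi , li = ⌊⌋-true⁻ {a? = isRep? C i} h in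
      ⌊⌋-true {a? = isRep? (restrict C S) i} (∧-true pi si , λ j pj → li j (proj₁ (∧-true⁻ pj))))
    (λ h → let pi , li = ⌊⌋-true⁻ {a? = isRep? (restrict C S) i} h in
      ⌊⌋-true {a? = isRep? C i} (proj₁ (∧-true⁻ pi) , λ j pj e → li j (∧-true pj (closed i j si pj e)) e))
  drop : ∀ S i → S i ≡ false → ⌊ isRep? (restrict C S) i ⌋ ≡ false
  drop S i si = ⌊⌋-false {a? = isRep? (restrict C S) i}
    (λ { (pi , _) → true≢false (trans (sym (proj₂ (∧-true⁻ {P C i} pi))) si) })
  eq : ∀ i → bit ⌊ isRep? C i ⌋ ≡ bit ⌊ isRep? (restrict C Q) i ⌋ + bit ⌊ isRep? (restrict C R) i ⌋
  eq i = go (P C i) (Q i) (R i) refl refl refl (pqr i)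
    where
    go : ∀ c a b → P C i ≡ c → Q i ≡ a → R i ≡ b → bit c ≡ bit a + bit b →
         bit ⌊ isRep? C i ⌋ ≡ bit ⌊ isRep? (restrict C Q) i ⌋ + bit ⌊ isRep? (restrict C R) i ⌋
    go true true false _ qi ri _ = trans (cong bit (keep Q i closedQ qi))
      (trans (sym (ℕₚ.+-identityʳ _)) (cong (λ z → bit ⌊ isRep? (restrict C Q) i ⌋ + bit z) (sym (drop R i ri))))
    go true false true _ qi ri _ = trans (cong bit (keep R i closedR ri))
      (cong (λ z → bit z + bit ⌊ isRep? (restrict C R) i ⌋) (sym (drop Q i qi)))
    go false false false pi qi ri _ =
      trans (cong bit (⌊⌋-false {a? = isRep? C i} λ { (h , _) → true≢false (trans (sym h) pi) }))
            (cong₂ (λ a b → bit a + bit b) (sym (drop Q i qi)) (sym (drop R i ri)))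

-- Orbits of permutations

iter-+ : ∀ {A : Set} (f : A → A) j k a → iter f (j + k) a ≡ iter f j (iter f k a)
iter-+ f zero    k a = refl
iter-+ f (suc j) k a = cong f (iter-+ f j k a)

iter-comm : ∀ {A : Set} (f : A → A) k a → iter f k (f a) ≡ f (iter f k a)
iter-comm f zero    a = refl
iter-comm f (suc k) a = cong f (iter-comm f k a)

iter-injective : ∀ {A : Set} {f : A → A} → (∀ {a b} → f a ≡ f b → a ≡ b) →
                 ∀ k {a b} → iter f k a ≡ iter f k b → a ≡ b
iter-injective inj zero    e = e
iter-injective inj (suc k) e = iter-injective inj k (inj e)

_⊢_~_ : ∀ {A : Set} → (A → A) → A → A → Set
f ⊢ a ~ b = ∃ λ k → iter f k a ≡ b

module _ {A : Set} {f : A → A} where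

  ~refl : ∀ {a} → f ⊢ a ~ a
  ~refl = 0 , refl

  ~trans : ∀ {a b c} → f ⊢ a ~ b → f ⊢ b ~ c → f ⊢ a ~ c
  ~trans {a} (j , refl) (k , refl) = k + j , iter-+ f k j a

  ~step : ∀ {a} → f ⊢ a ~ f a
  ~step = 1 , refl

  ~invariant : ∀ {L : Set} (ℓ : A → L) → (∀ t → ℓ (f t) ≡ ℓ t) → ∀ {a b} → f ⊢ a ~ b → ℓ a ≡ ℓ b
  ~invariant ℓ h (zero  , refl) = refl
  ~invariant ℓ h (suc k , refl) = trans (~invariant ℓ h (k , refl)) (sym (h _))

~agree : ∀ {A : Set} {f g : A → A} (Q : A → Set) → (∀ t → Q t → Q (f t)) → (∀ t → Q t → f t ≡ g t) →
         ∀ {a b} → Q a → f ⊢ a ~ b → g ⊢ a ~ b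
~agree {f = f} {g} Q closed agree {a} qa (k , refl) = k , sym (proj₂ (go k))
  where
  go : ∀ k → Q (iter f k a) × iter f k a ≡ iter g k a
  go zero    = qa , refl
  go (suc k) = let q , e = go k in closed _ q , trans (agree _ q) (cong g e)

~cong : ∀ {A : Set} {f g : A → A} → (∀ t → f t ≡ g t) → ∀ {a b} → f ⊢ a ~ b → g ⊢ a ~ b
~cong h = ~agree (λ _ → ⊤) (λ _ q → q) (λ t _ → h t) tt

record Finite (A : Set) (n : ℕ) : Set where
  field
    enc     : A → Fin n
    dec     : Fin n → A
    dec-enc : ∀ a → dec (enc a) ≡ a
    enc-dec : ∀ i → enc (dec i) ≡ i

record Perm (A : Set) : Set where
  field
    fn  : A → A
    inj : ∀ {a b} → fn a ≡ fn b → a ≡ b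
open Perm

record Match (A : Set) : Set where
  field
    app   : A → A
    invol : ∀ a → app (app a) ≡ a
    nofix : ∀ a → app a ≢ a

  app-inj : ∀ {a b} → app a ≡ app b → a ≡ b
  app-inj {a} {b} e = trans (sym (invol a)) (trans (cong app e) (invol b))

  adj : ∀ {a b} → app a ≡ b → a ≡ app b
  adj {a} refl = sym (invol a)
open Match

perm : ∀ {A} → Match A → Match A → Perm A
perm κ ƛ = record { fn = app κ ∘ app ƛ ; inj = app-inj ƛ ∘ app-inj κ }

module Orbits {A : Set} {n : ℕ} (F : Finite A n) where
  open Finite F

  enc-inj : ∀ {a b} → enc a ≡ enc b → a ≡ b
  enc-inj {a} {b} e = trans (sym (dec-enc a)) (trans (cong dec e) (dec-enc b))

  _≟ᴬ_ : (a b : A) → Dec (a ≡ b)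
  a ≟ᴬ b = map′ enc-inj (cong enc) (enc a ≟ enc b)

  any-dec : {P : A → Set} → (∀ a → Dec (P a)) → Dec (∃ P)
  any-dec {P} P? = map′ (λ (i , p) → dec i , p) (λ (a , p) → enc a , subst P (sym (dec-enc a)) p)
                        (Finₚ.any? (λ i → P? (dec i)))

  period : (π : Perm A) → ∀ a → ∃ λ m → 0 < m × m ≤ n × iter (fn π) m a ≡ a
  period π a with Finₚ.pigeonhole (ℕₚ.n<1+n n) (λ i → enc (iter (fn π) (toℕ i) a))
  ... | i , j , i<j , e = toℕ j ∸ toℕ i , ℕₚ.m<n⇒0<n∸m i<j
      , ℕₚ.≤-trans (ℕₚ.m∸n≤m (toℕ j) (toℕ i)) (ℕₚ.≤-pred (Finₚ.toℕ<n j))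
      , iter-injective (inj π) (toℕ i) (begin
          iter (fn π) (toℕ i) (iter (fn π) (toℕ j ∸ toℕ i) a) ≡⟨ iter-+ (fn π) (toℕ i) _ a ⟨
          iter (fn π) (toℕ i + (toℕ j ∸ toℕ i)) a ≡⟨ cong (λ k → iter (fn π) k a) (ℕₚ.m+[n∸m]≡n (ℕₚ.<⇒≤ i<j)) ⟩
          iter (fn π) (toℕ j) a ≡⟨ enc-inj e ⟨
          iter (fn π) (toℕ i) a ∎)
    where open ≡-Reasoning

  reduce : (π : Perm A) → ∀ a m → 0 < m → iter (fn π) m a ≡ a →
           ∀ k → ∃ λ k′ → k′ < m × iter (fn π) k′ a ≡ iter (fn π) k a
  reduce π a m 0<m e zero = 0 , 0<m , refl
  reduce π a m 0<m e (suc k) with reduce π a m 0<m e k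
  ... | k′ , k′<m , e′ with suc k′ ℕₚ.<? m
  ... | yes lt = suc k′ , lt , cong (fn π) e′
  ... | no ¬lt = 0 , 0<m , trans (sym e) (trans (cong (λ z → iter (fn π) z a) (ℕₚ.≤-antisym (ℕₚ.≮⇒≥ ¬lt) k′<m)) (cong (fn π) e′))

  ~bounded : (π : Perm A) → ∀ {a b} → fn π ⊢ a ~ b → ∃ λ k → k < n × iter (fn π) k a ≡ b
  ~bounded π {a} (k , refl) =
    let m , 0<m , m≤n , e = period π a
        k′ , k′<m , e′ = reduce π a m 0<m e k
    in k′ , ℕₚ.<-≤-trans k′<m m≤n , e′

  ~sym : (π : Perm A) → ∀ {a b} → fn π ⊢ a ~ b → fn π ⊢ b ~ a
  ~sym π {a} (k , refl) =
    let m , 0<m , _ , e = period π a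
        k′ , k′<m , e′ = reduce π a m 0<m e k
    in m ∸ k′ , trans (cong (iter (fn π) (m ∸ k′)) (sym e′))
         (trans (sym (iter-+ (fn π) (m ∸ k′) k′ a))
           (trans (cong (λ z → iter (fn π) z a) (ℕₚ.m∸n+n≡m (ℕₚ.<⇒≤ k′<m))) e))

  ~dec : (π : Perm A) → ∀ a b → Dec (fn π ⊢ a ~ b)
  ~dec π a b = map′ (λ (i , e) → toℕ i , e)
    (λ r → let k , k<n , e = ~bounded π r in fromℕ< k<n , trans (cong (λ z → iter (fn π) z a) (Finₚ.toℕ-fromℕ< k<n)) e)
    (Finₚ.any? (λ i → iter (fn π) (toℕ i) a ≟ᴬ b))

  orbPart : (A → Bool) → Perm A → Part n
  orbPart Q π = record
    { P = Q ∘ dec ; _≈_ = λ i j → fn π ⊢ dec i ~ dec j ; _≈?_ = λ i j → ~dec π (dec i) (dec j)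
    ; ≈refl = ~refl ; ≈sym = ~sym π ; ≈trans = ~trans }

  opaque
    orbOn : (A → Bool) → Perm A → ℕ
    orbOn Q π = classes (orbPart Q π)

    orbOn-spec : (Q : A → Bool) (π : Perm A) (p : Fin n → Bool) →
      (∀ i → p i ≡ true → IsRep (orbPart Q π) i) → (∀ i → IsRep (orbPart Q π) i → p i ≡ true) → cnt p ≡ orbOn Q π
    orbOn-spec Q π = classes-spec (orbPart Q π)

    orbOn-bounded : (Q : A → Bool) (π : Perm A) → orbOn Q π ≤ n
    orbOn-bounded Q π = cnt-≤ (λ i → ⌊ isRep? (orbPart Q π) i ⌋)

    orbOn-split : (Q Q₁ Q₂ : A → Bool) (π : Perm A) → (∀ t → bit (Q t) ≡ bit (Q₁ t) + bit (Q₂ t)) →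
      (∀ t → Q₁ t ≡ true → Q₁ (fn π t) ≡ true) → (∀ t → Q₂ t ≡ true → Q₂ (fn π t) ≡ true) →
      orbOn Q π ≡ orbOn Q₁ π + orbOn Q₂ π
    orbOn-split Q Q₁ Q₂ π h c₁ c₂ = trans
      (classes-split (orbPart Q π) (Q₁ ∘ dec) (Q₂ ∘ dec) (h ∘ dec) (λ i j q _ r → closed Q₁ c₁ q r) (λ i j q _ r → closed Q₂ c₂ q r))
      (cong₂ _+_ (classes-≡ (restrict (orbPart Q π) (Q₁ ∘ dec)) (orbPart Q₁ π) (λ i → absorb₁ (Q (dec i)) _ _ (h (dec i))) (λ _ _ r → r) (λ _ _ r → r))
                 (classes-≡ (restrict (orbPart Q π) (Q₂ ∘ dec)) (orbPart Q₂ π) (λ i → absorb₂ (Q (dec i)) _ _ (h (dec i))) (λ _ _ r → r) (λ _ _ r → r)))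
      where
      closed : (R : A → Bool) → (∀ t → R t ≡ true → R (fn π t) ≡ true) → ∀ {a b} → R a ≡ true → fn π ⊢ a ~ b → R b ≡ true
      closed R c q (zero , refl) = q
      closed R c q (suc k , refl) = c _ (closed R c q (k , refl))
      absorb₁ : ∀ p q r → bit p ≡ bit q + bit r → p ∧ q ≡ q
      absorb₁ true  _     _ _ = refl
      absorb₁ false false _ _ = refl
      absorb₂ : ∀ p q r → bit p ≡ bit q + bit r → p ∧ r ≡ r
      absorb₂ true  _     _     _ = refl
      absorb₂ false _     false _ = refl
      absorb₂ false false true  ()

    orbOn-fixed : (Q : A → Bool) (π : Perm A) → (∀ t → Q t ≡ true → fn π t ≡ t) → orbOn Q π ≡ cnt (Q ∘ dec)
    orbOn-fixed Q π h = sym (classes-spec (orbPart Q π) (Q ∘ dec)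
      (λ i q → q , λ j q′ r → ℕₚ.≤-reflexive (cong toℕ (trans (sym (enc-dec i)) (trans (cong enc (still q r)) (enc-dec j)))))
      (λ i → proj₁))
      where
      still : ∀ {a b} → Q a ≡ true → fn π ⊢ a ~ b → a ≡ b
      still q (zero , refl) = refl
      still q (suc k , refl) = trans (sym (h _ q)) (cong (fn π) (still q (k , refl)))

    orbOn-≤ : (Q R : A → Bool) (π ρ : Perm A) (g : A → A) → (∀ a → Q a ≡ true → R (g a) ≡ true) →
      (∀ a b → Q a ≡ true → Q b ≡ true → fn ρ ⊢ g a ~ g b → fn π ⊢ a ~ b) → orbOn Q π ≤ orbOn R ρ
    orbOn-≤ Q R π ρ g gQ gR = classes-≤ (orbPart Q π) (orbPart R ρ) (λ i → enc (g (dec i)))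
      (λ i q → trans (cong R (dec-enc _)) (gQ _ q))
      (λ i j qi qj e → gR _ _ qi qj (subst (fn ρ ⊢_~ g (dec j)) (dec-enc _) (subst (fn ρ ⊢ dec (enc (g (dec i))) ~_) (dec-enc _) e)))

  orb : Perm A → ℕ
  orb = orbOn (λ _ → true)

  orb-≤ : (π ρ : Perm A) (g : A → A) → (∀ a b → fn ρ ⊢ g a ~ g b → fn π ⊢ a ~ b) → orb π ≤ orb ρ
  orb-≤ π ρ g h = orbOn-≤ _ _ π ρ g (λ _ _ → refl) (λ a b _ _ → h a b)

  orb-cong : (π ρ : Perm A) → (∀ a → fn π a ≡ fn ρ a) → orb π ≡ orb ρ
  orb-cong π ρ h = ℕₚ.≤-antisym (orb-≤ π ρ id (λ a b → ~cong (sym ∘ h))) (orb-≤ ρ π id (λ a b → ~cong h))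

  opaque
    swap : A → A → A → A
    swap a b t = if ⌊ t ≟ᴬ a ⌋ then b else if ⌊ t ≟ᴬ b ⌋ then a else t

  data SwapView (a b t : A) : A → Set where
    isˡ : t ≡ a → SwapView a b t b
    isʳ : t ≡ b → SwapView a b t a
    isOff : t ≢ a → t ≢ b → SwapView a b t t

  opaque
    unfolding swap

    swap-view : ∀ a b t → SwapView a b t (swap a b t)
    swap-view a b t with t ≟ᴬ a
    ... | yes e = isˡ e
    ... | no ne with t ≟ᴬ b
    ... | yes e = isʳ e
    ... | no ne′ = isOff ne ne′

  swap-off : ∀ {a b t} → t ≢ a → t ≢ b → swap a b t ≡ t
  swap-off {a} {b} {t} p q with swap a b t | swap-view a b t
  ... | _ | isˡ e = contradiction e p
  ... | _ | isʳ e = contradiction e q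
  ... | _ | isOff _ _ = refl

  swap-l : ∀ a b → swap a b a ≡ b
  swap-l a b with swap a b a | swap-view a b a
  ... | _ | isˡ _ = refl
  ... | _ | isʳ e = e
  ... | _ | isOff ne _ = contradiction refl ne

  swap-r : ∀ a b → swap a b b ≡ a
  swap-r a b with swap a b b | swap-view a b b
  ... | _ | isˡ e = e
  ... | _ | isʳ _ = refl
  ... | _ | isOff _ ne = contradiction refl ne

  swap-swap : ∀ a b t → swap a b (swap a b t) ≡ t
  swap-swap a b t with swap a b t | swap-view a b t
  ... | _ | isˡ refl = swap-r t b
  ... | _ | isʳ refl = swap-l a t
  ... | _ | isOff p q = swap-off p q

  swap-inj : ∀ a b {s t} → swap a b s ≡ swap a b t → s ≡ t
  swap-inj a b {s} {t} e = trans (sym (swap-swap a b s)) (trans (cong (swap a b) e) (swap-swap a b t))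

  swap-label : ∀ {L : Set} (ℓ : A → L) a b → ℓ a ≡ ℓ b → ∀ t → ℓ (swap a b t) ≡ ℓ t
  swap-label ℓ a b e t with swap a b t | swap-view a b t
  ... | _ | isˡ refl = sym e
  ... | _ | isʳ refl = e
  ... | _ | isOff _ _ = refl

  swap-same : ∀ a t → swap a a t ≡ t
  swap-same a t with swap a a t | swap-view a a t
  ... | _ | isˡ e = sym e
  ... | _ | isʳ e = sym e
  ... | _ | isOff _ _ = refl

  swap-conj : (f : A → A) → (∀ {s t} → f s ≡ f t → s ≡ t) → ∀ a b t → f (swap a b t) ≡ swap (f a) (f b) (f t)
  swap-conj f f-inj a b t with swap a b t | swap-view a b t
  ... | _ | isˡ refl = sym (swap-l (f t) (f b))
  ... | _ | isʳ refl = sym (swap-r (f a) (f t))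
  ... | _ | isOff p q = sym (swap-off (p ∘ f-inj) (q ∘ f-inj))

  swapP : A → A → Perm A → Perm A
  swapP a b π = record { fn = swap a b ∘ fn π ; inj = inj π ∘ swap-inj a b }

  minPeriod : ∀ a (π : Perm A) → ∃ λ k → iter (fn π) (suc k) a ≡ a × (∀ l → l < k → iter (fn π) (suc l) a ≢ a)
  minPeriod a π with findLeast {P = λ i → iter (fn π) (suc (toℕ {n} i)) a ≡ a} (λ i → iter (fn π) (suc (toℕ i)) a ≟ᴬ a)
                      (let m , 0<m , m≤n , e = period π a in start m 0<m m≤n e)
    where
    start : ∀ m → 0 < m → m ≤ n → iter (fn π) m a ≡ a → ∃ λ i → iter (fn π) (suc (toℕ {n} i)) a ≡ a
    start (suc m) _ m<n e = fromℕ< m<n , trans (cong (λ z → iter (fn π) (suc z) a) (Finₚ.toℕ-fromℕ< m<n)) e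
  ... | i , e , least = toℕ i , e , early
    where
    early : ∀ l → l < toℕ i → iter (fn π) (suc l) a ≢ a
    early l l<i e′ = ℕₚ.<⇒≱ l<i (subst (toℕ i ≤_) (Finₚ.toℕ-fromℕ< l<n)
        (least (fromℕ< l<n) (trans (cong (λ z → iter (fn π) (suc z) a) (Finₚ.toℕ-fromℕ< l<n)) e′)))
      where l<n = ℕₚ.<-trans l<i (Finₚ.toℕ<n i)

  module _ (a b : A) (π : Perm A) where
    private
      ρ = swapP a b π

      Near : A → Set
      Near t = fn π ⊢ t ~ a ⊎ fn π ⊢ t ~ b

    -- A walk of `ρ` follows `π` until it is diverted to `a` or `b`; from then on it stays in the
    -- `π`-orbits of these two, so no other orbit changes.
    swapP-~ : ∀ {s t} → fn ρ ⊢ s ~ t → fn π ⊢ s ~ t ⊎ (Near s × Near t)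
    swapP-~ {s} (k , refl) = go k
      where
      go : ∀ k → fn π ⊢ s ~ iter (fn ρ) k s ⊎ (Near s × Near (iter (fn ρ) k s))
      go zero = inj₁ ~refl
      go (suc k) with swap a b (fn π (iter (fn ρ) k s)) | swap-view a b (fn π (iter (fn ρ) k s)) | go k
      ... | _ | isˡ e | inj₁ r = inj₂ (inj₁ (~trans r (1 , e)) , inj₂ ~refl)
      ... | _ | isˡ e | inj₂ (x , _) = inj₂ (x , inj₂ ~refl)
      ... | _ | isʳ e | inj₁ r = inj₂ (inj₂ (~trans r (1 , e)) , inj₁ ~refl)
      ... | _ | isʳ e | inj₂ (x , _) = inj₂ (x , inj₁ ~refl)
      ... | _ | isOff _ _ | inj₁ r = inj₁ (~trans r ~step)
      ... | _ | isOff _ _ | inj₂ (x , inj₁ y) = inj₂ (x , inj₁ (~trans (~sym π ~step) y))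
      ... | _ | isOff _ _ | inj₂ (x , inj₂ y) = inj₂ (x , inj₂ (~trans (~sym π ~step) y))

    opaque
      unfolding orbOn

      -- At worst the orbits of `a` and `b` merge.
      orb-swap-≤ : orb π ≤ suc (orb ρ)
      orb-swap-≤ = classes-≤-suc (orbPart _ π) (orbPart _ ρ) (enc a) (λ _ → refl)
        (λ i j r → case (dec i) (dec j) (swapP-~ r))
        where
        ↑ : ∀ {t} → fn π ⊢ t ~ a → fn π ⊢ t ~ dec (enc a)
        ↑ = subst (fn π ⊢ _ ~_) (sym (dec-enc a))
        case : ∀ s t → fn π ⊢ s ~ t ⊎ (Near s × Near t) →
               fn π ⊢ s ~ t ⊎ (fn π ⊢ s ~ dec (enc a) ⊎ fn π ⊢ t ~ dec (enc a))
        case s t (inj₁ r) = inj₁ r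
        case s t (inj₂ (inj₁ x , y)) = inj₂ (inj₁ (↑ x))
        case s t (inj₂ (inj₂ x , inj₁ y)) = inj₂ (inj₂ (↑ y))
        case s t (inj₂ (inj₂ x , inj₂ y)) = inj₁ (~trans x (~sym π y))

    private
      firstHit : ∀ c → fn π ⊢ a ~ c → a ≢ c → ∃ λ k → 0 < k × iter (fn π) k a ≡ c ×
                 (∀ l → 0 < l → l < k → iter (fn π) l a ≢ c × iter (fn π) l a ≢ a)
      firstHit c r a≢c with findLeast {P = λ i → iter (fn π) (toℕ {n} i) a ≡ c} (λ i → iter (fn π) (toℕ i) a ≟ᴬ c)
        (let k , k<n , e = ~bounded π r in fromℕ< k<n , trans (cong (λ z → iter (fn π) z a) (Finₚ.toℕ-fromℕ< k<n)) e)
      ... | i , e , least = toℕ i , pos (toℕ i) e , e , λ l 0<l l<i → early l l<i , return l 0<l l<i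
        where
        pos : ∀ k → iter (fn π) k a ≡ c → 0 < k
        pos zero e = contradiction e a≢c
        pos (suc k) _ = s≤s z≤n
        early : ∀ l → l < toℕ i → iter (fn π) l a ≢ c
        early l l<i e′ = ℕₚ.<⇒≱ l<i (subst (toℕ i ≤_) (Finₚ.toℕ-fromℕ< l<n)
            (least (fromℕ< l<n) (trans (cong (λ z → iter (fn π) z a) (Finₚ.toℕ-fromℕ< l<n)) e′)))
          where l<n = ℕₚ.<-trans l<i (Finₚ.toℕ<n i)
        return : ∀ l → 0 < l → l < toℕ i → iter (fn π) l a ≢ a
        -- A return to `a` after `l` steps would bring the visit to `c` forward by `l` steps.
        return l 0<l l<i e′ = early (toℕ i ∸ l) (ℕₚ.∸-monoʳ-< 0<l (ℕₚ.<⇒≤ l<i))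
          (trans (cong (iter (fn π) (toℕ i ∸ l)) (sym e′))
            (trans (sym (iter-+ (fn π) (toℕ i ∸ l) l a))
              (trans (cong (λ z → iter (fn π) z a) (ℕₚ.m∸n+n≡m (ℕₚ.<⇒≤ l<i))) e)))

    -- After the swap the orbit of a closes up on the iterates that precede the first visit to b.
    swap-separates : a ≢ b → fn π ⊢ a ~ b → ¬ (fn ρ ⊢ a ~ b)
    swap-separates a≢b r (m , e) =
      let k , 0<k , hit , before = firstHit b r a≢b
          l , l<k , e′ = stay k 0<k hit before m
      in bad k 0<k before l l<k (trans e′ e)
      where
      stay : ∀ k → 0 < k → iter (fn π) k a ≡ b →
             (∀ l → 0 < l → l < k → iter (fn π) l a ≢ b × iter (fn π) l a ≢ a) →
             ∀ m → ∃ λ l → l < k × iter (fn π) l a ≡ iter (fn ρ) m a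
      stay k 0<k hit before zero = 0 , 0<k , refl
      stay k 0<k hit before (suc m) with stay k 0<k hit before m
      ... | l , l<k , e′ with suc l ℕₚ.<? k
      ... | yes lt = suc l , lt , sym (trans (cong (swap a b ∘ fn π) (sym e′))
                       (swap-off (proj₂ (before (suc l) (s≤s z≤n) lt)) (proj₁ (before (suc l) (s≤s z≤n) lt))))
      ... | no ¬lt = 0 , 0<k , sym (trans (cong (swap a b ∘ fn π) (sym e′))
                       (trans (cong (λ z → swap a b (iter (fn π) z a)) (ℕₚ.≤-antisym l<k (ℕₚ.≮⇒≥ ¬lt)))
                         (trans (cong (swap a b) hit) (swap-r a b))))
      bad : ∀ k → 0 < k → (∀ l → 0 < l → l < k → iter (fn π) l a ≢ b × iter (fn π) l a ≢ a) →
            ∀ l → l < k → iter (fn π) l a ≡ b → ⊥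
      bad k 0<k before zero _ e = a≢b e
      bad k 0<k before (suc l) lt e = proj₁ (before (suc l) (s≤s z≤n) lt) e

    opaque
      unfolding orbOn

      orb-swap-split : a ≢ b → fn π ⊢ a ~ b → suc (orb π) ≤ orb ρ
      orb-swap-split a≢b r = classes-< (orbPart _ π) (orbPart _ ρ) (enc a) (enc b) (λ _ → refl)
        (λ i j e → collapse (swapP-~ e)) refl refl
        (subst (fn π ⊢ _ ~_) (sym (dec-enc b)) (subst (fn π ⊢_~ b) (sym (dec-enc a)) r))
        (λ e → swap-separates a≢b r (subst (fn ρ ⊢ a ~_) (dec-enc b) (subst (fn ρ ⊢_~ dec (enc b)) (dec-enc a) e)))
        where
        toA : ∀ {t} → Near t → fn π ⊢ t ~ a
        toA (inj₁ x) = x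
        toA (inj₂ x) = ~trans x (~sym π r)
        collapse : ∀ {s t} → fn π ⊢ s ~ t ⊎ (Near s × Near t) → fn π ⊢ s ~ t
        collapse (inj₁ e) = e
        collapse (inj₂ (x , y)) = ~trans (toA x) (~sym π (toA y))

    -- The orbit of `a` is followed under `π` until it is about to return to `a`. It has not met
    -- `b`, and the transposition now sends it there.
    swap-joins : ¬ (fn π ⊢ a ~ b) → fn ρ ⊢ a ~ b
    swap-joins a≁b with minPeriod a π
    ... | k , e , before = suc k , trans (cong (swap a b ∘ fn π) (follow k ℕₚ.≤-refl)) (trans (cong (swap a b) e) (swap-l a b))
      where
      follow : ∀ l → l ≤ k → iter (fn ρ) l a ≡ iter (fn π) l a
      follow zero _ = refl
      follow (suc l) lt = trans (cong (swap a b ∘ fn π) (follow l (ℕₚ.<⇒≤ lt)))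
        (swap-off (before l lt) (λ h → a≁b (suc l , h)))

  -- Swapping twice restores `π`, so a merger is a split read backwards.
  orb-swap-merge : ∀ a b (π : Perm A) → ¬ (fn π ⊢ a ~ b) → suc (orb (swapP a b π)) ≤ orb π
  orb-swap-merge a b π a≁b = ℕₚ.≤-trans
    (orb-swap-split a b (swapP a b π) (λ { refl → a≁b ~refl }) (swap-joins a b π a≁b))
    (ℕₚ.≤-reflexive (orb-cong (swapP a b (swapP a b π)) π (λ t → swap-swap a b (fn π t))))

-- Perfect matchings

module Matchings {A : Set} {n : ℕ} (F : Finite A n) where
  open Finite F
  open Orbits F

  orb₂ : Match A → Match A → ℕ
  orb₂ κ ε = orb (perm κ ε)

  _∙_⊢_≈_ : Match A → Match A → A → A → Set
  κ ∙ ε ⊢ a ≈ b = fn (perm κ ε) ⊢ a ~ b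

  orbOn-conj-≤ : (Q R : A → Bool) (π ρ : Perm A) (h : A → A) → (∀ t → h (h t) ≡ t) →
    (∀ t → Q t ≡ true → R (h t) ≡ true) → (∀ t → R t ≡ true → R (fn ρ t) ≡ true) →
    (∀ t → R t ≡ true → h (fn ρ t) ≡ fn π (h t)) → orbOn Q π ≤ orbOn R ρ
  orbOn-conj-≤ Q R π ρ h hh QR closed comm = orbOn-≤ Q R π ρ h QR
    (λ a b qa _ r → let k , e = r in k , trans (sym (proj₂ (conj-iter k a qa))) (trans (cong h e) (hh b)))
    where
    conj-iter : ∀ k a → Q a ≡ true → R (iter (fn ρ) k (h a)) ≡ true × h (iter (fn ρ) k (h a)) ≡ iter (fn π) k a
    conj-iter zero a qa = QR a qa , hh a
    conj-iter (suc k) a qa = let r , e = conj-iter k a qa in closed _ r , trans (comm _ r) (cong (fn π) e)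

  orbOn-conj : (Q R : A → Bool) (π ρ : Perm A) (h : A → A) → (∀ t → h (h t) ≡ t) →
    (∀ t → Q t ≡ true → R (h t) ≡ true) → (∀ t → R t ≡ true → Q (h t) ≡ true) →
    (∀ t → R t ≡ true → R (fn ρ t) ≡ true) →
    (∀ t → R t ≡ true → h (fn ρ t) ≡ fn π (h t)) → orbOn Q π ≡ orbOn R ρ
  orbOn-conj Q R π ρ h hh QR RQ closed comm = ℕₚ.≤-antisym
    (orbOn-conj-≤ Q R π ρ h hh QR closed comm)
    (orbOn-conj-≤ R Q ρ π h hh RQ
      (λ t q → subst (λ z → Q z ≡ true) (trans (comm (h t) (QR t q)) (cong (fn π) (hh t))) (RQ _ (closed (h t) (QR t q))))
      (λ t q → trans (cong h (trans (cong (fn π) (sym (hh t))) (sym (comm (h t) (QR t q))))) (hh _)))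

  orb-conj : (π ρ : Perm A) (h : A → A) → (∀ t → h (h t) ≡ t) → (∀ t → h (fn ρ t) ≡ fn π (h t)) → orb π ≡ orb ρ
  orb-conj π ρ h hh comm = orbOn-conj _ _ π ρ h hh (λ _ _ → refl) (λ _ _ → refl) (λ _ _ → refl) (λ t _ → comm t)

  module _ (κ ε : Match A) where
    private
      π = perm κ ε

    -- An orbit containing both `t` and `app ε t` would be its own reversal. Shortening the walk
    -- between them by one step at both ends leads to a fixed point of `ε` or of `κ`.
    ≉partner : ∀ t → ¬ (κ ∙ ε ⊢ t ≈ app ε t)
    ≉partner t (k , e) = go k t e
      where
      go : ∀ k t → iter (fn π) k t ≢ app ε t
      go zero t e = nofix ε t (sym e)
      go (suc zero) t e = nofix κ (app ε t) e
      go (suc (suc k)) t e = go k (fn π t) (trans (iter-comm (fn π) k t)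
        (adj ε (app-inj κ (trans e (sym (invol κ (app ε t)))))))

    -- `app ε` conjugates `perm κ ε` to its inverse and so reverses walks.
    ≈flip : ∀ {a b} → κ ∙ ε ⊢ a ≈ b → κ ∙ ε ⊢ app ε b ≈ app ε a
    ≈flip {a} (k , refl) = k , go k a
      where
      back : ∀ t → fn π (app ε (fn π t)) ≡ app ε t
      back t = trans (cong (app κ) (invol ε _)) (invol κ _)
      go : ∀ k a → iter (fn π) k (app ε (iter (fn π) k a)) ≡ app ε a
      go zero a = refl
      go (suc k) a = trans (sym (iter-comm (fn π) k _)) (trans (cong (iter (fn π) k) (back _)) (go k a))

    ≈κε : ∀ t → κ ∙ ε ⊢ app ε t ≈ app κ t
    ≈κε t = 1 , cong (app κ) (invol ε t)

    ≈flipκ : ∀ {a b} → κ ∙ ε ⊢ a ≈ b → κ ∙ ε ⊢ app κ b ≈ app κ a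
    ≈flipκ {a} {b} r = ~trans (~sym π (≈κε b)) (~trans (≈flip r) (≈κε a))

    ≉κ : ∀ t → ¬ (κ ∙ ε ⊢ t ≈ app κ t)
    ≉κ t r = ≉partner t (~trans r (~sym π (≈κε t)))

  opaque
    -- The edges from `b` and `c` exchange these ends: `b` gets the partner of `c` and conversely,
    -- while an edge joining `b` to `c` stays. As a conjugate of `κ` by a transposition the result
    -- is a matching without further conditions.
    switch : A → A → Match A → Match A
    switch b c κ = record
      { app = swap b c ∘ app κ ∘ swap b c
      ; invol = λ a → trans (cong (swap b c ∘ app κ) (swap-swap b c _))
                        (trans (cong (swap b c) (invol κ _)) (swap-swap b c a))
      ; nofix = λ a e → nofix κ _ (trans (sym (swap-swap b c _)) (cong (swap b c) e)) }

    switch-label : ∀ {L : Set} (ℓ : A → L) κ {b c} → ℓ b ≡ ℓ c → (∀ t → ℓ (app κ t) ≡ ℓ t) →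
                   ∀ t → ℓ (app (switch b c κ) t) ≡ ℓ t
    switch-label ℓ κ {b} {c} e h t = trans (swap-label ℓ b c e _) (trans (h _) (swap-label ℓ b c e t))

    switch-app : ∀ b c κ t → app (switch b c κ) t ≡ swap b c (app κ (swap b c t))
    switch-app b c κ t = refl

    switch-off : ∀ κ {b c t} → t ≢ b → t ≢ c → app κ t ≢ b → app κ t ≢ c → app (switch b c κ) t ≡ app κ t
    switch-off κ {b} {c} {t} p q r s = trans (cong (swap b c ∘ app κ) (swap-off p q)) (swap-off r s)

    switch-same : ∀ κ b t → app (switch b b κ) t ≡ app κ t
    switch-same κ b t = trans (swap-same b _) (cong (app κ) (swap-same b t))

    switch-switch : ∀ κ b c t → app (switch b c (switch b c κ)) t ≡ app κ t
    switch-switch κ b c t = trans (swap-swap b c _) (cong (app κ) (swap-swap b c t))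

    switch-moved : ∀ κ {b c t} → t ≢ b → t ≢ c → app κ t ≡ b → app (switch b c κ) t ≡ c
    switch-moved κ {b} {c} p q refl = trans (cong (swap b c ∘ app κ) (swap-off p q)) (swap-l b c)

    switch-movedʳ : ∀ κ {b c t} → t ≢ b → t ≢ c → app κ t ≡ c → app (switch b c κ) t ≡ b
    switch-movedʳ κ {b} {c} p q refl = trans (cong (swap b c ∘ app κ) (swap-off p q)) (swap-r b c)

  switch-outside : (Q : A → Bool) → ∀ κ {b c} → (∀ t → Q (app κ t) ≡ Q t) → Q b ≡ true → Q c ≡ true →
                   ∀ t → Q t ≡ false → app (switch b c κ) t ≡ app κ t
  switch-outside Q κ Qκ Qb Qc t Qt = switch-off κ (out Qb Qt) (out Qc Qt) (out Qb (trans (Qκ t) Qt)) (out Qc (trans (Qκ t) Qt))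
    where
    out : ∀ {s z} → Q z ≡ true → Q s ≡ false → s ≢ z
    out p q refl = true≢false (trans (sym p) q)

  module _ (κ ε : Match A) (b c : A) where
    private
      π = perm κ ε
      π₁ = swapP (app κ b) (app κ c) π
      π₂ = swapP b c π₁

      opaque
        unfolding switch

        -- Moved past `app κ`, the inner transposition becomes that of `app κ b` and `app κ c`. A
        -- switch is thus two transpositions applied after `π`, which is where the changes by at
        -- most 2 come from.
        two-swaps : orb (perm (switch b c κ) ε) ≡ orb π₂
        two-swaps = orb-cong (perm (switch b c κ) ε) π₂
          (λ t → cong (swap b c) (swap-conj (app κ) (app-inj κ) b c (app ε t)))

      -- The first transposition leaves the orbit of b alone: that orbit meets neither κ b nor κ c.
      b-orbit : ¬ (κ ∙ ε ⊢ b ≈ app κ c) → ∀ {t} → κ ∙ ε ⊢ b ≈ t → fn π₁ ⊢ b ~ t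
      b-orbit b≉κc = ~agree (κ ∙ ε ⊢ b ≈_) (λ t r → ~trans r ~step)
        (λ t r → sym (swap-off (λ e → ≉κ κ ε b (subst (κ ∙ ε ⊢ b ≈_) e (~trans r ~step)))
                               (λ e → b≉κc (subst (κ ∙ ε ⊢ b ≈_) e (~trans r ~step))))) ~refl

      b-orbit⁻ : ¬ (κ ∙ ε ⊢ b ≈ app κ c) → ∀ {t} → fn π₁ ⊢ b ~ t → κ ∙ ε ⊢ b ≈ t
      b-orbit⁻ b≉κc (k , refl) = go k
        where
        go : ∀ k → κ ∙ ε ⊢ b ≈ iter (fn π₁) k b
        go zero = ~refl
        go (suc k) = subst (κ ∙ ε ⊢ b ≈_)
          (sym (swap-off (λ e → ≉κ κ ε b (subst (κ ∙ ε ⊢ b ≈_) e (~trans (go k) ~step)))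
                         (λ e → b≉κc (subst (κ ∙ ε ⊢ b ≈_) e (~trans (go k) ~step)))))
          (~trans (go k) ~step)

    switch-≥ : orb₂ κ ε ≤ 2 + orb₂ (switch b c κ) ε
    switch-≥ = ℕₚ.≤-trans (orb-swap-≤ (app κ b) (app κ c) π)
      (s≤s (ℕₚ.≤-trans (orb-swap-≤ b c π₁) (s≤s (ℕₚ.≤-reflexive (sym two-swaps)))))

    -- One cycle runs through `b` and `c` in the same direction. The switch cuts it in two, and both
    -- transpositions split an orbit.
    switch-close : b ≢ c → κ ∙ ε ⊢ b ≈ c → 2 + orb₂ κ ε ≤ orb₂ (switch b c κ) ε
    switch-close b≢c r = ℕₚ.≤-trans (s≤s (orb-swap-split (app κ b) (app κ c) π (b≢c ∘ app-inj κ) (~sym π (≈flipκ κ ε r))))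
      (ℕₚ.≤-trans (orb-swap-split b c π₁ b≢c (b-orbit b≉κc r)) (ℕₚ.≤-reflexive (sym two-swaps)))
      where
      b≉κc : ¬ (κ ∙ ε ⊢ b ≈ app κ c)
      b≉κc h = ≉κ κ ε b (~trans h (≈flipκ κ ε r))

    -- The first transposition merges two orbits and the second splits one at best. This includes a
    -- single cycle that runs through `b` and `c` in opposite directions.
    switch-noninc : ¬ (κ ∙ ε ⊢ b ≈ c) → orb₂ (switch b c κ) ε ≤ orb₂ κ ε
    switch-noninc b≉c = ℕₚ.≤-trans (ℕₚ.≤-reflexive two-swaps) (ℕₚ.≤-trans
      (ℕₚ.≤-trans (orb-swap-≤ b c π₂) (s≤s (ℕₚ.≤-reflexive (orb-cong (swapP b c π₂) π₁ (λ t → swap-swap b c _)))))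
      (orb-swap-merge (app κ b) (app κ c) π
        (λ r → b≉c (subst (κ ∙ ε ⊢_≈ c) (invol κ b) (subst (κ ∙ ε ⊢ app κ (app κ b) ≈_) (invol κ c) (~sym π (≈flipκ κ ε r)))))))

    -- With `b` and `c` on different cycles, the two directions of these cycles are merged one after
    -- the other.
    switch-merge : ¬ (κ ∙ ε ⊢ b ≈ c) → ¬ (κ ∙ ε ⊢ b ≈ app κ c) → 2 + orb₂ (switch b c κ) ε ≤ orb₂ κ ε
    switch-merge b≉c b≉κc = ℕₚ.≤-trans (s≤s (s≤s (ℕₚ.≤-reflexive two-swaps)))
      (ℕₚ.≤-trans (s≤s (orb-swap-merge b c π₁ (λ r → b≉c (b-orbit⁻ b≉κc r))))
        (orb-swap-merge (app κ b) (app κ c) π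
          (λ r → b≉c (subst (κ ∙ ε ⊢_≈ c) (invol κ b) (subst (κ ∙ ε ⊢ app κ (app κ b) ≈_) (invol κ c) (~sym π (≈flipκ κ ε r)))))))

  switch-≤ : ∀ κ ε b c → orb₂ (switch b c κ) ε ≤ 2 + orb₂ κ ε
  switch-≤ κ ε b c = ℕₚ.≤-trans (switch-≥ (switch b c κ) ε b c)
    (s≤s (s≤s (ℕₚ.≤-reflexive (orb-cong (perm (switch b c (switch b c κ)) ε) (perm κ ε) (λ t → switch-switch κ b c (app ε t))))))

  opaque
    unfolding switch

    -- Conjugating the composition by the transposition moves the switch from one matching to the
    -- other.
    switch-right : ∀ κ ε b c → orb₂ κ (switch b c ε) ≡ orb₂ (switch b c κ) ε
    switch-right κ ε b c = orb-conj (perm κ (switch b c ε)) (perm (switch b c κ) ε) (swap b c) (swap-swap b c)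
      (λ t → trans (swap-swap b c _) (cong (app κ ∘ swap b c ∘ app ε) (sym (swap-swap b c t))))

  opaque
    unfolding orbOn

    -- `app ε` preserves `Q` and exchanges the two directions of each cycle.
    orbOn-even : (Q : A → Bool) → ∀ κ ε → (∀ t → Q t ≡ true → Q (app ε t) ≡ true) →
                 ∃ λ j → orbOn Q (perm κ ε) ≡ j + j
    orbOn-even Q κ ε Qε = classes-even (orbPart Q (perm κ ε)) (λ i → enc (app ε (dec i)))
      (λ i q → trans (cong Q (dec-enc _)) (Qε (dec i) q))
      (λ i j r → subst (κ ∙ ε ⊢_≈ dec i) (sym (dec-enc _))
        (subst (κ ∙ ε ⊢ app ε (dec j) ≈_) (trans (cong (app ε) (dec-enc _)) (invol ε (dec i))) (≈flip κ ε r)))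
      (λ i r → ≉partner κ ε (dec i) (~sym (perm κ ε) (subst (κ ∙ ε ⊢_≈ dec i) (dec-enc _) r)))

  -- The switch in `orb-adjoin` makes `ε` pair `w` with `app κ w`. This splits off a cycle of length
  -- two, hence two orbits, unless `app κ w` and `app ε w` agree already.
  gap : A → A → ℕ
  gap a b = if ⌊ a ≟ᴬ b ⌋ then 0 else 2

  orb-adjoin : ∀ κ ε w → orb₂ κ (switch (app κ w) (app ε w) ε) ≡ gap (app κ w) (app ε w) + orb₂ κ ε
  orb-adjoin κ ε w = trans (switch-right κ ε _ _) (go (app κ w ≟ᴬ app ε w))
    where
    go : (d : Dec (app κ w ≡ app ε w)) →
         orb₂ (switch (app κ w) (app ε w) κ) ε ≡ (if ⌊ d ⌋ then 0 else 2) + orb₂ κ ε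
    go (yes e) = orb-cong (perm (switch (app κ w) (app ε w) κ) ε) (perm κ ε)
      (λ t → subst (λ z → app (switch (app κ w) z κ) (app ε t) ≡ app κ (app ε t)) e (switch-same κ (app κ w) (app ε t)))
    go (no ne) = ℕₚ.≤-antisym (switch-≤ κ ε _ _) (switch-close κ ε _ _ ne (~sym (perm κ ε) (≈κε κ ε w)))

  gap-≢ : ∀ {a b} → a ≢ b → gap a b ≡ 2
  gap-≢ {a} {b} ne = cong (λ z → if z then 0 else 2) (⌊⌋-false {a? = a ≟ᴬ b} ne)

  adjoin-at : ∀ κ ε w → app (switch (app ε w) (app κ w) κ) w ≡ app ε w
  adjoin-at κ ε w = switch-movedʳ κ (nofix ε w ∘ sym) (nofix κ w ∘ sym) refl

  -- Undirected connectivity in `κ ∪ ε`: a component is one cycle and consists of two orbits of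
  -- `perm κ ε`.
  data Comp (κ ε : Match A) (a : A) : A → Set where
    here : Comp κ ε a a
    byκ  : ∀ {b} → Comp κ ε a b → Comp κ ε a (app κ b)
    byε  : ∀ {b} → Comp κ ε a b → Comp κ ε a (app ε b)

  module _ {κ ε : Match A} where

    Comp-trans : ∀ {a b c} → Comp κ ε a b → Comp κ ε b c → Comp κ ε a c
    Comp-trans r here = r
    Comp-trans r (byκ s) = byκ (Comp-trans r s)
    Comp-trans r (byε s) = byε (Comp-trans r s)

    Comp-κ⁻ : ∀ a → Comp κ ε (app κ a) a
    Comp-κ⁻ a = subst (Comp κ ε (app κ a)) (invol κ a) (byκ here)

    Comp-ε⁻ : ∀ a → Comp κ ε (app ε a) a
    Comp-ε⁻ a = subst (Comp κ ε (app ε a)) (invol ε a) (byε here)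

    Comp-sym : ∀ {a b} → Comp κ ε a b → Comp κ ε b a
    Comp-sym here = here
    Comp-sym (byκ r) = Comp-trans (Comp-κ⁻ _) (Comp-sym r)
    Comp-sym (byε r) = Comp-trans (Comp-ε⁻ _) (Comp-sym r)

    ≈⇒Comp : ∀ {a b} → κ ∙ ε ⊢ a ≈ b → Comp κ ε a b
    ≈⇒Comp (zero , refl) = here
    ≈⇒Comp (suc k , refl) = byκ (byε (≈⇒Comp (k , refl)))

    Comp⇒≈ : ∀ {a b} → Comp κ ε a b → κ ∙ ε ⊢ a ≈ b ⊎ κ ∙ ε ⊢ a ≈ app ε b
    Comp⇒≈ here = inj₁ ~refl
    Comp⇒≈ (byκ {b} r) with Comp⇒≈ r
    ... | inj₁ s = inj₂ (~trans s (~sym (perm κ ε) (1 , trans (cong (app κ) (invol ε _)) (invol κ b))))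
    ... | inj₂ s = inj₁ (~trans s (1 , cong (app κ) (invol ε b)))
    Comp⇒≈ (byε {b} r) with Comp⇒≈ r
    ... | inj₁ s = inj₂ (subst (κ ∙ ε ⊢ _ ≈_) (sym (invol ε b)) s)
    ... | inj₂ s = inj₁ s

    Comp-label : ∀ {L : Set} (ℓ : A → L) → (∀ t → ℓ (app κ t) ≡ ℓ t) → (∀ t → ℓ (app ε t) ≡ ℓ t) →
                 ∀ {a b} → Comp κ ε a b → ℓ a ≡ ℓ b
    Comp-label ℓ p q here = refl
    Comp-label ℓ p q (byκ r) = trans (Comp-label ℓ p q r) (sym (p _))
    Comp-label ℓ p q (byε r) = trans (Comp-label ℓ p q r) (sym (q _))

  Comp-map : ∀ {κ κ′ ε} (f : A → A) (Q : A → Set) → (∀ t → Q t → Q (app κ t)) → (∀ t → Q t → Q (app ε t)) →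
    (∀ t → Q t → f (app κ t) ≡ app κ′ (f t)) → (∀ t → Q t → f (app ε t) ≡ app ε (f t)) →
    ∀ {a b} → Q a → Comp κ ε a b → Comp κ′ ε (f a) (f b)
  Comp-map {κ} {κ′} {ε} f Q Qκ Qε fκ fε {a} qa r = proj₂ (go r)
    where
    go : ∀ {b} → Comp κ ε a b → Q b × Comp κ′ ε (f a) (f b)
    go here = qa , here
    go (byκ r) = let q , r′ = go r in Qκ _ q , subst (Comp κ′ ε (f a)) (sym (fκ _ q)) (byκ r′)
    go (byε r) = let q , r′ = go r in Qε _ q , subst (Comp κ′ ε (f a)) (sym (fε _ q)) (byε r′)

  Comp? : ∀ κ ε a b → Dec (Comp κ ε a b)
  Comp? κ ε a b = map′ (λ { (inj₁ r) → ≈⇒Comp r ; (inj₂ r) → Comp-trans (≈⇒Comp r) (Comp-ε⁻ b) }) Comp⇒≈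
    (~dec (perm κ ε) a b ⊎-dec ~dec (perm κ ε) a (app ε b))

  -- Every component carries exactly two orbits, so a finer division into components has at least as
  -- many. To compare the orbits themselves, `g` sends `t` to the canonical element of its
  -- `κ₁`-component or to the `ε`-partner of that element, whichever lies on the orbit of `t`. By
  -- `≉partner` the two are never on one orbit, hence `g` reflects orbits.
  orb-comp-≤ : ∀ κ₁ κ₂ ε → (∀ a b → Comp κ₂ ε a b → Comp κ₁ ε a b) → orb₂ κ₁ ε ≤ orb₂ κ₂ ε
  orb-comp-≤ κ₁ κ₂ ε h = orb-≤ (perm κ₁ ε) (perm κ₂ ε) g main
    where
    canon : ∀ t → ∃ λ i → Comp κ₁ ε t (dec i) × (∀ j → Comp κ₁ ε t (dec j) → toℕ i ≤ toℕ j)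
    canon t = findLeast {P = λ i → Comp κ₁ ε t (dec i)} (λ i → Comp? κ₁ ε t (dec i))
                (enc t , subst (Comp κ₁ ε t) (sym (dec-enc t)) here)
    c : A → A
    c t = dec (proj₁ (canon t))
    c-unique : ∀ s t → Comp κ₁ ε s t → c s ≡ c t
    c-unique s t r = let i , si , li = canon s ; j , tj , lj = canon t in
      cong dec (Finₚ.toℕ-injective (ℕₚ.≤-antisym (li j (Comp-trans r tj)) (lj i (Comp-trans (Comp-sym r) si))))
    g-dec : ∀ t → Dec (κ₁ ∙ ε ⊢ t ≈ c t) → A
    g-dec t (yes _) = c t
    g-dec t (no _)  = app ε (c t)
    g : A → A
    g t = g-dec t (~dec (perm κ₁ ε) t (c t))
    data Side (t : A) : A → Set where
      same  : κ₁ ∙ ε ⊢ t ≈ c t → Side t (c t)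
      other : κ₁ ∙ ε ⊢ t ≈ app ε (c t) → Side t (app ε (c t))
    side : ∀ t → Side t (g t)
    side t with ~dec (perm κ₁ ε) t (c t)
    ... | yes r = same r
    ... | no ¬r with Comp⇒≈ (proj₁ (proj₂ (canon t)))
    ... | inj₁ r = contradiction r ¬r
    ... | inj₂ r = other r
    side⇒≈ : ∀ {t u} → Side t u → κ₁ ∙ ε ⊢ t ≈ u
    side⇒≈ (same r) = r
    side⇒≈ (other r) = r
    main : ∀ s t → κ₂ ∙ ε ⊢ g s ≈ g t → κ₁ ∙ ε ⊢ s ≈ t
    main s t r = final (side s) (side t) r (c-unique s t
        (Comp-trans (≈⇒Comp (side⇒≈ (side s))) (Comp-trans (h _ _ (≈⇒Comp r)) (Comp-sym (≈⇒Comp (side⇒≈ (side t)))))))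
      where
      final : ∀ {u v} → Side s u → Side t v → κ₂ ∙ ε ⊢ u ≈ v → c s ≡ c t → κ₁ ∙ ε ⊢ s ≈ t
      final (same p) (same q) _ e = ~trans p (~sym (perm κ₁ ε) (subst (κ₁ ∙ ε ⊢ t ≈_) (sym e) q))
      final (same p) (other q) r e = contradiction (subst (λ z → κ₂ ∙ ε ⊢ c s ≈ app ε z) (sym e) r) (≉partner κ₂ ε (c s))
      final (other p) (same q) r e = contradiction (~sym (perm κ₂ ε) (subst (λ z → κ₂ ∙ ε ⊢ app ε (c s) ≈ z) (sym e) r)) (≉partner κ₂ ε (c s))
      final (other p) (other q) _ e = ~trans p (~sym (perm κ₁ ε) (subst (λ z → κ₁ ∙ ε ⊢ t ≈ app ε z) (sym e) q))

  -- Cutting the κ-edge at b leaves b and κ b joined by the rest of their cycle.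
  Comp-detour : ∀ κ κ′ ε b c → ¬ Comp κ ε b c →
    (∀ t → t ≢ b → t ≢ c → app κ t ≢ b → app κ t ≢ c → app κ′ t ≡ app κ t) → Comp κ′ ε b (app κ b)
  Comp-detour κ κ′ ε b c ¬bc off with minPeriod b (perm κ ε)
  ... | k , e , before = subst (Comp κ′ ε b) (adj κ e) (byε (walk k ℕₚ.≤-refl))
    where
    π = perm κ ε
    walk : ∀ l → l ≤ k → Comp κ′ ε b (iter (fn π) l b)
    walk zero _ = here
    walk (suc l) l<k = subst (Comp κ′ ε b)
      (off (app ε (iter (fn π) l b))
        (λ h → ≉partner κ ε b (l , adj ε h))
        (λ h → ¬bc (subst (Comp κ ε b) h (byε (≈⇒Comp (l , refl)))))
        (before l l<k)
        (λ h → ¬bc (≈⇒Comp (suc l , h))))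
      (byκ (byε (walk l (ℕₚ.<⇒≤ l<k))))

  module _ (κ ε : Match A) (b c : A) (¬bc : ¬ Comp κ ε b c) where
    private
      κ′ = switch b c κ

      away : ∀ t → t ≢ b → t ≢ c → app κ t ≢ b → app κ t ≢ c → app κ′ t ≡ app κ t
      away t p q r s = switch-off κ p q r s

      bb : Comp κ′ ε b (app κ b)
      bb = Comp-detour κ κ′ ε b c ¬bc away
      cc : Comp κ′ ε c (app κ c)
      cc = Comp-detour κ κ′ ε c b (¬bc ∘ Comp-sym) (λ t p q r s → away t q p s r)

    switch-joins : Comp κ′ ε b c
    switch-joins = subst (Comp κ′ ε b)
      (switch-moved κ (nofix κ b) (λ e → ¬bc (subst (Comp κ ε b) e (byκ here))) (invol κ b)) (byκ bb)

    -- Two cycles become one, and each removed edge is bypassed along the rest of its own cycle.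
    Comp-switch : ∀ {s t} → Comp κ ε s t → Comp κ′ ε s t
    Comp-switch here = here
    Comp-switch (byε r) = byε (Comp-switch r)
    Comp-switch (byκ {t} r) = Comp-trans (Comp-switch r) (edge t)
      where
      edge : ∀ t → Comp κ′ ε t (app κ t)
      edge t with t ≟ᴬ b | t ≟ᴬ c | app κ t ≟ᴬ b | app κ t ≟ᴬ c
      ... | yes refl | _ | _ | _ = bb
      ... | no _ | yes refl | _ | _ = cc
      ... | no _ | no _ | yes e | _ = subst (Comp κ′ ε t) (sym e) (Comp-sym (subst (Comp κ′ ε b) (sym (adj κ e)) bb))
      ... | no _ | no _ | no _ | yes e = subst (Comp κ′ ε t) (sym e) (Comp-sym (subst (Comp κ′ ε c) (sym (adj κ e)) cc))
      ... | no p | no q | no r | no s = subst (Comp κ′ ε t) (away t p q r s) (byκ here)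

-- Merging the vertex cycles of equal label

module Connecting {A : Set} {n : ℕ} (F : Finite A n) {L : Set} (_≟ᴸ_ : (k l : L) → Dec (k ≡ l)) (ℓ : A → L) where
  open Orbits F
  open Matchings F

  record Connected-by (ε θ κ : Match A) : Set where
    field
      κ⁺        : Match A
      label     : ∀ t → ℓ (app κ⁺ t) ≡ ℓ t
      connected : ∀ s t → ℓ s ≡ ℓ t → Comp κ⁺ θ s t
      bound     : orb₂ κ ε + orb₂ κ⁺ θ ≤ orb₂ κ⁺ ε + orb₂ κ θ

  -- Switching two equally labelled elements on different cycles of `κ ∪ θ` removes at least two
  -- orbits of `perm κ θ` and at most two of `perm κ ε`, so the difference of the second count and
  -- the first does not fall. The shrinking first count, bounded by `m`, ends the process.
  connect : ∀ ε θ → (∀ t → ℓ (app θ t) ≡ ℓ t) →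
    ∀ m κ → (∀ t → ℓ (app κ t) ≡ ℓ t) → orb₂ κ θ ≤ m → Connected-by ε θ κ
  connect ε θ ℓθ m κ ℓκ fuel
    with any-dec (λ s → any-dec (λ t → (ℓ s ≟ᴸ ℓ t) ×-dec ¬? (Comp? κ θ s t)))
  ... | no none = record { κ⁺ = κ ; label = ℓκ ; bound = ℕₚ.≤-refl
                         ; connected = λ s t e → dne s t e (Comp? κ θ s t) }
    where
    dne : ∀ s t → ℓ s ≡ ℓ t → Dec (Comp κ θ s t) → Comp κ θ s t
    dne s t e (yes r) = r
    dne s t e (no ¬r) = contradiction (s , t , e , ¬r) none
  ... | yes (s , t , e , ¬st) = go m fuel
    where
    κ₁ = switch s t κ
    less : 2 + orb₂ κ₁ θ ≤ orb₂ κ θ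
    less = switch-merge κ θ s t (λ r → ¬st (≈⇒Comp r)) (λ r → ¬st (Comp-trans (≈⇒Comp r) (Comp-κ⁻ t)))
    go : ∀ m → orb₂ κ θ ≤ m → Connected-by ε θ κ
    go zero h = contradiction (ℕₚ.≤-trans less h) (λ ())
    go (suc m) h = record
      { κ⁺ = C.κ⁺ ; label = C.label ; connected = C.connected
      ; bound = ℕₚ.≤-trans (ℕₚ.+-monoˡ-≤ (orb₂ C.κ⁺ θ) (switch-≥ κ ε s t))
          (ℕₚ.≤-trans (ℕₚ.+-monoʳ-≤ 2 C.bound)
            (ℕₚ.≤-trans (ℕₚ.≤-reflexive (shift (orb₂ C.κ⁺ ε) (orb₂ κ₁ θ))) (ℕₚ.+-monoʳ-≤ (orb₂ C.κ⁺ ε) less))) }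
      where
      module C = Connected-by (connect ε θ ℓθ m κ₁ (switch-label ℓ κ e ℓκ)
        (ℕₚ.≤-trans (ℕₚ.n≤1+n _) (ℕₚ.≤-pred (ℕₚ.≤-trans less h))))
      shift : ∀ a b → 2 + (a + b) ≡ a + (2 + b)
      shift a b = sym (trans (ℕₚ.+-suc a (1 + b)) (cong suc (ℕₚ.+-suc a b)))

-- Removing the mixed corners

third : ∀ {p q r : Bool} → p ≢ r → q ≢ r → p ≡ q
third {true}  {true}  _ _ = refl
third {false} {false} _ _ = refl
third {true}  {false} {true}  a _ = contradiction refl a
third {true}  {false} {false} _ b = contradiction refl b
third {false} {true}  {true}  _ b = contradiction refl b
third {false} {true}  {false} a _ = contradiction refl a

module Purifying {A : Set} {n N : ℕ} (F : Finite A n) (v : A → Fin N) (τ : A → Bool) (x y : Fin N) where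
  open Finite F
  open Orbits F
  open Matchings F

  -- `v` is the vertex of a flag and `τ` its part. Nothing more is kept of the graph, because `ε`
  -- and `θ` will be rerouted and then no longer describe its edges and sides.
  record Mixed (κ ε θ : Match A) : Set where
    field
      vκ  : ∀ t → v (app κ t) ≡ v t
      τε  : ∀ t → τ (app ε t) ≡ τ t
      vθ  : ∀ t → v (app θ t) ≡ v t
      τθ  : ∀ t → τ (app θ t) ≡ τ t
      mix : ∀ t → τ (app κ t) ≢ τ t → v t ≡ x ⊎ v t ≡ y

  -- A pair matched by all three is a cycle by itself among the faces and among the vertices. The
  -- underlying set being fixed, spent elements are parked in such pairs instead of being deleted.
  record Dead (κ ε θ : Match A) (t : A) : Set where
    constructor isDead
    field
      ε≡κ : app ε t ≡ app κ t
      θ≡κ : app θ t ≡ app κ t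
  open Dead

  dead? : ∀ κ ε θ t → Dec (Dead κ ε θ t)
  dead? κ ε θ t = map′ (λ (p , q) → isDead p q) (λ d → ε≡κ d , θ≡κ d) ((app ε t ≟ᴬ app κ t) ×-dec (app θ t ≟ᴬ app κ t))

  -- The 4 pays for separating the two parts at x and at y, each cycle being counted in both directions.
  record Pure (κ ε θ : Match A) : Set where
    field
      κ⁺    : Match A
      vκ⁺   : ∀ t → v (app κ⁺ t) ≡ v t
      τκ⁺   : ∀ t → τ (app κ⁺ t) ≡ τ t
      dead  : ∀ t → Dead κ ε θ t → app κ⁺ t ≡ app κ t
      bound : orb₂ κ ε + orb₂ κ⁺ θ ≤ orb₂ κ⁺ ε + orb₂ κ θ + 4

  dead-κ : ∀ {κ ε θ t} → Dead κ ε θ t → Dead κ ε θ (app κ t)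
  dead-κ {κ} {ε} {θ} {t} (isDead p q) = isDead (back ε p) (back θ q)
    where
    back : ∀ ε → app ε t ≡ app κ t → app ε (app κ t) ≡ app κ (app κ t)
    back ε p = trans (sym (adj ε p)) (sym (invol κ t))

  dead-κ⁻ : ∀ {κ ε θ t} → Dead κ ε θ (app κ t) → Dead κ ε θ t
  dead-κ⁻ {κ} {ε} {θ} {t} d = subst (Dead κ ε θ) (invol κ t) (dead-κ d)

  dead-ε : ∀ {κ ε θ t} → Dead κ ε θ t → Dead κ ε θ (app ε t)
  dead-ε {κ} {ε} {θ} d = subst (Dead κ ε θ) (sym (ε≡κ d)) (dead-κ d)

  dead-ε⁻ : ∀ {κ ε θ t} → Dead κ ε θ (app ε t) → Dead κ ε θ t
  dead-ε⁻ {κ} {ε} {θ} {t} d = subst (Dead κ ε θ) (invol ε t) (dead-ε d)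

  dead-θ : ∀ {κ ε θ t} → Dead κ ε θ t → Dead κ ε θ (app θ t)
  dead-θ {κ} {ε} {θ} d = subst (Dead κ ε θ) (sym (θ≡κ d)) (dead-κ d)

  dead-θ⁻ : ∀ {κ ε θ t} → Dead κ ε θ (app θ t) → Dead κ ε θ t
  dead-θ⁻ {κ} {ε} {θ} {t} d = subst (Dead κ ε θ) (invol θ t) (dead-θ d)

  -- An edge common to `κ` and `ε` is a whole cycle. It avoids the switched edges unless `w` lies on
  -- such a cycle too, and in that case the switch does nothing.
  adjoin-off : ∀ κ ε w t → app κ t ≡ app ε t → app (switch (app ε w) (app κ w) κ) t ≡ app κ t
  adjoin-off κ ε w t e with app ε w ≟ᴬ app κ w
  ... | yes f = subst (λ z → app (switch (app ε w) z κ) t ≡ app κ t) f (switch-same κ (app ε w) t)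
  ... | no ne = switch-off κ
    (λ h → ne (trans (sym h) (adj κ (trans e (trans (cong (app ε) h) (invol ε w))))))
    (λ h → ne (sym (trans (sym h) (adj ε (trans (sym e) (trans (cong (app κ) h) (invol κ w)))))))
    (λ h → ne (trans (sym h) (cong (app κ) (app-inj ε (trans (sym e) h)))))
    (λ h → ne (trans (sym (cong (app ε) (app-inj κ h))) (trans (sym e) h)))

  -- An element counts once while it is live and once more while its `κ`-edge is mixed. `contract`
  -- lowers the first count and `close` the second, and neither raises the other one.
  badness : Match A → Match A → Match A → ℕ
  badness κ ε θ = cnt (λ i → not ⌊ dead? κ ε θ (dec i) ⌋) + cnt (λ i → not ⌊ τ (app κ (dec i)) ≟ᵇ τ (dec i) ⌋)

  module _ {p q : A → Set} (p? : ∀ t → Dec (p t)) (q? : ∀ t → Dec (q t)) where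
    fewer : (∀ t → q t → p t) → cnt (λ i → not ⌊ p? (dec i) ⌋) ≤ cnt (λ i → not ⌊ q? (dec i) ⌋)
    fewer h = cnt-mono _ _ (λ i pi → cong not (⌊⌋-false {a? = q? (dec i)}
      (λ qi → true≢false (trans (sym pi) (cong not (⌊⌋-true {a? = p? (dec i)} (h _ qi)))))))

    strictly-fewer : (∀ t → q t → p t) → ∀ w → p w → ¬ q w →
                     cnt (λ i → not ⌊ p? (dec i) ⌋) < cnt (λ i → not ⌊ q? (dec i) ⌋)
    strictly-fewer h w pw ¬qw = cnt-mono-< _ _ (enc w)
      (λ i pi → cong not (⌊⌋-false {a? = q? (dec i)}
        (λ qi → true≢false (trans (sym pi) (cong not (⌊⌋-true {a? = p? (dec i)} (h _ qi)))))))
      (cong not (⌊⌋-false {a? = q? (dec (enc w))} (¬qw ∘ subst q (dec-enc w))))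
      (cong not (⌊⌋-true {a? = p? (dec (enc w))} (subst p (sym (dec-enc w)) pw)))

  Progress : Match A → Match A → Match A → Set
  Progress κ ε θ = Σ (Match A) λ κ₁ → Σ (Match A) λ ε₁ → Σ (Match A) λ θ₁ →
    Mixed κ₁ ε₁ θ₁ × badness κ₁ ε₁ θ₁ < badness κ ε θ × (Pure κ₁ ε₁ θ₁ → Pure κ ε θ)

  -- A κ-edge {w, κ w} inside one part is contracted: ε and θ are rerouted past it.
  contract : ∀ {κ ε θ} → Mixed κ ε θ → ∀ w → ¬ Dead κ ε θ w → τ (app κ w) ≡ τ w → Progress κ ε θ
  contract {κ} {ε} {θ} M w ¬dw pure = κ , ε₁ , θ₁ ,
    record { vκ = vκ ; τε = switch-label τ ε (trans pure (sym (τε w))) τε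
           ; vθ = switch-label v θ (trans (vκ w) (sym (vθ w))) vθ
           ; τθ = switch-label τ θ (trans pure (sym (τθ w))) τθ ; mix = mix } ,
    ℕₚ.+-monoˡ-< _ (strictly-fewer (dead? κ ε₁ θ₁) (dead? κ ε θ) still w (isDead (adjoin-at ε κ w) (adjoin-at θ κ w)) ¬dw) ,
    λ S → let open Pure S in record
      { κ⁺ = κ⁺ ; vκ⁺ = vκ⁺ ; τκ⁺ = τκ⁺ ; dead = λ t d → dead t (still t d)
      -- `κ⁺` keeps the dead edge at `w`, so rerouting `ε` and `θ` changes its two counts by the
      -- same amounts as those of `κ`, and everything cancels.
      ; bound = transfer {a = orb₂ κ ε} {b = orb₂ κ⁺ θ} {c = orb₂ κ⁺ ε} {d = orb₂ κ θ}
          {g = gap (app κ w) (app ε w)} {h = gap (app κ w) (app θ w)} (orb-adjoin κ ε w) (orb-adjoin κ θ w)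
          (same-gap κ⁺ ε (dead w (isDead (adjoin-at ε κ w) (adjoin-at θ κ w))))
          (same-gap κ⁺ θ (dead w (isDead (adjoin-at ε κ w) (adjoin-at θ κ w)))) bound }
    where
    open Mixed M
    ε₁ = switch (app κ w) (app ε w) ε
    θ₁ = switch (app κ w) (app θ w) θ
    still : ∀ t → Dead κ ε θ t → Dead κ ε₁ θ₁ t
    still t (isDead p q) = isDead (trans (adjoin-off ε κ w t p) p) (trans (adjoin-off θ κ w t q) q)
    same-gap : ∀ κ⁺ η → app κ⁺ w ≡ app κ w →
      orb₂ κ⁺ (switch (app κ w) (app η w) η) ≡ gap (app κ w) (app η w) + orb₂ κ⁺ η
    same-gap κ⁺ η e = subst (λ z → orb₂ κ⁺ (switch z (app η w) η) ≡ gap z (app η w) + orb₂ κ⁺ η) e (orb-adjoin κ⁺ η w)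
    transfer : ∀ {a b c d a₁ b₁ c₁ d₁ g h} → a₁ ≡ g + a → d₁ ≡ h + d → c₁ ≡ g + c → b₁ ≡ h + b →
               a₁ + b₁ ≤ c₁ + d₁ + 4 → a + b ≤ c + d + 4
    transfer {a} {b} {c} {d} {g = g} {h} refl refl refl refl le = ℕₚ.+-cancelˡ-≤ (g + h) _ _
      (ℕₚ.≤-trans (ℕₚ.≤-reflexive (interchange g h a b)) (ℕₚ.≤-trans le (ℕₚ.≤-reflexive
        (trans (cong (_+ 4) (interchange g c h d)) (ℕₚ.+-assoc (g + h) (c + d) 4)))))

  -- An ε-edge {w, ε w} at a single vertex is closed off by a face of its own.
  close : ∀ {κ ε θ} → Mixed κ ε θ → (∀ t → ¬ Dead κ ε θ t → τ (app κ t) ≢ τ t) →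
          ∀ w → ¬ Dead κ ε θ w → v (app ε w) ≡ v w → Progress κ ε θ
  close {κ} {ε} {θ} M mixed w ¬dw flat = κ₁ , ε , θ ,
    record { vκ = switch-label v κ (trans flat (sym (vκ w))) vκ ; τε = τε ; vθ = vθ ; τθ = τθ
           ; mix = λ t h → mix t (h ∘ pure₁ t) } ,
    ℕₚ.+-mono-≤-< (fewer (dead? κ₁ ε θ) (dead? κ ε θ) still)
      (strictly-fewer (λ t → τ (app κ₁ t) ≟ᵇ τ t) (λ t → τ (app κ t) ≟ᵇ τ t) pure₁ w
        (trans (cong τ (adjoin-at κ ε w)) (τε w)) (mixed w ¬dw)) ,
    λ S → let open Pure S in record
      { κ⁺ = κ⁺ ; vκ⁺ = vκ⁺ ; τκ⁺ = τκ⁺ ; dead = λ t d → trans (dead t (still t d)) (fixed t d)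
      -- The closed face brings two orbits of `perm κ₁ ε`, which pay for the two of `perm κ₁ θ` that
      -- the switch may add.
      ; bound = transfer {c = orb₂ κ⁺ ε} (switch-close κ ε (app ε w) (app κ w)
          (λ e → mixed w ¬dw (trans (cong τ (sym e)) (τε w))) (≈κε κ ε w))
          (switch-≤ κ θ _ _) bound }
    where
    open Mixed M
    κ₁ = switch (app ε w) (app κ w) κ
    fixed : ∀ t → Dead κ ε θ t → app κ₁ t ≡ app κ t
    fixed t (isDead p _) = adjoin-off κ ε w t (sym p)
    still : ∀ t → Dead κ ε θ t → Dead κ₁ ε θ t
    still t d = isDead (trans (ε≡κ d) (sym (fixed t d))) (trans (θ≡κ d) (sym (fixed t d)))
    -- All live `κ`-edges are mixed beforehand, so the other edge that the switch creates cannot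
    -- spoil a pure one.
    pure₁ : ∀ t → τ (app κ t) ≡ τ t → τ (app κ₁ t) ≡ τ t
    pure₁ t e with dead? κ ε θ t
    ... | yes d = trans (cong τ (fixed t d)) e
    ... | no ¬d = contradiction e (mixed t ¬d)
    transfer : ∀ {a b c d a₁ d₁} → 2 + a ≤ a₁ → d₁ ≤ 2 + d → a₁ + b ≤ c + d₁ + 4 → a + b ≤ c + d + 4
    transfer {a} {b} {c} {d} p q le = ℕₚ.+-cancelˡ-≤ 2 _ _
      (ℕₚ.≤-trans (ℕₚ.+-monoˡ-≤ b p) (ℕₚ.≤-trans le (ℕₚ.≤-trans (ℕₚ.+-monoˡ-≤ 4 (ℕₚ.+-monoʳ-≤ c q))
        (ℕₚ.≤-reflexive (cong (_+ 4) (trans (ℕₚ.+-suc c (1 + d)) (cong suc (ℕₚ.+-suc c d))))))))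

  -- Once every live κ-edge joins the two parts and every live ε-edge joins x to y,
  -- all faces of κ⁺ ∪ ε can be made squares by choosing κ⁺ to commute with ε.
  module Crossing {κ ε θ : Match A} (M : Mixed κ ε θ)
    (mixed : ∀ t → ¬ Dead κ ε θ t → τ (app κ t) ≢ τ t)
    (cross : ∀ t → ¬ Dead κ ε θ t → v (app ε t) ≢ v t) where
    open Mixed M

    Live : A → Set
    Live t = ¬ Dead κ ε θ t

    xy : ∀ t → Live t → v t ≡ x ⊎ v t ≡ y
    xy t l = mix t (mixed t l)

    live-ε : ∀ {t} → Live t → Live (app ε t)
    live-ε l = l ∘ dead-ε⁻

    live-κ : ∀ {t} → Live t → Live (app κ t)
    live-κ l = l ∘ dead-κ⁻

    live-θ : ∀ {t} → Live t → Live (app θ t)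
    live-θ l = l ∘ dead-θ⁻

    two-vertices : ∀ {s t u} → Live s → Live t → Live u → v s ≢ v u → v t ≢ v u → v s ≡ v t
    two-vertices {s} {t} {u} ls lt lu p q with xy s ls | xy t lt | xy u lu
    ... | inj₁ a | inj₁ b | _ = trans a (sym b)
    ... | inj₂ a | inj₂ b | _ = trans a (sym b)
    ... | inj₁ a | inj₂ b | inj₁ c = contradiction (trans a (sym c)) p
    ... | inj₁ a | inj₂ b | inj₂ c = contradiction (trans b (sym c)) q
    ... | inj₂ a | inj₁ b | inj₁ c = contradiction (trans b (sym c)) q
    ... | inj₂ a | inj₁ b | inj₂ c = contradiction (trans a (sym c)) p

    opposite : ∀ {s t} → Live s → Live t → v s ≡ v t → v (app ε s) ≡ v (app ε t)
    opposite ls lt e = two-vertices (live-ε ls) (live-ε lt) ls (cross _ ls) (λ h → cross _ lt (trans h e))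

    record Good (κ* : Match A) : Set where
      field
        vκ*   : ∀ t → v (app κ* t) ≡ v t
        τκ*   : ∀ t → τ (app κ* t) ≡ τ t
        dead* : ∀ t → Dead κ ε θ t → app κ* t ≡ app κ t
        comm  : ∀ t → app κ* (app ε t) ≡ app ε (app κ* t)

      live* : ∀ {t} → Live t → Live (app κ* t)
      live* {t} l d = l (subst (Dead κ ε θ) (trans (sym (dead* _ d)) (invol κ* t)) (dead-κ d))

    -- `θ` is a matching at hand that respects vertices and parts. It is used at `x` and carried
    -- over to `y` by `ε`, which makes the result commute with `ε`.
    k₀ : ∀ t → Dec (Dead κ ε θ t) → Dec (v t ≡ x) → A
    k₀ t (yes _) _ = app κ t
    k₀ t (no _) (yes _) = app θ t
    k₀ t (no _) (no _) = app ε (app θ (app ε t))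

    k : A → A
    k t = k₀ t (dead? κ ε θ t) (v t ≟ x)

    k-dead : ∀ {t} → Dead κ ε θ t → k t ≡ app κ t
    k-dead {t} d with dead? κ ε θ t
    ... | yes _ = refl
    ... | no l = contradiction d l

    k-x : ∀ {t} → Live t → v t ≡ x → k t ≡ app θ t
    k-x {t} l e with dead? κ ε θ t | v t ≟ x
    ... | yes d | _ = contradiction d l
    ... | no _ | yes _ = refl
    ... | no _ | no ne = contradiction e ne

    k-y : ∀ {t} → Live t → v t ≢ x → k t ≡ app ε (app θ (app ε t))
    k-y {t} l ne with dead? κ ε θ t | v t ≟ x
    ... | yes d | _ = contradiction d l
    ... | no _ | yes e = contradiction e ne
    ... | no _ | no _ = refl

    data Place (t : A) : Set where
      dead : Dead κ ε θ t → Place t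
      at-x : Live t → v t ≡ x → Place t
      at-y : Live t → v t ≢ x → Place t

    place : ∀ t → Place t
    place t with dead? κ ε θ t | v t ≟ x
    ... | yes d | _ = dead d
    ... | no l | yes e = at-x l e
    ... | no l | no ne = at-y l ne

    εx : ∀ {t} → Live t → v t ≡ x → v (app ε t) ≢ x
    εx l e h = cross _ l (trans h (sym e))

    εy : ∀ {t} → Live t → v t ≢ x → v (app ε t) ≡ x
    εy {t} l ne with xy t l | xy (app ε t) (live-ε l)
    ... | inj₁ e | _ = contradiction e ne
    ... | inj₂ e | inj₁ f = f
    ... | inj₂ e | inj₂ f = contradiction (trans f (sym e)) (cross t l)

    κ₀ : Match A
    κ₀ = record { app = k ; invol = k-invol ; nofix = k-nofix }
      where
      k-invol : ∀ t → k (k t) ≡ t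
      k-invol t with place t
      ... | dead d = trans (cong k (k-dead d)) (trans (k-dead (dead-κ d)) (invol κ t))
      ... | at-x l e = trans (cong k (k-x l e)) (trans (k-x (live-θ l) (trans (vθ t) e)) (invol θ t))
      ... | at-y l ne = trans (cong k (k-y l ne)) (trans
              (k-y (live-ε (live-θ (live-ε l))) (εx (live-θ (live-ε l)) (trans (vθ _) (εy l ne))))
              (trans (cong (app ε ∘ app θ) (invol ε _)) (trans (cong (app ε) (invol θ _)) (invol ε t))))
      k-nofix : ∀ t → k t ≢ t
      k-nofix t with place t
      ... | dead d = λ h → nofix κ t (trans (sym (k-dead d)) h)
      ... | at-x l e = λ h → nofix θ t (trans (sym (k-x l e)) h)
      ... | at-y l ne = λ h → nofix θ (app ε t) (adj ε (trans (sym (k-y l ne)) h))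

    good₀ : Good κ₀
    good₀ = record { vκ* = vk ; τκ* = τk ; dead* = λ t → k-dead ; comm = ck }
      where
      vk : ∀ t → v (k t) ≡ v t
      vk t with place t
      ... | dead d = trans (cong v (k-dead d)) (vκ t)
      ... | at-x l e = trans (cong v (k-x l e)) (vθ t)
      ... | at-y l ne = trans (cong v (k-y l ne))
              (trans (opposite (live-θ (live-ε l)) (live-ε l) (vθ _)) (cong v (invol ε t)))
      τk : ∀ t → τ (k t) ≡ τ t
      τk t with place t
      ... | dead d = trans (cong τ (k-dead d)) (trans (cong τ (sym (ε≡κ d))) (τε t))
      ... | at-x l e = trans (cong τ (k-x l e)) (τθ t)
      ... | at-y l ne = trans (cong τ (k-y l ne)) (trans (τε _) (trans (τθ _) (τε t)))
      ck : ∀ t → k (app ε t) ≡ app ε (k t)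
      ck t with place t
      ... | dead d = trans (k-dead (dead-ε d)) (trans (cong (app κ) (ε≡κ d)) (trans (invol κ t)
              (trans (sym (invol ε t)) (cong (app ε) (trans (ε≡κ d) (sym (k-dead d)))))))
      ... | at-x l e = trans (k-y (live-ε l) (εx l e)) (trans (cong (app ε ∘ app θ) (invol ε t)) (cong (app ε) (sym (k-x l e))))
      ... | at-y l ne = trans (k-x (live-ε l) (εy l ne)) (trans (sym (invol ε _)) (cong (app ε) (sym (k-y l ne))))

    module _ {κ* : Match A} (G : Good κ*) where
      open Good G

      -- `comm` makes the square of `perm κ* ε` the identity.
      squares : ∀ {a b} → κ* ∙ ε ⊢ a ≈ b → b ≡ a ⊎ b ≡ app κ* (app ε a)
      squares (zero , refl) = inj₁ refl
      squares {a} (suc k , refl) with squares (k , refl)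
      ... | inj₁ e = inj₂ (cong (app κ* ∘ app ε) e)
      ... | inj₂ e = inj₁ (trans (cong (app κ* ∘ app ε) e) (trans (cong (app κ*) (sym (comm _)))
                      (trans (invol κ* _) (invol ε a))))

      -- A live orbit of `perm κ ε` alternates between `x` and `y`, whereas one of `perm κ* ε` is a
      -- pair with one element at each. Elements at `x` chosen from different live orbits of the
      -- former therefore lie on different orbits of the latter. A dead element is an orbit by
      -- itself for both.
      squares-maximal : orb₂ κ ε ≤ orb₂ κ* ε
      squares-maximal = orb-≤ (perm κ ε) (perm κ* ε) (proj₁ ∘ pick) main
        where
        Pick : A → A → Set
        Pick t u = κ ∙ ε ⊢ t ≈ u × (Dead κ ε θ u ⊎ (Live u × v u ≡ x))
        pick : ∀ t → ∃ (Pick t)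
        pick t with place t
        ... | dead d = t , ~refl , inj₁ d
        ... | at-x l e = t , ~refl , inj₂ (l , e)
        ... | at-y l ne = app κ (app ε t) , ~step , inj₂ (live-κ (live-ε l) , trans (vκ _) (εy l ne))
        meet : ∀ {s t a b} → Pick s a → Pick t b → b ≡ a ⊎ b ≡ app κ* (app ε a) → κ ∙ ε ⊢ s ≈ t
        meet (r , _) (r′ , _) (inj₁ refl) = ~trans r (~sym (perm κ ε) r′)
        meet {a = a} (r , inj₁ d) (r′ , _) (inj₂ refl) = ~trans r (~sym (perm κ ε)
          (subst (κ ∙ ε ⊢ _ ≈_) (trans (dead* _ (dead-ε d)) (trans (cong (app κ) (ε≡κ d)) (invol κ a))) r′))
        meet (r , inj₂ (l , e)) (r′ , inj₁ d) (inj₂ refl) = contradiction d (live* (live-ε l))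
        meet (r , inj₂ (l , e)) (r′ , inj₂ (l′ , e′)) (inj₂ refl) = contradiction (trans (sym (vκ* _)) e′) (εx l e)
        main : ∀ s t → κ* ∙ ε ⊢ proj₁ (pick s) ≈ proj₁ (pick t) → κ ∙ ε ⊢ s ≈ t
        main s t r = meet (proj₂ (pick s)) (proj₂ (pick t)) (squares r)

      module _ {b c : A} (lb : Live b) (lc : Live c) (vbc : v b ≡ v c) (τbc : τ b ≡ τ c)
        (¬bc : ¬ Comp κ* θ b c) (¬εbc : ¬ (κ* ∙ θ ⊢ app ε b ≈ app ε c)) where
        private
          κ₂ = switch (app ε b) (app ε c) κ*
          κ₁ = switch b c κ₂
          s s′ : A → A
          s = swap b c
          s′ = swap (app ε b) (app ε c)

          far : ∀ {t u} → Live t → v t ≡ v u → Live u → ∀ {w} → v w ≡ v t → w ≢ app ε u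
          far lt e lu e′ refl = cross _ lu (trans e′ e)

          ss′ : ∀ t → s (s′ t) ≡ s′ (s t)
          ss′ t = sym (trans (swap-conj s′ (swap-inj _ _) b c t)
            (cong₂ (λ p q → swap p q (s′ t))
              (swap-off (far lb refl lb refl) (far lb vbc lc refl))
              (swap-off (far lc (sym vbc) lb refl) (far lc refl lc refl))))

          εs : ∀ t → app ε (s t) ≡ s′ (app ε t)
          εs = swap-conj (app ε) (app-inj ε) b c

          εs′ : ∀ t → app ε (s′ t) ≡ s (app ε t)
          εs′ t = trans (cong (app ε) (sym (trans (εs _) (cong s′ (invol ε t))))) (invol ε _)

          at-v : ∀ t → v t ≡ v b → app κ₂ t ≡ app κ* t
          at-v t e = switch-off κ* (far lb refl lb e) (far lb vbc lc e)
            (far lb refl lb (trans (vκ* t) e)) (far lb vbc lc (trans (vκ* t) e))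

          near : ∀ {t} → κ₂ ∙ θ ⊢ b ≈ t → κ* ∙ θ ⊢ b ≈ t
          near = ~agree (λ t → v t ≡ v b)
            (λ t e → trans (cong v (at-v _ (trans (vθ t) e))) (trans (vκ* _) (trans (vθ t) e)))
            (λ t e → at-v _ (trans (vθ t) e)) refl

        -- To keep commuting with `ε`, the switch at `b` and `c` needs its mirror image at `app ε b`
        -- and `app ε c`. The mirror image takes place at the other vertex, so it leaves the cycles
        -- through `b` and `c` alone, and by `¬εbc` it adds no orbit. The merger of those two cycles
        -- then removes two.
        merge-squares : Σ (Match A) λ κ₁ → Good κ₁ × 2 + orb₂ κ₁ θ ≤ orb₂ κ* θ
        merge-squares = κ₁ , record
          { vκ* = switch-label v κ₂ vbc (switch-label v κ* (opposite lb lc vbc) vκ*)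
          ; τκ* = switch-label τ κ₂ τbc (switch-label τ κ* (trans (τε b) (trans τbc (sym (τε c)))) τκ*)
          ; dead* = λ t d → trans (switch-off κ₂ (away d lb) (away d lc)
              (away (κ₂-dead t d) lb) (away (κ₂-dead t d) lc)) (κ₂-κ t d)
          ; comm = commute }
          , ℕₚ.≤-trans (switch-merge κ₂ θ b c (λ r → ¬bc (≈⇒Comp (near r)))
              (λ r → ¬bc (Comp-trans (≈⇒Comp (near (subst (κ₂ ∙ θ ⊢ b ≈_) (at-v c (sym vbc)) r))) (Comp-sym (byκ here)))) )
              (switch-noninc κ* θ _ _ ¬εbc)
          where
          away : ∀ {t u} → Dead κ ε θ t → Live u → t ≢ u
          away d l refl = l d
          κ₂-κ : ∀ t → Dead κ ε θ t → app κ₂ t ≡ app κ t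
          κ₂-κ t d = trans (switch-off κ* (away d (live-ε lb)) (away d (live-ε lc))
            (away (subst (Dead κ ε θ) (sym (dead* t d)) (dead-κ d)) (live-ε lb))
            (away (subst (Dead κ ε θ) (sym (dead* t d)) (dead-κ d)) (live-ε lc))) (dead* t d)
          κ₂-dead : ∀ t → Dead κ ε θ t → Dead κ ε θ (app κ₂ t)
          κ₂-dead t d = subst (Dead κ ε θ) (sym (κ₂-κ t d)) (dead-κ d)
          κ₁-app : ∀ t → app κ₁ t ≡ s (s′ (app κ* (s′ (s t))))
          κ₁-app t = trans (switch-app b c κ₂ t) (cong s (switch-app _ _ κ* (s t)))
          commute : ∀ t → app κ₁ (app ε t) ≡ app ε (app κ₁ t)
          commute t = begin
            app κ₁ (app ε t) ≡⟨ κ₁-app _ ⟩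
            s (s′ (app κ* (s′ (s (app ε t))))) ≡⟨ cong (λ z → s (s′ (app κ* z))) (ss′ (app ε t)) ⟨
            s (s′ (app κ* (s (s′ (app ε t))))) ≡⟨ cong (λ z → s (s′ (app κ* (s z)))) (εs t) ⟨
            s (s′ (app κ* (s (app ε (s t))))) ≡⟨ cong (λ z → s (s′ (app κ* z))) (εs′ (s t)) ⟨
            s (s′ (app κ* (app ε (s′ (s t))))) ≡⟨ ss′ _ ⟩
            s′ (s (app κ* (app ε (s′ (s t))))) ≡⟨ cong (λ z → s′ (s z)) (comm _) ⟩
            s′ (s (app ε (app κ* (s′ (s t))))) ≡⟨ cong s′ (εs′ _) ⟨
            s′ (app ε (s′ (app κ* (s′ (s t))))) ≡⟨ εs _ ⟨
            app ε (s (s′ (app κ* (s′ (s t))))) ≡⟨ cong (app ε) (κ₁-app t) ⟨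
            app ε (app κ₁ t) ∎
            where open ≡-Reasoning

      -- One of the two ways of merging the components of b and c keeps those of ε b and ε c in check.
      improve : ∀ b c → Live b → Live c → v b ≡ v c → τ b ≡ τ c → ¬ Comp κ* θ b c →
                Σ (Match A) λ κ₁ → Good κ₁ × 2 + orb₂ κ₁ θ ≤ orb₂ κ* θ
      improve b c lb lc vbc τbc ¬bc with ~dec (perm κ* θ) (app ε b) (app ε c)
      ... | no ¬r = merge-squares lb lc vbc τbc ¬bc ¬r
      -- `c` is replaced by its partner. As `κ*` commutes with `ε`, the mirror image moves to the
      -- partner too, which lies on the opposite orbit.
      ... | yes r = merge-squares lb (live* lc) (trans vbc (sym (vκ* c))) (trans τbc (sym (τκ* c)))
              (λ h → ¬bc (Comp-trans h (Comp-κ⁻ c)))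
              (λ r′ → ≉κ κ* θ (app ε b) (~trans (subst (κ* ∙ θ ⊢ app ε b ≈_) (sym (comm c)) r′) (≈flipκ κ* θ r)))

    Joined : Match A → Set
    Joined κ* = ∀ s t → Live s → Live t → v s ≡ v t → τ s ≡ τ t → Comp κ* θ s t

    greedy : ∀ m κ* → Good κ* → orb₂ κ* θ ≤ m → Σ (Match A) λ κ* → Good κ* × Joined κ*
    greedy m κ* G fuel with any-dec (λ s → any-dec (λ t →
        ¬? (dead? κ ε θ s) ×-dec ¬? (dead? κ ε θ t) ×-dec (v s ≟ v t) ×-dec (τ s ≟ᵇ τ t) ×-dec ¬? (Comp? κ* θ s t)))
    ... | no none = κ* , G , λ s t ls lt e e′ → dne (Comp? κ* θ s t) (λ ¬r → none (s , t , ls , lt , e , e′ , ¬r))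
      where
      dne : ∀ {P : Set} → Dec P → ¬ ¬ P → P
      dne (yes p) _ = p
      dne (no ¬p) h = contradiction ¬p h
    ... | yes (s , t , ls , lt , e , e′ , ¬r) = go m fuel (improve G s t ls lt e e′ ¬r)
      where
      go : ∀ m → orb₂ κ* θ ≤ m → (Σ (Match A) λ κ₁ → Good κ₁ × 2 + orb₂ κ₁ θ ≤ orb₂ κ* θ) →
           Σ (Match A) λ κ* → Good κ* × Joined κ*
      go zero h (κ₁ , G₁ , less) = contradiction (ℕₚ.≤-trans less h) (λ ())
      go (suc m) h (κ₁ , G₁ , less) = greedy m κ₁ G₁ (ℕₚ.≤-trans (ℕₚ.n≤1+n _) (ℕₚ.≤-pred (ℕₚ.≤-trans less h)))

    -- Joining the two parts at x and at y costs four orbits and yields a matching at least as connected as κ.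
    few-components : ∀ {κ*} → Good κ* → Joined κ* → ∀ w → Live w → orb₂ κ* θ ≤ 4 + orb₂ κ θ
    few-components {κ*} G J w lw = ℕₚ.≤-trans (switch-≥ κ* θ w (app κ w))
      (ℕₚ.+-monoʳ-≤ 2 (ℕₚ.≤-trans (switch-≥ κ₁ θ w′ (app κ w′)) (ℕₚ.+-monoʳ-≤ 2 (orb-comp-≤ κ₂ κ θ coarser))))
      where
      open Good G
      w′ = app ε w
      lw′ = live-ε lw
      κ₁ = switch w (app κ w) κ*
      κ₂ = switch w′ (app κ w′) κ₁
      ¬w : ¬ Comp κ* θ w (app κ w)
      ¬w r = mixed w lw (sym (Comp-label τ τκ* τθ r))
      -- The first switch connects the parts at `v w`, so `τ` is no longer constant on the cycles of
      -- `κ₁ ∪ θ`. Forgetting it at `v w` alone still tells the parts apart at the other vertex.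
      mark : A → Bool
      mark t = if ⌊ v t ≟ v w ⌋ then true else τ t
      mark-at : ∀ t → v t ≡ v w → mark t ≡ true
      mark-at t e with v t ≟ v w
      ... | yes _ = refl
      ... | no ne = contradiction e ne
      mark-off : ∀ t → v t ≢ v w → mark t ≡ τ t
      mark-off t ne with v t ≟ v w
      ... | yes e = contradiction e ne
      ... | no _ = refl
      mark-≡ : ∀ s t → v s ≡ v t → τ s ≡ τ t → mark s ≡ mark t
      mark-≡ s t e e′ = cong₂ (λ p q → if ⌊ p ≟ v w ⌋ then true else q) e e′
      ¬w′ : ¬ Comp κ₁ θ w′ (app κ w′)
      ¬w′ r = mixed w′ lw′ (trans (sym (mark-off _ (λ e → cross w lw (trans (sym (vκ w′)) e))))
        (trans (sym (Comp-label mark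
            (switch-label mark κ* (trans (mark-at w refl) (sym (mark-at _ (vκ w)))) (λ t → mark-≡ _ _ (vκ* t) (τκ* t)))
            (λ t → mark-≡ _ _ (vθ t) (τθ t)) r))
          (mark-off w′ (cross w lw))))
      up : ∀ {s t} → Comp κ* θ s t → Comp κ₂ θ s t
      up r = Comp-switch κ₁ θ _ _ ¬w′ (Comp-switch κ* θ _ _ ¬w r)
      to-w : ∀ s → Live s → v s ≡ v w → Comp κ₂ θ s w
      to-w s ls e with τ s ≟ᵇ τ w
      ... | yes e′ = up (J s w ls lw e e′)
      ... | no ne = Comp-trans (up (J s (app κ w) ls (live-κ lw) (trans e (sym (vκ w))) (third ne (mixed w lw))))
              (Comp-sym (Comp-switch κ₁ θ _ _ ¬w′ (switch-joins κ* θ _ _ ¬w)))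
      to-w′ : ∀ s → Live s → v s ≡ v w′ → Comp κ₂ θ s w′
      to-w′ s ls e with τ s ≟ᵇ τ w′
      ... | yes e′ = up (J s w′ ls lw′ e e′)
      ... | no ne = Comp-trans (up (J s (app κ w′) ls (live-κ lw′) (trans e (sym (vκ w′))) (third ne (mixed w′ lw′))))
              (Comp-sym (switch-joins κ₁ θ _ _ ¬w′))
      edge : ∀ t → Comp κ₂ θ t (app κ t)
      edge t with dead? κ ε θ t | v t ≟ v w
      ... | yes d | _ = subst (Comp κ₂ θ t) (θ≡κ d) (byε here)
      ... | no l | yes e = Comp-trans (to-w t l e) (Comp-sym (to-w _ (live-κ l) (trans (vκ t) e)))
      ... | no l | no ne = Comp-trans (to-w′ t l e) (Comp-sym (to-w′ _ (live-κ l) (trans (vκ t) e)))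
        where e = two-vertices l lw′ lw ne (cross w lw)
      coarser : ∀ a b → Comp κ θ a b → Comp κ₂ θ a b
      coarser a _ here = here
      coarser a _ (byκ r) = Comp-trans (coarser a _ r) (edge _)
      coarser a _ (byε r) = byε (coarser a _ r)

    crossing : ∀ w → Live w → Pure κ ε θ
    crossing w lw with greedy (orb₂ κ₀ θ) κ₀ good₀ ℕₚ.≤-refl
    ... | κ* , G , J = record { κ⁺ = κ* ; vκ⁺ = vκ* ; τκ⁺ = τκ* ; dead = dead*
        ; bound = ℕₚ.≤-trans (ℕₚ.+-mono-≤ (squares-maximal G) (few-components G J w lw))
            (ℕₚ.≤-reflexive (shift (orb₂ κ* ε) (orb₂ κ θ))) }
      where
      open Good G
      shift : ∀ a b → a + (4 + b) ≡ a + b + 4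
      shift a b = trans (cong (a +_) (ℕₚ.+-comm 4 b)) (sym (ℕₚ.+-assoc a b 4))

  progress : ∀ {κ ε θ} → Mixed κ ε θ → Pure κ ε θ ⊎ Progress κ ε θ
  progress {κ} {ε} {θ} M
    with any-dec (λ w → ¬? (dead? κ ε θ w) ×-dec (τ (app κ w) ≟ᵇ τ w))
       | any-dec (λ w → ¬? (dead? κ ε θ w) ×-dec (v (app ε w) ≟ v w))
       | any-dec (λ w → ¬? (dead? κ ε θ w))
  ... | yes (w , l , e) | _ | _ = inj₂ (contract M w l e)
  ... | no none | yes (w , l , e) | _ = inj₂ (close M (λ t l e → none (t , l , e)) w l e)
  ... | no none | no none′ | yes (w , l) =
    inj₁ (Crossing.crossing M (λ t l e → none (t , l , e)) (λ t l e → none′ (t , l , e)) w l)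
  -- On dead elements `κ` agrees with `ε` and therefore keeps the part.
  ... | no none | no _ | no all-dead = inj₁ (record
      { κ⁺ = κ ; vκ⁺ = vκ ; τκ⁺ = λ t → pure t (dead? κ ε θ t) ; dead = λ _ _ → refl ; bound = ℕₚ.m≤m+n _ 4 })
    where
    open Mixed M
    pure : ∀ t → Dec (Dead κ ε θ t) → τ (app κ t) ≡ τ t
    pure t (yes d) = trans (cong τ (sym (ε≡κ d))) (τε t)
    pure t (no l) = contradiction (t , l) all-dead

  purify : ∀ m κ ε θ → Mixed κ ε θ → badness κ ε θ ≤ m → Pure κ ε θ
  purify m κ ε θ M fuel with progress M
  ... | inj₁ S = S
  ... | inj₂ (κ₁ , ε₁ , θ₁ , M₁ , less , back) = go m fuel
    where
    go : ∀ m → badness κ ε θ ≤ m → Pure κ ε θ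
    go zero h = contradiction (ℕₚ.≤-trans less h) (λ ())
    go (suc m) h = back (purify m κ₁ ε₁ θ₁ M₁ (ℕₚ.≤-pred (ℕₚ.≤-trans less h)))

-- Embeddings as matchings on flags

Sum-product : ∀ {m k} (f : Fin (m * k) → ℕ) → Sum f ≡ Sum (λ i → Sum (λ j → f (combine {m} {k} i j)))
Sum-product {zero}  f = refl
Sum-product {suc m} {k} f = trans (Sum-append k f)
  (cong (Sum (λ j → f (j Fin.↑ˡ (m * k))) +_) (Sum-product {m} {k} (λ i → f (k Fin.↑ʳ i))))
  where
  Sum-append : ∀ k {l} (f : Fin (k + l) → ℕ) → Sum f ≡ Sum (λ i → f (i Fin.↑ˡ l)) + Sum (λ j → f (k Fin.↑ʳ j))
  Sum-append zero f = refl
  Sum-append (suc k) f = trans (cong (f zero +_) (Sum-append k (f ∘ suc))) (sym (ℕₚ.+-assoc (f zero) _ _))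

sum-allFin₂ : ∀ {n} (f : Fin n → Fin n → ℕ) →
  sum (map (λ i → sum (map (f i) (allFin n))) (allFin n)) ≡ Sum (λ i → Sum (f i))
sum-allFin₂ {n} f = trans (sum-allFin (λ i → sum (map (f i) (allFin n)))) (Sum-cong (λ i → sum-allFin (f i)))

sideFin : Bool → Fin 2
sideFin false = zero
sideFin true  = suc zero

finSide : Fin 2 → Bool
finSide zero = false
finSide (suc zero) = true

encState : ∀ {N} → State N → Fin (N * (N * 2))
encState (u , w , s) = combine u (combine w (sideFin s))

decState : ∀ {N} → Fin (N * (N * 2)) → State N
decState {N} i = let u , r = remQuot {N} (N * 2) i ; w , s = remQuot {N} 2 r in u , w , finSide s

decState-encState : ∀ {N} (t : State N) → decState (encState t) ≡ t
decState-encState {N} (u , w , s) = trans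
  (cong (λ (u , r) → let w , s = remQuot {N} 2 r in u , w , finSide s) (Finₚ.remQuot-combine u (combine w (sideFin s))))
  (trans (cong (λ (w , s) → u , w , finSide s) (Finₚ.remQuot-combine w (sideFin s))) (cong (λ b → u , w , b) (back s)))
  where
  back : ∀ s → finSide (sideFin s) ≡ s
  back false = refl
  back true = refl

encState-decState : ∀ {N} (i : Fin (N * (N * 2))) → encState {N} (decState i) ≡ i
encState-decState {N} i = trans (cong (combine (proj₁ (remQuot {N} (N * 2) i)))
    (trans (cong (combine (proj₁ (remQuot {N} 2 r))) (back _)) (Finₚ.combine-remQuot {N} 2 r)))
  (Finₚ.combine-remQuot {N} (N * 2) i)
  where
  r = proj₂ (remQuot {N} (N * 2) i)
  back : ∀ s → sideFin (finSide s) ≡ s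
  back zero = refl
  back (suc zero) = refl

finState : ∀ {N} → Finite (State N) (N * (N * 2))
finState {N} = record { enc = encState ; dec = decState ; dec-enc = decState-encState ; enc-dec = encState-decState {N} }

-- The encoding orders states as `code` does, so least elements of classes are the representatives
-- that `isRep` selects.
code-enc : ∀ {N} (t : State N) → toℕ (encState t) ≡ code t
code-enc {N} (u , w , s) = trans (Finₚ.toℕ-combine u _) (trans (cong (N * 2 * toℕ u +_) (Finₚ.toℕ-combine w (sideFin s)))
  (trans (sym (ℕₚ.+-assoc (N * 2 * toℕ u) (2 * toℕ w) _))
    (cong₂ _+_ (cong₂ _+_ (trans (ℕₚ.*-comm (N * 2) (toℕ u)) (cong (toℕ u *_) (ℕₚ.*-comm N 2))) (ℕₚ.*-comm 2 (toℕ w))) (side s))))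
  where
  side : ∀ s → toℕ (sideFin s) ≡ (if s then 1 else 0)
  side false = refl
  side true = refl

Sum-states : ∀ {N} (f : State N → ℕ) →
  Sum (f ∘ decState {N}) ≡ Sum (λ u → Sum (λ w → f (u , w , false) + f (u , w , true)))
Sum-states {N} f = trans (Sum-product {N} {N * 2} (f ∘ decState)) (Sum-cong λ u →
  trans (Sum-product {N} {2} (λ r → f (decState (combine u r)))) (Sum-cong λ w →
    trans (cong (f (decState (combine u (combine w zero))) +_) (ℕₚ.+-identityʳ _))
      (cong₂ _+_ (cong f (decState-encState (u , w , false))) (cong f (decState-encState (u , w , true))))))

≤ᵇ′⇒≤ : ∀ m n → (m ≤ᵇ' n) ≡ true → m ≤ n
≤ᵇ′⇒≤ zero n _ = z≤n
≤ᵇ′⇒≤ (suc m) (suc n) h = s≤s (≤ᵇ′⇒≤ m n h)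

≤⇒≤ᵇ′ : ∀ {m n} → m ≤ n → (m ≤ᵇ' n) ≡ true
≤⇒≤ᵇ′ z≤n = refl
≤⇒≤ᵇ′ (s≤s h) = ≤⇒≤ᵇ′ h

all-applyUpTo : ∀ {A : Set} (p : A → Bool) (f : ℕ → A) n → (∀ k → k < n → p (f k) ≡ true) → all p (applyUpTo f n) ≡ true
all-applyUpTo p f zero h = refl
all-applyUpTo p f (suc n) h = ∧-true (h 0 (s≤s z≤n)) (all-applyUpTo p (f ∘ suc) n (λ k lt → h (suc k) (s≤s lt)))

all-applyUpTo⁻ : ∀ {A : Set} (p : A → Bool) (f : ℕ → A) n → all p (applyUpTo f n) ≡ true → ∀ k → k < n → p (f k) ≡ true
all-applyUpTo⁻ p f (suc n) h zero _ = proj₁ (∧-true⁻ h)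
all-applyUpTo⁻ p f (suc n) h (suc k) (s≤s lt) = all-applyUpTo⁻ p (f ∘ suc) n (proj₂ (∧-true⁻ {p (f 0)} h)) k lt

not-≢ : ∀ b → not b ≢ b
not-≢ true ()
not-≢ false ()

vertexOf : ∀ {N} → State N → Fin N
vertexOf = proj₁

flipSide : ∀ {N} → State N → State N
flipSide (u , w , s) = u , w , not s

θ : ∀ {N} → Match (State N)
θ = record { app = flipSide ; invol = λ (u , w , s) → cong (λ b → u , w , b) (Boolₚ.not-involutive s)
           ; nofix = λ (u , w , s) e → not-≢ s (cong (proj₂ ∘ proj₂) e) }

flag : ∀ {N} → Graph N → State N → Bool
flag G (u , w , _) = E G u w

Symmetric Irreflexive : ∀ {N} → Graph N → Set
Symmetric G = ∀ a b → E G a b ≡ E G b a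
Irreflexive G = ∀ a → E G a a ≡ false

-- Seen from the other end, the two sides of a dart exchange names, whence the `not`; a twisted edge
-- undoes the exchange.
crossEdge : ∀ {N} → (Fin N → Fin N → Bool) → State N → State N
crossEdge sig (u , w , s) = w , u , not (s xor sig u w)

-- The corner between a dart and its successor joins the `true` side of the former to the `false`
-- side of the latter.
turn : ∀ {N} → (Fin N → Fin N → Fin N) → (Fin N → Fin N → Fin N) → State N → State N
turn r r⁻ (u , w , true)  = u , r u w , false
turn r r⁻ (u , w , false) = u , r⁻ u w , true

not-xor-twice : ∀ s g → not (not (s xor g) xor g) ≡ s
not-xor-twice false false = refl
not-xor-twice false true  = refl
not-xor-twice true  false = refl
not-xor-twice true  true  = refl

-- Non-flags are paired by flipping the side, so that they are inert.
onFlags : ∀ {N} → Graph N → (State N → State N) → State N → State N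
onFlags G f t = if flag G t then f t else flipSide t

onFlags-yes : ∀ {N} (G : Graph N) f t → flag G t ≡ true → onFlags G f t ≡ f t
onFlags-yes G f t h = cong (λ b → if b then f t else flipSide t) h

onFlags-no : ∀ {N} (G : Graph N) f t → flag G t ≡ false → onFlags G f t ≡ flipSide t
onFlags-no G f t h = cong (λ b → if b then f t else flipSide t) h

onFlagsMatch : ∀ {N} (G : Graph N) (f : State N → State N) → (∀ t → flag G t ≡ true → flag G (f t) ≡ true) →
  (∀ t → flag G t ≡ true → f (f t) ≡ t) → (∀ t → flag G t ≡ true → f t ≢ t) → Match (State N)
onFlagsMatch {N} G f ff inv nf = record { app = onFlags G f ; invol = λ t → i t _ refl ; nofix = λ t → n t _ refl }
  where
  i : ∀ t b → flag G t ≡ b → onFlags G f (onFlags G f t) ≡ t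
  i t true h = trans (cong (onFlags G f) (onFlags-yes G f t h)) (trans (onFlags-yes G f (f t) (ff t h)) (inv t h))
  i t false h = trans (cong (onFlags G f) (onFlags-no G f t h)) (trans (onFlags-no G f (flipSide t) h) (invol θ t))
  n : ∀ t b → flag G t ≡ b → onFlags G f t ≢ t
  n t true h e = nf t h (trans (sym (onFlags-yes G f t h)) e)
  n t false h e = nofix θ t (trans (sym (onFlags-no G f t h)) e)

module Gem {N} (G : Graph N) (symG : Symmetric G) (irrG : Irreflexive G) where
  open Finite (finState {N})
  open Orbits (finState {N})
  open Matchings (finState {N})

  edges : (sig : Fin N → Fin N → Bool) → (∀ u w → sig u w ≡ sig w u) → Match (State N)
  edges sig sig-sym = onFlagsMatch G (crossEdge sig) (λ (u , w , s) h → trans (symG w u) h)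
    (λ (u , w , s) h → cong (λ b → u , w , b) (trans (cong (λ g → not (not (s xor sig u w) xor g)) (sig-sym w u)) (not-xor-twice s (sig u w))))
    (λ (u , w , s) h e → true≢false (trans (sym h) (trans (cong (E G u) (cong proj₁ e)) (irrG u))))

  corners : Embedding G → Match (State N)
  corners e = onFlagsMatch G (turn (rot e) (rotInv e)) turn-flag turn-turn turn-nofix
    where
    turn-flag : ∀ t → flag G t ≡ true → flag G (turn (rot e) (rotInv e) t) ≡ true
    turn-flag (u , w , true) = rot-nb e u w
    turn-flag (u , w , false) = rotInv-nb e u w
    turn-turn : ∀ t → flag G t ≡ true → turn (rot e) (rotInv e) (turn (rot e) (rotInv e) t) ≡ t
    turn-turn (u , w , true) h = cong (λ z → u , z , true) (inv₁ e u w h)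
    turn-turn (u , w , false) h = cong (λ z → u , z , false) (inv₂ e u w h)
    turn-nofix : ∀ t → flag G t ≡ true → turn (rot e) (rotInv e) t ≢ t
    turn-nofix (u , w , true) h ()
    turn-nofix (u , w , false) h ()

  corners-vertex : ∀ e t → vertexOf (app (corners e) t) ≡ vertexOf t
  corners-vertex e (u , w , s) with E G u w
  corners-vertex e (u , w , true)  | true = refl
  corners-vertex e (u , w , false) | true = refl
  corners-vertex e (u , w , s)     | false = refl

  onFlags-flag : (f : State N → State N) → (∀ t → flag G t ≡ true → flag G (f t) ≡ true) →
                 ∀ t → flag G (onFlags G f t) ≡ flag G t
  onFlags-flag f c t = go (flag G t) refl
    where
    go : ∀ b → flag G t ≡ b → flag G (onFlags G f t) ≡ flag G t
    go true h = trans (cong (flag G) (onFlags-yes G f t h)) (trans (c t h) (sym h))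
    go false h = cong (flag G) (onFlags-no G f t h)

  corners-flag : ∀ e t → flag G (app (corners e) t) ≡ flag G t
  corners-flag e = onFlags-flag _ λ { (u , w , true) → rot-nb e u w ; (u , w , false) → rotInv-nb e u w }

  edges-flag : ∀ sig sig-sym t → flag G (app (edges sig sig-sym) t) ≡ flag G t
  edges-flag sig sig-sym = onFlags-flag _ (λ (u , w , s) h → trans (symG w u) h)

  flag-closed : (f : State N → State N) → (∀ t → flag G t ≡ true → flag G (f t) ≡ true) →
                ∀ k {t} → flag G t ≡ true → flag G (iter f k t) ≡ true
  flag-closed f c zero h = h
  flag-closed f c (suc k) h = c _ (flag-closed f c k h)

  module _ (e : Embedding G) where
    private
      π = perm (corners e) (edges (sig e) (sig-sym e))

      π-flag : ∀ t → flag G t ≡ true → flag G (fn π t) ≡ true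
      π-flag t h = go (app (edges (sig e) (sig-sym e)) t)
          (trans (cong (flag G) (onFlags-yes G (crossEdge (sig e)) t h)) (trans (symG _ _) h))
        where
        go : ∀ t → flag G t ≡ true → flag G (app (corners e) t) ≡ true
        go (u , w , true) h = trans (cong (flag G) (onFlags-yes G (turn (rot e) (rotInv e)) (u , w , true) h)) (rot-nb e u w h)
        go (u , w , false) h = trans (cong (flag G) (onFlags-yes G (turn (rot e) (rotInv e)) (u , w , false) h)) (rotInv-nb e u w h)

      step-π : ∀ t → flag G t ≡ true → step e t ≡ fn π t
      step-π (u , w , s) h = sym (trans (cong (app (corners e)) (onFlags-yes G (crossEdge (sig e)) (u , w , s) h))
        (trans (onFlags-yes G (turn (rot e) (rotInv e)) (w , u , not (s xor sig e u w)) (trans (symG w u) h)) (side (s xor sig e u w))))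
        where
        side : ∀ s′ → turn (rot e) (rotInv e) (w , u , not s′) ≡ (w , (if s′ then rotInv e w u else rot e w u) , s′)
        side true = refl
        side false = refl

      iter-π : ∀ t → flag G t ≡ true → ∀ k → iter (step e) k t ≡ iter (fn π) k t
      iter-π t h zero = refl
      iter-π t h (suc k) = trans (cong (step e) (iter-π t h k)) (step-π _ (flag-closed (fn π) π-flag k h))

      numStates : N * (N * 2) ≡ 2 * N * N
      numStates = trans (sym (ℕₚ.*-assoc N N 2)) (trans (ℕₚ.*-comm (N * N) 2) (sym (ℕₚ.*-assoc 2 N N)))

      counted : State N → Bool
      counted t = flag G t ∧ isRep e t

      sound : ∀ i → counted (dec i) ≡ true → Part.IsRep (orbPart (flag G) π) i
      sound i h = let f , r = ∧-true⁻ {flag G (dec i)} h in f , λ j fj i~j →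
        let k , k<n , eq = ~bounded π i~j in
        begin
          toℕ i ≡⟨ cong toℕ (enc-dec i) ⟨
          toℕ (enc (dec i)) ≡⟨ code-enc (dec i) ⟩
          code (dec i) ≤⟨ ≤ᵇ′⇒≤ _ _ (all-applyUpTo⁻ _ id (2 * N * N) r k (subst (k <_) numStates k<n)) ⟩
          code (iter (step e) k (dec i)) ≡⟨ cong code (trans (iter-π _ f k) eq) ⟩
          code (dec j) ≡⟨ code-enc (dec j) ⟨
          toℕ (enc (dec j)) ≡⟨ cong toℕ (enc-dec j) ⟩
          toℕ j ∎
        where open ℕₚ.≤-Reasoning

      complete : ∀ i → Part.IsRep (orbPart (flag G) π) i → counted (dec i) ≡ true
      complete i (f , least) = ∧-true f (all-applyUpTo _ id (2 * N * N) λ k _ →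
        let t = iter (fn π) k (dec i)
            le = least (enc t) (trans (cong (flag G) (dec-enc t)) (flag-closed (fn π) π-flag k f)) (k , sym (dec-enc t))
        in ≤⇒≤ᵇ′ (begin
          code (dec i) ≡⟨ code-enc (dec i) ⟨
          toℕ (enc (dec i)) ≡⟨ cong toℕ (enc-dec i) ⟩
          toℕ i ≤⟨ le ⟩
          toℕ (enc t) ≡⟨ code-enc t ⟩
          code t ≡⟨ cong code (iter-π _ f k) ⟨
          code (iter (step e) k (dec i)) ∎))
        where open ℕₚ.≤-Reasoning

    -- On flags `step` is corner after edge, and `isRep` inspects as many iterates as there are
    -- states, which exhausts the orbit.
    numOrbits-orbOn : numOrbits e ≡ orbOn (flag G) π
    numOrbits-orbOn = trans (sum-allFin₂ (λ u w → bit (counted (u , w , false)) + bit (counted (u , w , true))))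
      (trans (sym (Sum-states (λ t → bit (counted t))))
        (orbOn-spec (flag G) π (counted ∘ dec) sound complete))

  -- From the `false` side of a dart, `flipSide` and then the corner lead to the `false` side of its
  -- `rot`-successor. So `cyclic` puts all darts at a vertex on one cycle.
  corners-connected : ∀ e {u w z} s s′ → E G u w ≡ true → E G u z ≡ true → Comp (corners e) θ (u , w , s) (u , z , s′)
  corners-connected e {u} {w} {z} s s′ hw hz with cyclic e u w z hw hz
  ... | k , refl = Comp-trans (Comp-sym (sides false s w)) (Comp-trans (walk k) (sides false s′ _))
    where
    sides : ∀ s s′ w → Comp (corners e) θ (u , w , s) (u , w , s′)
    sides true true w = here
    sides false false w = here
    sides true false w = byε here
    sides false true w = byε here
    flags : ∀ k → E G u (iter (rot e u) k w) ≡ true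
    flags zero = hw
    flags (suc k) = rot-nb e u _ (flags k)
    walk : ∀ k → Comp (corners e) θ (u , w , false) (u , iter (rot e u) k w , false)
    walk zero = here
    walk (suc k) = subst (Comp (corners e) θ _)
      (onFlags-yes G (turn (rot e) (rotInv e)) (u , iter (rot e u) k w , true) (flags k)) (byκ (byε (walk k)))

-- The matching κ is turned into rotations by orienting each vertex along one of its two κ ∘ θ orbits;
-- χ records on which side of each dart that orbit runs.
module Realize {N} (G : Graph N) (symG : Symmetric G) (irrG : Irreflexive G)
  (κ ε : Match (State N)) (sg : Fin N → Fin N → Bool) (sg-sym : ∀ u w → sg u w ≡ sg w u)
  (κ-vertex : ∀ t → vertexOf (app κ t) ≡ vertexOf t)
  (κ-flag : ∀ t → flag G t ≡ true → flag G (app κ t) ≡ true)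
  (ε-flag : ∀ t → flag G t ≡ true → app ε t ≡ crossEdge sg t)
  (connected : ∀ u w z → E G u w ≡ true → E G u z ≡ true →
               Matchings.Comp finState κ θ (u , w , false) (u , z , false)) where
  open Orbits (finState {N})
  open Matchings (finState {N})
  open Gem G symG irrG
  private
    ρ = perm κ θ

    base? : ∀ u → Dec (∃ λ b → E G u b ≡ true)
    base? u = Finₚ.any? (λ b → E G u b ≟ᵇ true)

    χ₀ : ∀ u → Dec (∃ λ b → E G u b ≡ true) → Fin N → Bool
    χ₀ u (yes (b , _)) w = not ⌊ ~dec ρ (u , w , false) (u , b , false) ⌋
    χ₀ u (no _) w = false

    χ : Fin N → Fin N → Bool
    χ u w = χ₀ u (base? u) w

    χ₀-base : ∀ u w b (h : E G u b ≡ true) → E G u w ≡ true →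
              κ ∙ θ ⊢ (u , w , χ₀ u (yes (b , h)) w) ≈ (u , b , false)
    χ₀-base u w b hb hw with ~dec ρ (u , w , false) (u , b , false)
    ... | yes r = r
    ... | no ¬r with Comp⇒≈ (connected u w b hw hb)
    ... | inj₁ r = contradiction r ¬r
    ... | inj₂ r = ~sym ρ (≈flip κ θ r)

    χ-orbit : ∀ {u w z} → E G u w ≡ true → E G u z ≡ true → κ ∙ θ ⊢ (u , w , χ u w) ≈ (u , z , χ u z)
    χ-orbit {u} {w} {z} hw hz = go (base? u)
      where
      go : ∀ d → κ ∙ θ ⊢ (u , w , χ₀ u d w) ≈ (u , z , χ₀ u d z)
      go (yes (b , hb)) = ~trans (χ₀-base u w b hb hw) (~sym ρ (χ₀-base u z b hb hz))
      go (no none) = contradiction (w , hw) none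

    bool-cases : ∀ a b → a ≡ b ⊎ a ≡ not b
    bool-cases true true = inj₁ refl
    bool-cases true false = inj₂ refl
    bool-cases false true = inj₂ refl
    bool-cases false false = inj₁ refl

    -- By `≉partner` the two sides of a dart lie on different orbits, so the orbit chosen at `u`
    -- determines the side.
    side-χ : ∀ {u w z s} → E G u w ≡ true → E G u z ≡ true → κ ∙ θ ⊢ (u , w , χ u w) ≈ (u , z , s) → s ≡ χ u z
    side-χ {u} {w} {z} {s} hw hz r with bool-cases s (χ u z)
    ... | inj₁ e = e
    ... | inj₂ e = contradiction (~trans (~sym ρ (χ-orbit hw hz)) (subst (λ b → κ ∙ θ ⊢ (u , w , χ u w) ≈ (u , z , b)) e r))
                     (≉partner κ θ (u , z , χ u z))

    next : Fin N → Fin N → Bool → Fin N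
    next u w s = proj₁ (proj₂ (app κ (u , w , s)))

    r r⁻ : Fin N → Fin N → Fin N
    r u w = next u w (not (χ u w))
    r⁻ u w = next u w (χ u w)

    next-flag : ∀ {u w} s → E G u w ≡ true → E G u (next u w s) ≡ true
    next-flag {u} {w} s h = trans (cong (λ z → E G z (next u w s)) (sym (κ-vertex (u , w , s)))) (κ-flag (u , w , s) h)

    next-at : ∀ u w s → ∃ λ s′ → app κ (u , w , s) ≡ (u , next u w s , s′)
    next-at u w s = proj₂ (proj₂ (app κ (u , w , s))) , cong (λ z → z , proj₂ (app κ (u , w , s))) (κ-vertex (u , w , s))

    κ-fwd : ∀ {u w} → E G u w ≡ true → app κ (u , w , not (χ u w)) ≡ (u , r u w , χ u (r u w))
    κ-fwd {u} {w} h with next-at u w (not (χ u w))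
    ... | s′ , e = trans e (cong (λ b → u , r u w , b) (side-χ h (next-flag _ h) (1 , e)))

    κ-bwd : ∀ {u w} → E G u w ≡ true → app κ (u , w , χ u w) ≡ (u , r⁻ u w , not (χ u (r⁻ u w)))
    κ-bwd {u} {w} h with next-at u w (χ u w)
    ... | s′ , e = trans e (cong (λ b → u , r⁻ u w , b)
          (trans (sym (Boolₚ.not-involutive s′)) (cong not (side-χ h (next-flag _ h)
            (~sym ρ (1 , trans (cong (λ b → app κ (u , r⁻ u w , b)) (Boolₚ.not-involutive s′)) (sym (adj κ e))))))))

    second : ∀ {t t′ : State N} → t ≡ t′ → proj₁ (proj₂ t) ≡ proj₁ (proj₂ t′)
    second = cong (proj₁ ∘ proj₂)

    iter-ρ : ∀ {u w} → E G u w ≡ true → ∀ k →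
      E G u (iter (r u) k w) ≡ true × iter (fn ρ) k (u , w , χ u w) ≡ (u , iter (r u) k w , χ u (iter (r u) k w))
    iter-ρ h zero = h , refl
    iter-ρ h (suc k) = let h′ , e = iter-ρ h k in next-flag _ h′ , trans (cong (fn ρ) e) (κ-fwd h′)

    -- An edge changes its signature once for each end at which `χ` renames the sides.
    sg′ : Fin N → Fin N → Bool
    sg′ u w = sg u w xor (χ u w xor χ w u)

  realized : Embedding G
  realized = record
    { rot = r ; rotInv = r⁻ ; sig = sg′
    ; rot-nb = λ u w h → next-flag _ h
    ; rotInv-nb = λ u w h → next-flag _ h
    ; inv₁ = λ u w h → second (trans (cong (app κ) (sym (κ-fwd h))) (invol κ _))
    ; inv₂ = λ u w h → second (trans (cong (app κ) (sym (κ-bwd h))) (invol κ _))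
    ; cyclic = λ u w z hw hz → let k , e = χ-orbit hw hz in k , second (trans (sym (proj₂ (iter-ρ hw k))) e)
    ; sig-sym = λ u w → cong₂ _xor_ (sg-sym u w) (Boolₚ.xor-comm (χ u w) (χ w u)) }

  private
    -- Renames sides so that the chosen orbits run along `false` sides. On flags it carries `κ` and
    -- `ε` to the corners and edges of `realized`.
    β : State N → State N
    β (u , w , s) = u , w , s xor χ u w

    xor-xor : ∀ s c → (s xor c) xor c ≡ s
    xor-xor false false = refl
    xor-xor false true = refl
    xor-xor true false = refl
    xor-xor true true = refl

    cross-xor : ∀ s g a b → not (s xor g) xor b ≡ not ((s xor a) xor (g xor (a xor b)))
    cross-xor false false false false = refl
    cross-xor false false false true  = refl
    cross-xor false false true  false = refl
    cross-xor false false true  true  = refl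
    cross-xor false true  false false = refl
    cross-xor false true  false true  = refl
    cross-xor false true  true  false = refl
    cross-xor false true  true  true  = refl
    cross-xor true  false false false = refl
    cross-xor true  false false true  = refl
    cross-xor true  false true  false = refl
    cross-xor true  false true  true  = refl
    cross-xor true  true  false false = refl
    cross-xor true  true  false true  = refl
    cross-xor true  true  true  false = refl
    cross-xor true  true  true  true  = refl

    xor-self : ∀ c → c xor c ≡ false
    xor-self false = refl
    xor-self true = refl

    not-xor-self : ∀ c → not c xor c ≡ true
    not-xor-self false = refl
    not-xor-self true = refl

    β-cross : ∀ t → flag G t ≡ true → β (app ε t) ≡ app (edges sg′ (sig-sym realized)) (β t)
    β-cross (u , w , s) h = trans (cong β (ε-flag _ h)) (trans (cong (λ b → w , u , b) (cross-xor s (sg u w) (χ u w) (χ w u)))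
      (sym (onFlags-yes G (crossEdge sg′) (β (u , w , s)) h)))

    β-turn : ∀ t → flag G t ≡ true → β (app κ t) ≡ app (corners realized) (β t)
    β-turn (u , w , s) h with bool-cases s (χ u w)
    ... | inj₁ refl = trans (cong β (κ-bwd h)) (trans (cong (λ b → u , r⁻ u w , b) (not-xor-self (χ u (r⁻ u w))))
          (sym (trans (onFlags-yes G (turn r r⁻) (β (u , w , χ u w)) h) (cong (λ b → turn r r⁻ (u , w , b)) (xor-self (χ u w))))))
    ... | inj₂ refl = trans (cong β (κ-fwd h)) (trans (cong (λ b → u , r u w , b) (xor-self (χ u (r u w))))
          (sym (trans (onFlags-yes G (turn r r⁻) (β (u , w , not (χ u w))) h) (cong (λ b → turn r r⁻ (u , w , b)) (not-xor-self (χ u w))))))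

    ε-keeps : ∀ t → flag G t ≡ true → flag G (app ε t) ≡ true
    ε-keeps (u , w , s) h = trans (cong (flag G) (ε-flag _ h)) (trans (symG w u) h)

  numOrbits-realized : numOrbits realized ≡ orbOn (flag G) (perm κ ε)
  numOrbits-realized = trans (numOrbits-orbOn realized)
    (orbOn-conj (flag G) (flag G) (perm (corners realized) (edges sg′ (sig-sym realized))) (perm κ ε) β
      (λ (u , w , s) → cong (λ b → u , w , b) (xor-xor s (χ u w)))
      (λ _ h → h) (λ _ h → h)
      (λ t h → κ-flag _ (ε-keeps t h))
      (λ t h → trans (β-turn _ (ε-keeps t h)) (cong (app (corners realized)) (β-cross t h))))

-- Laying two edges side by side and excising darts

module Joining {A : Set} {n : ℕ} (F : Finite A n) where
  open Orbits F
  open Matchings F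

  module _ (κ ε : Match A) (h k : A) where
    join₁ join₂ : Match A
    join₁ = switch (app κ h) k κ
    join₂ = switch (app join₁ (app ε h)) (app ε k) join₁

    join₁-at : h ≢ k → app join₁ h ≡ k
    join₁-at h≢k = switch-moved κ (nofix κ h ∘ sym) h≢k refl

    -- The first switch merges two faces at worst; the second one closes the digon h k (ε k) (ε h).
    orb-join : h ≢ k → app join₁ (app ε h) ≢ app ε k → orb₂ κ ε ≤ orb₂ join₂ ε
    orb-join h≢k ne = ℕₚ.≤-trans (switch-≥ κ ε (app κ h) k)
      (switch-close join₁ ε _ _ ne (~sym (perm join₁ ε) (2 ,
        cong (app join₁ ∘ app ε) (trans (cong (app join₁) (invol ε k)) (sym (adj join₁ (join₁-at h≢k)))))))

  -- Walks through the excised pair {w, θ w} are rerouted through κ w.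
  module Excise (κ θ : Match A) (w : A) (ne : app κ w ≢ app θ w) where
    private
      κ′ = switch (app θ w) (app κ w) κ

      bypass₀ : ∀ t → Dec (t ≡ w) → Dec (t ≡ app θ w) → A
      bypass₀ t (yes _) _ = app κ w
      bypass₀ t (no _) (yes _) = app κ w
      bypass₀ t (no _) (no _) = t

      bypass : A → A
      bypass t = bypass₀ t (t ≟ᴬ w) (t ≟ᴬ app θ w)

      bypass-w : ∀ {t} → t ≡ w ⊎ t ≡ app θ w → bypass t ≡ app κ w
      bypass-w {t} h with t ≟ᴬ w | t ≟ᴬ app θ w | h
      ... | yes _ | _ | _ = refl
      ... | no _ | yes _ | _ = refl
      ... | no p | no q | inj₁ e = contradiction e p
      ... | no p | no q | inj₂ e = contradiction e q

      bypass-off : ∀ {t} → t ≢ w → t ≢ app θ w → bypass t ≡ t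
      bypass-off {t} p q with t ≟ᴬ w | t ≟ᴬ app θ w
      ... | yes e | _ = contradiction e p
      ... | no _ | yes e = contradiction e q
      ... | no _ | no _ = refl

      κθw≢w : app κ (app θ w) ≢ w
      κθw≢w e = ne (sym (adj κ e))

      shortcut : Comp κ′ θ (app κ (app θ w)) (app κ w)
      shortcut = subst (Comp κ′ θ _)
        (switch-moved κ (nofix κ _) (λ e → nofix θ w (app-inj κ e)) (invol κ _)) (byκ here)

      κ-edge : ∀ t → Comp κ′ θ (bypass t) (bypass (app κ t))
      κ-edge t with t ≟ᴬ w | t ≟ᴬ app θ w | t ≟ᴬ app κ w | t ≟ᴬ app κ (app θ w)
      ... | yes refl | _ | _ | _ = subst (Comp κ′ θ _) (sym (bypass-off (nofix κ t) ne)) here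
      ... | no _ | yes refl | _ | _ = subst (Comp κ′ θ _) (sym (bypass-off κθw≢w (nofix κ _))) (Comp-sym shortcut)
      ... | no p | no q | yes refl | _ = subst (Comp κ′ θ _) (sym (bypass-w (inj₁ (invol κ w)))) here
      ... | no p | no q | no _ | yes refl = subst (Comp κ′ θ _) (sym (bypass-w (inj₂ (invol κ _)))) shortcut
      ... | no p | no q | no r | no s = subst (Comp κ′ θ t)
            (trans (switch-off κ q r (λ e → s (adj κ e)) (p ∘ app-inj κ)) (sym (bypass-off (λ e → r (adj κ e)) (λ e → s (adj κ e)))))
            (byκ here)

      θ-edge : ∀ t → Comp κ′ θ (bypass t) (bypass (app θ t))
      θ-edge t with t ≟ᴬ w | t ≟ᴬ app θ w
      ... | yes refl | _ = subst (Comp κ′ θ _) (sym (bypass-w (inj₂ refl))) here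
      ... | no _ | yes refl = subst (Comp κ′ θ _) (sym (bypass-w (inj₁ (invol θ w)))) here
      ... | no p | no q = subst (Comp κ′ θ t) (sym (bypass-off (λ e → q (adj θ e)) (λ e → p (app-inj θ e)))) (byε here)

      walk : ∀ {s t} → Comp κ θ s t → Comp κ′ θ (bypass s) (bypass t)
      walk here = here
      walk (byκ r) = Comp-trans (walk r) (κ-edge _)
      walk (byε r) = Comp-trans (walk r) (θ-edge _)

    Comp-excise : ∀ {s t} → s ≢ w → s ≢ app θ w → t ≢ w → t ≢ app θ w → Comp κ θ s t → Comp κ′ θ s t
    Comp-excise p q p′ q′ r = subst (Comp κ′ θ _) (bypass-off p′ q′) (subst (λ z → Comp κ′ θ z (bypass _)) (bypass-off p q) (walk r))

-- Flags of an edge amalgamation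

finVertex : ∀ {N} → Finite (Fin N) N
finVertex = record { enc = id ; dec = id ; dec-enc = λ _ → refl ; enc-dec = λ _ → refl }

-- H and K share the edge xy; in their union the copy of xy belonging to K is moved by β
-- to the otherwise unused flags (x , x , _) and (y , y , _).
record Amalgam {N} (x y : Fin N) (H K U : Graph N) : Set where
  field
    x≢y    : x ≢ y
    symH   : Symmetric H
    irrH   : Irreflexive H
    symK   : Symmetric K
    irrK   : Irreflexive K
    Hxy    : E H x y ≡ true
    Kxy    : E K x y ≡ true
    shared : ∀ u w z → E H u w ≡ true → E K u z ≡ true → u ≡ x ⊎ u ≡ y
    EU     : ∀ u w → E U u w ≡ E H u w ∨ E K u w

∨-true : ∀ {a b} → a ∨ b ≡ true → a ≡ true ⊎ b ≡ true
∨-true {true} _ = inj₁ refl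
∨-true {false} h = inj₂ h

∨-trueˡ : ∀ {a b} → a ≡ true → a ∨ b ≡ true
∨-trueˡ refl = refl

∨-trueʳ : ∀ {a b} → b ≡ true → a ∨ b ≡ true
∨-trueʳ {true} _ = refl
∨-trueʳ {false} h = h

module AmalgamFlags {N} {x y : Fin N} {H K U : Graph N} (am : Amalgam x y H K U) where
  open Amalgam am
  open Finite (finState {N})
  open Orbits (finState {N})
  open Matchings (finState {N})
  open Joining (finState {N})
  module V = Orbits (finVertex {N})

  τ : State N → Bool
  τ = flag H

  y≢x : y ≢ x
  y≢x = x≢y ∘ sym

  Hyx : E H y x ≡ true
  Hyx = trans (symH y x) Hxy

  Kyx : E K y x ≡ true
  Kyx = trans (symK y x) Kxy

  symU : Symmetric U
  symU a b = trans (EU a b) (trans (cong₂ _∨_ (symH a b) (symK a b)) (sym (EU b a)))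

  irrU : Irreflexive U
  irrU a = trans (EU a a) (cong₂ _∨_ (irrH a) (irrK a))

  β : State N → State N
  β (u , w , s) = u , (if ⌊ u ≟ x ⌋ ∨ ⌊ u ≟ y ⌋ then V.swap x y w else w) , s

  β-at : ∀ {u} → u ≡ x ⊎ u ≡ y → ∀ w s → β (u , w , s) ≡ (u , V.swap x y w , s)
  β-at {u} h w s with u ≟ x | u ≟ y | h
  ... | yes _ | _ | _ = refl
  ... | no _ | yes _ | _ = refl
  ... | no p | no q | inj₁ e = contradiction e p
  ... | no p | no q | inj₂ e = contradiction e q

  β-off : ∀ {u} → u ≢ x → u ≢ y → ∀ w s → β (u , w , s) ≡ (u , w , s)
  β-off {u} p q w s with u ≟ x | u ≟ y
  ... | yes e | _ = contradiction e p
  ... | no _ | yes e = contradiction e q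
  ... | no _ | no _ = refl

  β-β : ∀ t → β (β t) ≡ t
  β-β (u , w , s) = go (u ≟ x) (u ≟ y)
    where
    swapped : u ≡ x ⊎ u ≡ y → β (β (u , w , s)) ≡ (u , w , s)
    swapped e = trans (cong β (β-at e w s)) (trans (β-at e _ s) (cong (λ z → u , z , s) (V.swap-swap x y w)))
    go : Dec (u ≡ x) → Dec (u ≡ y) → β (β (u , w , s)) ≡ (u , w , s)
    go (yes e) _ = swapped (inj₁ e)
    go (no _) (yes e) = swapped (inj₂ e)
    go (no p) (no q) = trans (cong β (β-off p q w s)) (β-off p q w s)

  βxy : ∀ s → β (x , y , s) ≡ (x , x , s)
  βxy s = trans (β-at (inj₁ refl) y s) (cong (λ z → x , z , s) (V.swap-r x y))

  βyx : ∀ s → β (y , x , s) ≡ (y , y , s)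
  βyx s = trans (β-at (inj₂ refl) x s) (cong (λ z → y , z , s) (V.swap-l x y))

  βxx : ∀ s → β (x , x , s) ≡ (x , y , s)
  βxx s = trans (cong β (sym (βxy s))) (β-β _)

  βyy : ∀ s → β (y , y , s) ≡ (y , x , s)
  βyy s = trans (cong β (sym (βyx s))) (β-β _)

  flagK : State N → Bool
  flagK t = flag K (β t)

  data Edge (u w : Fin N) : Set where
    is-xy : u ≡ x → w ≡ y → Edge u w
    is-yx : u ≡ y → w ≡ x → Edge u w
    plain : (∀ s → β (u , w , s) ≡ (u , w , s)) → E H u w ≡ false → Edge u w

  edgeK : ∀ {u w} → E K u w ≡ true → Edge u w
  edgeK {u} {w} h = go (u ≟ x) (u ≟ y) (w ≟ x) (w ≟ y)
    where
    private-end : w ≢ x → w ≢ y → E H u w ≡ false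
    private-end p q = ¬true⇒false (λ e → case (shared w u u (trans (symH w u) e) (trans (symK w u) h)))
      where
      case : w ≡ x ⊎ w ≡ y → ⊥
      case (inj₁ e) = p e
      case (inj₂ e) = q e
    loop : u ≡ w → ⊥
    loop refl = true≢false (trans (sym h) (irrK u))
    go : Dec (u ≡ x) → Dec (u ≡ y) → Dec (w ≡ x) → Dec (w ≡ y) → Edge u w
    go (yes e) _ _ (yes f) = is-xy e f
    go (yes e) _ (yes f) (no _) = ⊥-elim (loop (trans e (sym f)))
    go (yes e) _ (no p) (no q) = plain (λ s → trans (β-at (inj₁ e) w s) (cong (λ z → u , z , s) (V.swap-off p q))) (private-end p q)
    go (no _) (yes e) (yes f) _ = is-yx e f
    go (no _) (yes e) (no _) (yes f) = ⊥-elim (loop (trans e (sym f)))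
    go (no _) (yes e) (no p) (no q) = plain (λ s → trans (β-at (inj₂ e) w s) (cong (λ z → u , z , s) (V.swap-off p q))) (private-end p q)
    go (no p) (no q) _ _ = plain (β-off p q w) (¬true⇒false (λ e → case (shared u w w e h)))
      where
      case : u ≡ x ⊎ u ≡ y → ⊥
      case (inj₁ e) = p e
      case (inj₂ e) = q e

  data Special : State N → Set where
    at-x : ∀ s → Special (x , x , s)
    at-y : ∀ s → Special (y , y , s)

  data KFlag : State N → Set where
    special : ∀ {t} → Special t → KFlag t
    plain   : ∀ {t} → β t ≡ t → flag K t ≡ true → flag H t ≡ false → KFlag t

  kflag : ∀ t → flagK t ≡ true → KFlag t
  kflag t h = subst KFlag (β-β t) (go (β t) h)
    where
    go : ∀ t → flag K t ≡ true → KFlag (β t)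
    go (u , w , s) h with edgeK h
    ... | is-xy refl refl = special (subst Special (sym (βxy s)) (at-x s))
    ... | is-yx refl refl = special (subst Special (sym (βyx s)) (at-y s))
    ... | plain fix f = subst KFlag (sym (fix s)) (plain (fix s) h f)

  special-θ : ∀ {t} → Special t → Special (flipSide t)
  special-θ (at-x s) = at-x (not s)
  special-θ (at-y s) = at-y (not s)

  special-H : ∀ {t} → Special t → flag H t ≡ false
  special-H (at-x s) = irrH x
  special-H (at-y s) = irrH y

  special-U : ∀ {t} → Special t → flag U t ≡ false
  special-U (at-x s) = irrU x
  special-U (at-y s) = irrU y

  special-K : ∀ {t} → Special t → flagK t ≡ true
  special-K (at-x s) = trans (cong (flag K) (βxx s)) Kxy
  special-K (at-y s) = trans (cong (flag K) (βyy s)) Kyx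

  K⇒¬H : ∀ t → flagK t ≡ true → flag H t ≡ false
  K⇒¬H t h with kflag t h
  ... | special sp = special-H sp
  ... | plain _ _ f = f

  H⇒¬K : ∀ t → flag H t ≡ true → flagK t ≡ false
  H⇒¬K t h = ¬true⇒false (λ k → true≢false (trans (sym h) (K⇒¬H t k)))

  -- Flags of the union with `xy` doubled: the flags of `H` and, disjoint from them, the relocated
  -- flags of `K`.
  flagD : State N → Bool
  flagD t = flag H t ∨ flagK t

  H⇒D : ∀ t → flag H t ≡ true → flagD t ≡ true
  H⇒D t = ∨-trueˡ

  K⇒D : ∀ t → flagK t ≡ true → flagD t ≡ true
  K⇒D t = ∨-trueʳ

  special-D : ∀ {t} → Special t → flagD t ≡ true
  special-D {t} sp = K⇒D t (special-K sp)

  H⇒U : ∀ t → flag H t ≡ true → flag U t ≡ true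
  H⇒U (u , w , s) h = trans (EU u w) (∨-trueˡ h)

  U⇒D : ∀ t → flag U t ≡ true → flagD t ≡ true
  U⇒D t@(u , w , s) h with ∨-true (trans (sym (EU u w)) h)
  ... | inj₁ e = H⇒D t e
  ... | inj₂ e with edgeK e
  ... | is-xy refl refl = H⇒D t Hxy
  ... | is-yx refl refl = H⇒D t Hyx
  ... | plain fix _ = K⇒D t (trans (cong (flag K) (fix s)) e)

  D⇒U : ∀ t → flagD t ≡ true → flag U t ≡ true ⊎ Special t
  D⇒U t@(u , w , s) h with ∨-true {flag H t} h
  ... | inj₁ e = inj₁ (H⇒U t e)
  ... | inj₂ e with kflag t e
  ... | special sp = inj₂ sp
  ... | plain _ k _ = inj₁ (trans (EU u w) (∨-trueʳ {E H u w} k))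

  ¬D⇒¬U : ∀ t → flagD t ≡ false → flag U t ≡ false
  ¬D⇒¬U t h = ¬true⇒false (λ e → true≢false (trans (sym (U⇒D t e)) h))

  ¬D⇒¬H : ∀ t → flagD t ≡ false → flag H t ≡ false
  ¬D⇒¬H t h = ¬true⇒false (λ e → true≢false (trans (sym (H⇒D t e)) h))

  ¬D⇒¬K : ∀ t → flagD t ≡ false → flagK t ≡ false
  ¬D⇒¬K t h = ¬true⇒false (λ e → true≢false (trans (sym (K⇒D t e)) h))

  D∧¬H⇒K : ∀ t → flagD t ≡ true → flag H t ≡ false → flagK t ≡ true
  D∧¬H⇒K t d h = subst (λ b → b ∨ flagK t ≡ true) h d

  size : (State N → Bool) → ℕ
  size Q = cnt (Q ∘ dec)

  -- The 4 counts the relocated flags of `xy`, two sides at each end; they belong to the doubled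
  -- graph but not to `U`.
  size-U : size (not ∘ flag U) ≡ 4 + size (not ∘ flagD)
  size-U = trans (remove {q₀} (x , x , false) refl₀) (cong suc (trans (remove {q₁} (x , x , true) refl₁)
    (cong suc (trans (remove {q₂} (y , y , false) refl₂) (cong suc (trans (remove {q₃} (y , y , true) refl₃)
      (cong suc (cnt-cong rest))))))))
    where
    q₀ q₁ q₂ q₃ q₄ : Fin (N * (N * 2)) → Bool
    q₀ = not ∘ flag U ∘ dec
    q₁ = q₀ ∖ enc (x , x , false)
    q₂ = q₁ ∖ enc (x , x , true)
    q₃ = q₂ ∖ enc (y , y , false)
    q₄ = q₃ ∖ enc (y , y , true)
    remove : ∀ {q : Fin (N * (N * 2)) → Bool} t → q (enc t) ≡ true → cnt q ≡ suc (cnt (q ∖ enc t))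
    remove {q} t = cnt-∖ q (enc t)
    at : ∀ {t} → Special t → q₀ (enc t) ≡ true
    at {t} sp = cong not (trans (cong (flag U) (dec-enc t)) (special-U sp))
    side≢ : ∀ {u w s u′ w′ s′} → s ≢ s′ → enc (u , w , s) ≢ enc (u′ , w′ , s′)
    side≢ p e = p (cong (proj₂ ∘ proj₂) (enc-inj e))
    vertex≢ : ∀ {u w s u′ w′ s′} → u ≢ u′ → enc (u , w , s) ≢ enc (u′ , w′ , s′)
    vertex≢ p e = p (cong proj₁ (enc-inj e))
    refl₀ = at (at-x false)
    refl₁ = ∖-true {q = q₀} (at (at-x true)) (side≢ λ ())
    refl₂ = ∖-true {q = q₁} (∖-true {q = q₀} (at (at-y false)) (vertex≢ y≢x)) (vertex≢ y≢x)
    refl₃ = ∖-true {q = q₂} (∖-true {q = q₁} (∖-true {q = q₀} (at (at-y true)) (vertex≢ y≢x)) (vertex≢ y≢x)) (side≢ λ ())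
    rest : ∀ i → q₄ i ≡ not (flagD (dec i))
    rest i = bool-ext
      (λ h → let h₃ , n₃ = ∖-true⁻ {q = q₃} h ; h₂ , n₂ = ∖-true⁻ {q = q₂} h₃
                 h₁ , n₁ = ∖-true⁻ {q = q₁} h₂ ; h₀ , n₀ = ∖-true⁻ {q = q₀} h₁
                 hit : ∀ {t} → dec i ≡ t → i ≡ enc t
                 hit e = trans (sym (enc-dec i)) (cong enc e)
                 none : ∀ {t} → Special t → dec i ≡ t → ⊥
                 none = λ { (at-x false) e → n₀ (hit e) ; (at-x true) e → n₁ (hit e)
                          ; (at-y false) e → n₂ (hit e) ; (at-y true) e → n₃ (hit e) }
                 no-D : flagD (dec i) ≡ true → ⊥
                 no-D d = case (D⇒U (dec i) d) (not-false h₀) none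
             in cong not (¬true⇒false no-D))
      (λ h → let ne : ∀ {t} → Special t → i ≢ enc t
                 ne {t} sp e = true≢false (trans (sym (special-D sp)) (trans (cong flagD (trans (sym (dec-enc t)) (cong dec (sym e)))) (not-false h)))
             in ∖-true {q = q₃} (∖-true {q = q₂} (∖-true {q = q₁} (∖-true {q = q₀}
                  (cong not (¬D⇒¬U (dec i) (not-false h))) (ne (at-x false))) (ne (at-x true))) (ne (at-y false))) (ne (at-y true)))
      where
      case : ∀ {t} → flag U t ≡ true ⊎ Special t → flag U t ≡ false → (∀ {t′} → Special t′ → t ≡ t′ → ⊥) → ⊥
      case (inj₁ e) f _ = true≢false (trans (sym e) f)
      case (inj₂ sp) _ none = none sp refl

  -- Non-flags are fixed by the composition and are orbits of their own; the second summand accounts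
  -- for them.
  orb-U : (κ ε : Match (State N)) → (∀ t → flag U t ≡ true → flag U (app κ (app ε t)) ≡ true) →
    (∀ t → flag U t ≡ false → app κ (app ε t) ≡ t) → orb₂ κ ε ≡ orbOn (flag U) (perm κ ε) + size (not ∘ flag U)
  orb-U κ ε keep fixed = trans
    (orbOn-split (λ _ → true) (flag U) (not ∘ flag U) (perm κ ε) (λ t → split (flag U t)) keep
      (λ t h → trans (cong (not ∘ flag U) (fixed t (not-false h))) h))
    (cong (orbOn (flag U) (perm κ ε) +_) (orbOn-fixed (not ∘ flag U) (perm κ ε) (λ t h → fixed t (not-false h))))
    where
    split : ∀ b → 1 ≡ bit b + bit (not b)
    split true = refl
    split false = refl

  orb-D : (κ ε : Match (State N)) → (∀ t → flag H t ≡ true → flag H (app κ (app ε t)) ≡ true) →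
    (∀ t → flagK t ≡ true → flagK (app κ (app ε t)) ≡ true) →
    (∀ t → flagD t ≡ false → app κ (app ε t) ≡ t) →
    orb₂ κ ε ≡ orbOn (flag H) (perm κ ε) + orbOn flagK (perm κ ε) + size (not ∘ flagD)
  orb-D κ ε keepH keepK fixed = trans
    (orbOn-split (λ _ → true) flagD (not ∘ flagD) (perm κ ε) (λ t → split (flagD t)) keepD
      (λ t h → trans (cong (not ∘ flagD) (fixed t (not-false h))) h))
    (cong₂ _+_ (orbOn-split flagD (flag H) flagK (perm κ ε) parts keepH keepK)
      (orbOn-fixed (not ∘ flagD) (perm κ ε) (λ t h → fixed t (not-false h))))
    where
    split : ∀ b → 1 ≡ bit b + bit (not b)
    split true = refl
    split false = refl
    keepD : ∀ t → flagD t ≡ true → flagD (app κ (app ε t)) ≡ true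
    keepD t d with ∨-true {flag H t} d
    ... | inj₁ h = H⇒D (app κ (app ε t)) (keepH t h)
    ... | inj₂ k = K⇒D (app κ (app ε t)) (keepK t k)
    parts : ∀ t → bit (flagD t) ≡ bit (flag H t) + bit (flagK t)
    parts t = go (flag H t) (flagK t) (H⇒¬K t)
      where
      go : ∀ a b → (a ≡ true → b ≡ false) → bit (a ∨ b) ≡ bit a + bit b
      go true b f = cong (λ z → suc (bit z)) (sym (f refl))
      go false b f = refl

-- Joining K's copy of xy to the edge xy of H, at x and at y
module JoinXY {N} {x y : Fin N} {H K U : Graph N} (am : Amalgam x y H K U) where
  open Amalgam am
  open AmalgamFlags am
  open Orbits (finState {N})
  open Matchings (finState {N})
  open Joining (finState {N})

  -- Corresponding flags at `x` of the edge `xy` of `H` and of its relocated copy in `K`.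
  h k : State N
  h = x , y , false
  k = x , x , false

  conjugate : Match (State N) → Match (State N)
  conjugate κ = record { app = β ∘ app κ ∘ β
    ; invol = λ t → trans (cong (β ∘ app κ) (β-β _)) (trans (cong β (invol κ _)) (β-β t))
    ; nofix = λ t e → nofix κ (β t) (trans (sym (β-β _)) (cong β e)) }

  -- `f` tells the edge of `h` from that of `k`. It is `flag H` when two embeddings are combined and
  -- `flag U` when one is split.
  module Join (κ ε : Match (State N)) (κ-vertex : ∀ t → vertexOf (app κ t) ≡ vertexOf t)
    (εh-vertex : vertexOf (app ε h) ≡ y) (εk-vertex : vertexOf (app ε k) ≡ y)
    (f : State N → Bool) (fκ : ∀ t → f (app κ t) ≡ f t) (fθ : ∀ t → f (flipSide t) ≡ f t)
    (fh : f h ≡ true) (fεh : f (app ε h) ≡ true) (fk : f k ≡ false) (fεk : f (app ε k) ≡ false) where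

    κ₁ κ₂ : Match (State N)
    κ₁ = join₁ κ ε h k
    κ₂ = join₂ κ ε h k

    h≢k : h ≢ k
    h≢k e = true≢false (trans (sym fh) (trans (cong f e) fk))

    κ₁-off : ∀ {t} → vertexOf t ≢ x → app κ₁ t ≡ app κ t
    κ₁-off {t} ne = switch-off κ (off (κ-vertex h)) (off refl) (off′ (κ-vertex h)) (off′ refl)
      where
      off : ∀ {z} → vertexOf z ≡ x → t ≢ z
      off e refl = ne e
      off′ : ∀ {z} → vertexOf z ≡ x → app κ t ≢ z
      off′ e refl = ne (trans (sym (κ-vertex t)) e)

    κ₁εh : app κ₁ (app ε h) ≡ app κ (app ε h)
    κ₁εh = κ₁-off (λ e → y≢x (trans (sym εh-vertex) e))

    ne : app κ₁ (app ε h) ≢ app ε k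
    ne e = true≢false (trans (sym (trans (cong f κ₁εh) (trans (fκ _) fεh))) (trans (cong f e) fεk))

    orb-κ₂ : orb₂ κ ε ≤ orb₂ κ₂ ε
    orb-κ₂ = orb-join κ ε h k h≢k ne

    label₁ : ∀ {L : Set} (ℓ : State N → L) → (∀ t → ℓ (app κ t) ≡ ℓ t) → ℓ h ≡ ℓ k →
             ∀ t → ℓ (app κ₁ t) ≡ ℓ t
    label₁ ℓ ℓκ e = switch-label ℓ κ (trans (ℓκ h) e) ℓκ

    label : ∀ {L : Set} (ℓ : State N → L) → (∀ t → ℓ (app κ t) ≡ ℓ t) → ℓ h ≡ ℓ k → ℓ (app ε h) ≡ ℓ (app ε k) →
            ∀ t → ℓ (app κ₂ t) ≡ ℓ t
    label ℓ ℓκ e e′ = switch-label ℓ κ₁ (trans (label₁ ℓ ℓκ e _) e′) (label₁ ℓ ℓκ e)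

    -- The first switch may connect cycles with different `f` at `x`. Forgetting `f` there alone
    -- leaves an invariant that still separates the cycles to be joined at `y`.
    mark : State N → Bool
    mark t = if ⌊ vertexOf t ≟ x ⌋ then true else f t

    mark-x : ∀ t → vertexOf t ≡ x → mark t ≡ true
    mark-x t e = cong (λ b → if b then true else f t) (⌊⌋-true {a? = vertexOf t ≟ x} e)

    mark-y : ∀ t → vertexOf t ≡ y → mark t ≡ f t
    mark-y t e = cong (λ b → if b then true else f t) (⌊⌋-false {a? = vertexOf t ≟ x} (λ e′ → y≢x (trans (sym e) e′)))

    mark-≡ : ∀ s t → vertexOf s ≡ vertexOf t → f s ≡ f t → mark s ≡ mark t
    mark-≡ s t e e′ = cong₂ (λ p q → if ⌊ p ≟ x ⌋ then true else q) e e′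

    κ₁-mark : ∀ t → mark (app κ₁ t) ≡ mark t
    κ₁-mark = label₁ mark (λ t → mark-≡ _ _ (κ-vertex t) (fκ t)) (trans (mark-x h refl) (sym (mark-x k refl)))

    ¬₁ : ¬ Comp κ θ (app κ h) k
    ¬₁ r = true≢false (trans (sym fh) (trans (sym (fκ h)) (trans (Comp-label f fκ fθ r) fk)))

    ¬₂ : ¬ Comp κ₁ θ (app κ₁ (app ε h)) (app ε k)
    ¬₂ r = true≢false (trans (sym (trans (κ₁-mark _) (trans (mark-y _ εh-vertex) fεh)))
      (trans (Comp-label mark κ₁-mark (λ t → mark-≡ _ _ refl (fθ t)) r) (trans (mark-y _ εk-vertex) fεk)))

    lift₁ : ∀ {s t} → Comp κ₁ θ s t → Comp κ₂ θ s t
    lift₁ = Comp-switch κ₁ θ _ _ ¬₂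

    lift : ∀ {s t} → Comp κ θ s t → Comp κ₂ θ s t
    lift r = lift₁ (Comp-switch κ θ _ _ ¬₁ r)

    hk : Comp κ₂ θ h k
    hk = Comp-trans (lift (byκ here)) (lift₁ (switch-joins κ θ _ _ ¬₁))

    εhk : Comp κ₂ θ (app ε h) (app ε k)
    εhk = Comp-trans (lift₁ (byκ here)) (switch-joins κ₁ θ _ _ ¬₂)

    inert : (D : State N → Bool) → (∀ t → D (app κ t) ≡ D t) → D h ≡ true → D k ≡ true →
            D (app ε h) ≡ true → D (app ε k) ≡ true → ∀ t → D t ≡ false → app κ₂ t ≡ app κ t
    inert D Dκ Dh Dk Dεh Dεk t Dt = trans (switch-outside D κ₁ D₁ (trans (D₁ _) Dεh) Dεk t Dt)
                                          (switch-outside D κ Dκ (trans (Dκ h) Dh) Dk t Dt)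
      where
      D₁ = label₁ D Dκ (trans Dh (sym Dk))

-- An embedding of the union from embeddings of the parts

module Combine {N} {x y : Fin N} {H K U : Graph N} (am : Amalgam x y H K U) (eH : Embedding H) (eK : Embedding K) where
  open Amalgam am
  open AmalgamFlags am
  open Orbits (finState {N})
  open Matchings (finState {N})
  open Joining (finState {N})
  open JoinXY am using (h; k; conjugate; module Join)
  module GH = Gem H symH irrH
  module GK = Gem K symK irrK

  glue : (κH κK : Match (State N)) → (∀ t → flag H (app κH t) ≡ flag H t) →
         (∀ t → flag H t ≡ false → flag H (app κK t) ≡ false) → Match (State N)
  glue κH κK cH cK = record { app = g ; invol = λ t → i t (flag H t) refl ; nofix = λ t → n t (flag H t) refl }
    where
    g : State N → State N
    g t = if flag H t then app κH t else app κK t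
    yes′ : ∀ t → flag H t ≡ true → g t ≡ app κH t
    yes′ t e = cong (λ b → if b then app κH t else app κK t) e
    no′ : ∀ t → flag H t ≡ false → g t ≡ app κK t
    no′ t e = cong (λ b → if b then app κH t else app κK t) e
    i : ∀ t b → flag H t ≡ b → g (g t) ≡ t
    i t true e = trans (cong g (yes′ t e)) (trans (yes′ _ (trans (cH t) e)) (invol κH t))
    i t false e = trans (cong g (no′ t e)) (trans (no′ _ (cK t e)) (invol κK t))
    n : ∀ t b → flag H t ≡ b → g t ≢ t
    n t true e p = nofix κH t (trans (sym (yes′ t e)) p)
    n t false e p = nofix κK t (trans (sym (no′ t e)) p)

  module Glued (κH κK : Match (State N)) (cH : ∀ t → flag H (app κH t) ≡ flag H t) (cK : ∀ t → flag K (app κK t) ≡ flag K t)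
    (inertH : ∀ t → flag H t ≡ false → app κH t ≡ flipSide t) (inertK : ∀ t → flag K t ≡ false → app κK t ≡ flipSide t) where

    conj-inert : ∀ t → flagK t ≡ false → app (conjugate κK) t ≡ flipSide t
    conj-inert t e = trans (cong β (inertK (β t) e)) (cong flipSide (β-β t))

    conj-K : ∀ t → flagK (app (conjugate κK) t) ≡ flagK t
    conj-K t = trans (cong (flag K) (β-β (app κK (β t)))) (cK (β t))

    conj-H : ∀ t → flag H t ≡ false → flag H (app (conjugate κK) t) ≡ false
    conj-H t e = go (flagK t) refl
      where
      go : ∀ b → flagK t ≡ b → flag H (app (conjugate κK) t) ≡ false
      go true f = K⇒¬H (app (conjugate κK) t) (trans (conj-K t) f)
      go false f = trans (cong (flag H) (conj-inert t f)) e

    κJ : Match (State N)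
    κJ = glue κH (conjugate κK) cH conj-H

    on-H : ∀ t → flag H t ≡ true → app κJ t ≡ app κH t
    on-H t e = cong (λ b → if b then app κH t else app (conjugate κK) t) e

    off-H : ∀ t → flag H t ≡ false → app κJ t ≡ app (conjugate κK) t
    off-H t e = cong (λ b → if b then app κH t else app (conjugate κK) t) e

    on-K : ∀ t → flagK t ≡ true → app κJ t ≡ app (conjugate κK) t
    on-K t e = off-H t (K⇒¬H t e)

    off-D : ∀ t → flagD t ≡ false → app κJ t ≡ flipSide t
    off-D t e = trans (off-H t (¬D⇒¬H t e)) (conj-inert t (¬D⇒¬K t e))

    keep-H : ∀ t → flag H (app κJ t) ≡ flag H t
    keep-H t = go (flag H t) refl
      where
      go : ∀ b → flag H t ≡ b → flag H (app κJ t) ≡ flag H t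
      go true e = trans (cong (flag H) (on-H t e)) (cH t)
      go false e = trans (cong (flag H) (off-H t e)) (trans (conj-H t e) (sym e))

    keep-K : ∀ t → flagK (app κJ t) ≡ flagK t
    keep-K t = go (flag H t) refl
      where
      go : ∀ b → flag H t ≡ b → flagK (app κJ t) ≡ flagK t
      go true e = trans (H⇒¬K (app κJ t) (trans (keep-H t) e)) (sym (H⇒¬K t e))
      go false e = trans (cong flagK (off-H t e)) (conj-K t)

    keep-D : ∀ t → flagD (app κJ t) ≡ flagD t
    keep-D t = cong₂ _∨_ (keep-H t) (keep-K t)

  private
    κH = GH.corners eH
    κK = GK.corners eK
    εH = GH.edges (sig eH) (sig-sym eH)
    εK = GK.edges (sig eK) (sig-sym eK)
    module C = Glued κH κK (GH.corners-flag eH) (GK.corners-flag eK) (onFlags-no H (turn (rot eH) (rotInv eH))) (onFlags-no K (turn (rot eK) (rotInv eK)))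
    module S = Glued εH εK (GH.edges-flag _ (sig-sym eH)) (GK.edges-flag _ (sig-sym eK)) (onFlags-no H (crossEdge (sig eH))) (onFlags-no K (crossEdge (sig eK)))
    κ = C.κJ
    ε = S.κJ

    κ-vertex : ∀ t → vertexOf (app κ t) ≡ vertexOf t
    κ-vertex t = go (flag H t) refl
      where
      go : ∀ b → flag H t ≡ b → vertexOf (app κ t) ≡ vertexOf t
      go true e = trans (cong vertexOf (C.on-H t e)) (GH.corners-vertex eH t)
      go false e = trans (cong vertexOf (C.off-H t e)) (GK.corners-vertex eK (β t))

    ε-H : ∀ t → flag H t ≡ true → app ε t ≡ crossEdge (sig eH) t
    ε-H t e = trans (S.on-H t e) (onFlags-yes H (crossEdge (sig eH)) t e)

    ε-K : ∀ t → flagK t ≡ true → app ε t ≡ β (crossEdge (sig eK) (β t))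
    ε-K t e = trans (S.on-K t e) (cong β (onFlags-yes K (crossEdge (sig eK)) (β t) e))

    ε-x : ∀ s → app ε (x , x , s) ≡ (y , y , not (s xor sig eK x y))
    ε-x s = trans (ε-K _ (special-K (at-x s))) (trans (cong (β ∘ crossEdge (sig eK)) (βxx s)) (βyx _))

    h′ k′ : State N
    h′ = app ε h
    k′ = app ε k

    h′-is : h′ ≡ (y , x , not (false xor sig eH x y))
    h′-is = ε-H h Hxy

    k′-is : k′ ≡ (y , y , not (false xor sig eK x y))
    k′-is = ε-x false

    vk′ : vertexOf k′ ≡ y
    vk′ = cong vertexOf k′-is

    special-k′ : Special k′
    special-k′ = subst Special (sym k′-is) (at-y _)

    D-ε : ∀ t → flagD (app ε t) ≡ flagD t
    D-ε = S.keep-D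

    Dh : flagD h ≡ true
    Dh = H⇒D h Hxy

    Dk : flagD k ≡ true
    Dk = special-D (at-x false)

    module J = Join κ ε κ-vertex (cong vertexOf h′-is) (cong vertexOf k′-is) (flag H) C.keep-H (λ _ → refl)
                 Hxy (trans (S.keep-H h) Hxy) (irrH x) (special-H special-k′)
    κ₂ = J.κ₂

    κ₂-vertex : ∀ t → vertexOf (app κ₂ t) ≡ vertexOf t
    κ₂-vertex = J.label vertexOf κ-vertex refl (trans (cong vertexOf h′-is) (sym (cong vertexOf k′-is)))

    κ₂-D : ∀ t → flagD (app κ₂ t) ≡ flagD t
    κ₂-D = J.label flagD C.keep-D (trans Dh (sym Dk)) (trans (D-ε h) (trans Dh (sym (trans (D-ε k) Dk))))

    κ₂-off : ∀ t → flagD t ≡ false → app κ₂ t ≡ flipSide t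
    κ₂-off t e = trans (J.inert flagD C.keep-D Dh Dk (trans (D-ε h) Dh) (trans (D-ε k) Dk) t e) (C.off-D t e)

    Comp-H : ∀ {u w z} s s′ → E H u w ≡ true → E H u z ≡ true → Comp κ θ (u , w , s) (u , z , s′)
    Comp-H s s′ hw hz = Comp-map {κH} {κ} id (λ t → flag H t ≡ true) (λ t e → trans (GH.corners-flag eH t) e) (λ _ e → e)
      (λ t e → sym (C.on-H t e)) (λ _ _ → refl) hw (GH.corners-connected eH s s′ hw hz)

    Comp-K : ∀ {s t} → flagK s ≡ true → flagK t ≡ true → vertexOf s ≡ vertexOf t → Comp κ θ s t
    Comp-K {s@(u , w , a)} {t@(_ , z , b)} p q refl = subst (λ r → Comp κ θ r t) (β-β s) (subst (Comp κ θ _) (β-β t)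
      (Comp-map {κK} {κ} β (λ t → flag K t ≡ true) (λ t e → trans (GK.corners-flag eK t) e) (λ _ e → e)
        (λ t e → sym (trans (C.on-K (β t) (trans (cong (flag K) (β-β t)) e)) (cong (β ∘ app κK) (β-β t))))
        (λ _ _ → refl) p (GK.corners-connected eK a b p q)))

    D-connected : ∀ s t → flagD s ≡ true → flagD t ≡ true → vertexOf s ≡ vertexOf t → Comp κ₂ θ s t
    D-connected s t p q e = go s t (∨-true {flag H s} p) (∨-true {flag H t} q) e
      where
      HK : ∀ s t → flag H s ≡ true → flagK t ≡ true → vertexOf s ≡ vertexOf t → Comp κ₂ θ s t
      HK (u , w , a) t p q refl = meet u w a t p q refl (shared u w _ p q)
        where
        meet : ∀ u w a t → E H u w ≡ true → flagK t ≡ true → u ≡ vertexOf t → u ≡ x ⊎ u ≡ y → Comp κ₂ θ (u , w , a) t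
        meet u w a t p q e (inj₁ refl) = Comp-trans (J.lift (Comp-H a false p Hxy)) (Comp-trans J.hk
              (J.lift (Comp-K (special-K (at-x false)) q e)))
        meet u w a t p q e (inj₂ refl) = Comp-trans (J.lift (subst (Comp κ θ (y , w , a)) (sym h′-is) (Comp-H a (not (false xor sig eH x y)) p Hyx)))
              (Comp-trans J.εhk (J.lift (Comp-K (special-K special-k′) q (trans vk′ e))))
      go : ∀ s t → flag H s ≡ true ⊎ flagK s ≡ true → flag H t ≡ true ⊎ flagK t ≡ true →
           vertexOf s ≡ vertexOf t → Comp κ₂ θ s t
      go (u , w , a) (_ , z , b) (inj₁ p) (inj₁ q) refl = J.lift (Comp-H a b p q)
      go s t (inj₁ p) (inj₂ q) e = HK s t p q e
      go s t (inj₂ p) (inj₁ q) e = Comp-sym (HK t s q p (sym e))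
      go s t (inj₂ p) (inj₂ q) e = J.lift (Comp-K p q e)

    x-not-y : ∀ {s t : State N} → vertexOf s ≡ x → vertexOf t ≡ y → s ≢ t
    x-not-y p q refl = x≢y (trans (sym p) q)

    vh′ : vertexOf h′ ≡ y
    vh′ = cong vertexOf h′-is

    h′≢k′ : h′ ≢ k′
    h′≢k′ e = true≢false (trans (sym (trans (S.keep-H h) Hxy)) (trans (cong (flag H) e) (special-H special-k′)))

    κ₂k : app κ₂ k ≡ h
    κ₂k = trans (switch-off J.κ₁ (x-not-y refl (trans v₁ vh′)) (x-not-y refl vk′)
        (λ e → x-not-y refl (trans v₁ vh′) (trans (sym κ₁k) e)) (λ e → x-not-y refl vk′ (trans (sym κ₁k) e))) κ₁k
      where
      κ₁k : app J.κ₁ k ≡ h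
      κ₁k = sym (adj J.κ₁ (join₁-at κ ε h k J.h≢k))
      v₁ : vertexOf (app J.κ₁ h′) ≡ vertexOf h′
      v₁ = J.label₁ vertexOf κ-vertex refl h′

    κ₂k′ : app κ₂ k′ ≡ h′
    κ₂k′ = sym (adj κ₂ (switch-moved J.κ₁ (nofix J.κ₁ h′ ∘ sym) h′≢k′ refl))

    -- These delete the copy of `xy`: its four flags end up in pairs `{t , flipSide t}`, as the
    -- non-flags of `U` have to.
    κ₃ κ₄ ε₄ : Match (State N)
    κ₃ = switch (flipSide k′) (app κ₂ k′) κ₂
    κ₄ = switch (flipSide k) (app κ₃ k) κ₃
    ε₄ = switch (app κ₃ k′) (app ε k′) ε

    κ₃k′ : app κ₃ k′ ≡ flipSide k′
    κ₃k′ = adjoin-at κ₂ θ k′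

    κ₃-vertex : ∀ t → vertexOf (app κ₃ t) ≡ vertexOf t
    κ₃-vertex = switch-label vertexOf κ₂ (sym (κ₂-vertex k′)) κ₂-vertex

    κ₃-D : ∀ t → flagD (app κ₃ t) ≡ flagD t
    κ₃-D = switch-label flagD κ₂ (sym (κ₂-D k′)) κ₂-D

    κ₃k : app κ₃ k ≡ h
    κ₃k = trans (switch-off κ₂ (x-not-y refl vk′) (x-not-y refl (trans (κ₂-vertex k′) vk′))
      (λ e → x-not-y refl vk′ (trans (sym κ₂k) e)) (λ e → x-not-y refl (trans (κ₂-vertex k′) vk′) (trans (sym κ₂k) e))) κ₂k

    κ₄k : app κ₄ k ≡ flipSide k
    κ₄k = adjoin-at κ₃ θ k

    κ₄k′ : app κ₄ k′ ≡ flipSide k′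
    κ₄k′ = trans (switch-off κ₃ (y-not-x vk′ refl) (y-not-x vk′ (cong vertexOf κ₃k))
      (y-not-x (trans (κ₃-vertex k′) vk′) refl) (y-not-x (trans (κ₃-vertex k′) vk′) (cong vertexOf κ₃k))) κ₃k′
      where
      y-not-x : ∀ {s t : State N} → vertexOf s ≡ y → vertexOf t ≡ x → s ≢ t
      y-not-x p q e = x-not-y q p (sym e)

    κ₄-vertex : ∀ t → vertexOf (app κ₄ t) ≡ vertexOf t
    κ₄-vertex = switch-label vertexOf κ₃ (sym (κ₃-vertex k)) κ₃-vertex

    ε₄k′ : app ε₄ k′ ≡ flipSide k′
    ε₄k′ = trans (adjoin-at ε κ₃ k′) κ₃k′

    εθk′ : app ε (flipSide k′) ≡ flipSide k
    εθk′ = sym (adj ε (trans (ε-x true) (cong flipSide (sym k′-is))))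

    ε₄k : app ε₄ k ≡ flipSide k
    ε₄k = sym (adj ε₄ (trans (switch-moved ε (x-not-y refl (trans (κ₃-vertex k′) vk′))
      (λ e → nofix θ k (trans e (invol ε k))) (trans (sym (adj ε εθk′)) (sym κ₃k′))) (invol ε k)))

    Dk′ : flagD k′ ≡ true
    Dk′ = special-D special-k′

    special-cases : ∀ {t} → Special t → (t ≡ k ⊎ t ≡ flipSide k) ⊎ (t ≡ k′ ⊎ t ≡ flipSide k′)
    special-cases (at-x false) = inj₁ (inj₁ refl)
    special-cases (at-x true) = inj₁ (inj₂ refl)
    special-cases (at-y s) = inj₂ (subst (λ z → (y , y , s) ≡ z ⊎ (y , y , s) ≡ flipSide z) (sym k′-is) (go s _))
      where
      go : ∀ s b → (y , y , s) ≡ (y , y , b) ⊎ (y , y , s) ≡ (y , y , not b)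
      go true true = inj₁ refl
      go true false = inj₂ refl
      go false true = inj₂ refl
      go false false = inj₁ refl

    flips : (η : Match (State N)) → app η k ≡ flipSide k → app η k′ ≡ flipSide k′ →
            (∀ t → flagD t ≡ false → app η t ≡ flipSide t) → ∀ t → flag U t ≡ false → app η t ≡ flipSide t
    flips η ηk ηk′ η-off t u = go (flagD t) refl
      where
      back : ∀ {z} → app η z ≡ flipSide z → app η (flipSide z) ≡ flipSide (flipSide z)
      back {z} e = trans (sym (adj η e)) (sym (invol θ z))
      cases : (t ≡ k ⊎ t ≡ flipSide k) ⊎ (t ≡ k′ ⊎ t ≡ flipSide k′) → app η t ≡ flipSide t
      cases (inj₁ (inj₁ refl)) = ηk
      cases (inj₁ (inj₂ refl)) = back ηk
      cases (inj₂ (inj₁ refl)) = ηk′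
      cases (inj₂ (inj₂ refl)) = back ηk′
      go : ∀ b → flagD t ≡ b → app η t ≡ flipSide t
      go false e = η-off t e
      go true e with D⇒U t e
      ... | inj₁ u′ = contradiction (trans (sym u′) u) true≢false
      ... | inj₂ sp = cases (special-cases sp)

    κ₄-off : ∀ t → flag U t ≡ false → app κ₄ t ≡ flipSide t
    κ₄-off = flips κ₄ κ₄k κ₄k′ λ t e → trans (switch-outside flagD κ₃ κ₃-D Dk (trans (κ₃-D k) Dk) t e)
      (trans (switch-outside flagD κ₂ κ₂-D Dk′ (trans (κ₂-D k′) Dk′) t e) (κ₂-off t e))

    ε₄-off : ∀ t → flag U t ≡ false → app ε₄ t ≡ flipSide t
    ε₄-off = flips ε₄ ε₄k ε₄k′ λ t e → trans (switch-outside flagD ε D-ε (trans (κ₃-D k′) Dk′) (trans (D-ε k′) Dk′) t e) (S.off-D t e)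

    keeps-U : (η : Match (State N)) → (∀ t → flag U t ≡ false → app η t ≡ flipSide t) →
              ∀ t → flag U t ≡ true → flag U (app η t) ≡ true
    keeps-U η off t u = go (flag U (app η t)) refl
      where
      go : ∀ b → flag U (app η t) ≡ b → flag U (app η t) ≡ true
      go true e = e
      go false e = contradiction (trans (sym u) (trans (cong (flag U) (trans (sym (invol η t)) (off _ e))) e)) true≢false

    not-special : ∀ {t} → flag U t ≡ true → ¬ Special t
    not-special u sp = true≢false (trans (sym u) (special-U sp))

    U-connected : ∀ s t → flag U s ≡ true → flag U t ≡ true → vertexOf s ≡ vertexOf t → Comp κ₄ θ s t
    U-connected s t p q e = Excise.Comp-excise κ₃ θ k (λ f → k≢h (trans (sym f) κ₃k)) (off p (at-x false)) (off p (at-x true)) (off q (at-x false)) (off q (at-x true))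
      (Excise.Comp-excise κ₂ θ k′ (λ f → θk′≢h′ (trans (sym f) κ₂k′)) (off p special-k′) (off p (special-θ special-k′))
        (off q special-k′) (off q (special-θ special-k′)) (D-connected s t (U⇒D s p) (U⇒D t q) e))
      where
      off : ∀ {t z} → flag U t ≡ true → Special z → t ≢ z
      off u sp refl = not-special u sp
      k≢h : flipSide k ≢ h
      k≢h f = true≢false (trans (sym Hxy) (trans (cong (flag H) (sym f)) (irrH x)))
      θk′≢h′ : flipSide k′ ≢ h′
      θk′≢h′ f = true≢false (trans (sym (trans (S.keep-H h) Hxy)) (trans (cong (flag H) (sym f)) (special-H (special-θ special-k′))))

    sg : Fin N → Fin N → Bool
    sg u w = if E H u w then sig eH u w else sig eK u w

    sg-sym : ∀ u w → sg u w ≡ sg w u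
    sg-sym u w = trans (cong (λ b → if b then sig eH u w else sig eK u w) (symH u w))
      (cong₂ (λ p q → if E H w u then p else q) (sig-sym eH u w) (sig-sym eK u w))

    ε-U : ∀ t → flag U t ≡ true → app ε t ≡ crossEdge sg t
    ε-U t@(u , w , s) p = go (E H u w) refl
      where
      go : ∀ b → E H u w ≡ b → app ε t ≡ crossEdge sg t
      go true e = trans (ε-H t e) (cong (λ b → w , u , not (s xor (if b then sig eH u w else sig eK u w))) (sym e))
      go false e with kflag t (D∧¬H⇒K t (U⇒D t p) e)
      ... | special sp = contradiction sp (not-special p)
      ... | plain fix hK _ = trans (ε-K t (trans (cong (flag K) fix) hK)) (trans (cong (β ∘ crossEdge (sig eK)) fix)
              (trans (fixed (edgeK (trans (symK w u) hK))) (cong (λ b → w , u , not (s xor (if b then sig eH u w else sig eK u w))) (sym e))))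
        where
        fixed : Edge w u → β (crossEdge (sig eK) t) ≡ crossEdge (sig eK) t
        fixed (is-xy refl refl) = contradiction (trans (sym Hyx) e) true≢false
        fixed (is-yx refl refl) = contradiction (trans (sym Hxy) e) true≢false
        fixed (plain f _) = f _

    ε₄-U : ∀ t → flag U t ≡ true → app ε₄ t ≡ crossEdge sg t
    ε₄-U t p = trans (switch-off ε
      (λ e → not-special p (subst Special (sym (trans e κ₃k′)) (special-θ special-k′)))
      (λ e → not-special p (subst Special (sym (trans e (invol ε k))) (at-x false)))
      (λ e → not-special p (subst Special (sym (trans (adj ε (trans e κ₃k′)) εθk′)) (at-x true)))
      (λ e → not-special p (subst Special (sym (app-inj ε e)) special-k′))) (ε-U t p)

    module R = Realize U symU irrU κ₄ ε₄ sg sg-sym κ₄-vertex (keeps-U κ₄ κ₄-off) ε₄-U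
                 (λ u w z p q → U-connected (u , w , false) (u , z , false) p q refl)

  combined : Embedding U
  combined = R.realized

  private
    orb-H : orbOn (flag H) (perm κ ε) ≡ numOrbits eH
    orb-H = trans (orbOn-conj (flag H) (flag H) (perm κ ε) (perm κH εH) id (λ _ → refl) (λ _ e → e) (λ _ e → e)
      (λ t e → trans (GH.corners-flag eH _) (trans (GH.edges-flag _ (sig-sym eH) t) e))
      (λ t e → sym (trans (C.on-H _ (trans (S.keep-H t) e)) (cong (app κH) (S.on-H t e)))))
      (sym (GH.numOrbits-orbOn eH))

    orb-K : orbOn flagK (perm κ ε) ≡ numOrbits eK
    orb-K = trans (orbOn-conj flagK (flag K) (perm κ ε) (perm κK εK) β β-β (λ _ e → e) (λ t e → trans (cong (flag K) (β-β t)) e)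
      (λ t e → trans (GK.corners-flag eK _) (trans (GK.edges-flag _ (sig-sym eK) t) e))
      (λ t e → let k = trans (cong (flag K) (β-β t)) e in
        sym (trans (C.on-K _ (trans (S.keep-K (β t)) k)) (cong (β ∘ app κK)
          (trans (cong β (S.on-K (β t) k)) (trans (β-β _) (cong (app εK) (β-β t))))))))
      (sym (GK.numOrbits-orbOn eK))

    orb-joint : orb₂ κ ε ≡ numOrbits eH + numOrbits eK + size (not ∘ flagD)
    orb-joint = trans (orb-D κ ε (λ t e → trans (C.keep-H _) (trans (S.keep-H t) e))
        (λ t e → trans (C.keep-K _) (trans (S.keep-K t) e))
        (λ t e → trans (C.off-D _ (trans (S.keep-D t) e)) (trans (cong flipSide (S.off-D t e)) (invol θ t))))
      (cong (_+ size (not ∘ flagD)) (cong₂ _+_ orb-H orb-K))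

    orb-union : orb₂ κ₄ ε₄ ≡ numOrbits combined + (4 + size (not ∘ flagD))
    orb-union = trans (orb-U κ₄ ε₄ (λ t e → keeps-U κ₄ κ₄-off _ (keeps-U ε₄ ε₄-off t e))
        (λ t e → trans (cong (app κ₄) (ε₄-off t e)) (trans (κ₄-off _ e) (invol θ t))))
      (cong₂ _+_ (sym R.numOrbits-realized) size-U)

    -- Taking `k′` out of its vertex cycle costs at most two orbits, and `ε₄` returns two by making
    -- `k′` and `flipSide k′` a cycle. The switch that does the same to `k` is a pure gain of two,
    -- since `ε₄` already pairs `k` with `flipSide k`.
    excised : 2 + orb₂ κ ε ≤ orb₂ κ₄ ε₄
    excised = ℕₚ.≤-trans (ℕₚ.+-monoʳ-≤ 2 (ℕₚ.≤-trans J.orb-κ₂ (ℕₚ.≤-trans (switch-≥ κ₂ ε _ _) (ℕₚ.≤-reflexive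
        (sym (trans (orb-adjoin κ₃ ε k′) (cong (_+ orb₂ κ₃ ε) (gap-≢ κ₃k′≢εk′))))))))
      (subst (λ z → 2 + orb₂ κ₃ ε₄ ≤ orb₂ (switch z (app κ₃ k) κ₃) ε₄) ε₄k
        (switch-close κ₃ ε₄ _ _ (λ e → h≢θk (trans (sym κ₃k) (trans (sym e) ε₄k))) (≈κε κ₃ ε₄ k)))
      where
      κ₃k′≢εk′ : app κ₃ k′ ≢ app ε k′
      κ₃k′≢εk′ e = x-not-y refl (trans (κ₃-vertex k′) vk′) (trans (sym (invol ε k)) (sym e))
      h≢θk : h ≢ flipSide k
      h≢θk f = true≢false (trans (sym Hxy) (trans (cong (flag H) f) (irrH x)))

  combined-orbits : numOrbits eH + numOrbits eK ≤ 2 + numOrbits combined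
  combined-orbits = ℕₚ.+-cancelˡ-≤ 2 _ _ (ℕₚ.+-cancelʳ-≤ (size (not ∘ flagD)) _ _
    (ℕₚ.≤-trans (ℕₚ.≤-reflexive (cong (2 +_) (sym orb-joint))) (ℕₚ.≤-trans excised
      (ℕₚ.≤-reflexive (trans orb-union (trans (sym (ℕₚ.+-assoc (numOrbits combined) 4 _))
        (cong (_+ size (not ∘ flagD)) (ℕₚ.+-comm (numOrbits combined) 4))))))))

-- Embeddings of the parts from an embedding of the union

module Split {N} {x y : Fin N} {H K U : Graph N} (am : Amalgam x y H K U) (eU : Embedding U) where
  open Amalgam am
  open AmalgamFlags am
  open Finite (finState {N})
  open Orbits (finState {N})
  open Matchings (finState {N})
  open Joining (finState {N})
  open JoinXY am using (h; k; conjugate; module Join)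
  module GU = Gem U symU irrU

  private
    sg = sig eU
    κ = GU.corners eU
    εU = GU.edges sg (sig-sym eU)

    κ-vertex = GU.corners-vertex eU

    κ-off : ∀ t → flag U t ≡ false → app κ t ≡ flipSide t
    κ-off = onFlags-no U (turn (rot eU) (rotInv eU))

    εU-on : ∀ t → flag U t ≡ true → app εU t ≡ crossEdge sg t
    εU-on = onFlags-yes U (crossEdge sg)

    εU-off : ∀ t → flag U t ≡ false → app εU t ≡ flipSide t
    εU-off = onFlags-no U (crossEdge sg)

    -- The flag to be paired with `k` if the copy of `xy` is to have the signature of `xy`.
    k′ : State N
    k′ = y , y , not (false xor sg x y)

    -- Under `εU` the special flags form the inert pairs of `k` and of `k′`. One switch turns these
    -- pairs into the two sides of an edge.
    ε : Match (State N)
    ε = switch (flipSide k) k′ εU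

    x-not-y : ∀ {s t : State N} → vertexOf s ≡ x → vertexOf t ≡ y → s ≢ t
    x-not-y p q refl = x≢y (trans (sym p) q)

    εk : app ε k ≡ k′
    εk = switch-moved εU (nofix θ k ∘ sym) (x-not-y refl refl) (εU-off k (irrU x))

    εθk : app ε (flipSide k) ≡ flipSide k′
    εθk = sym (adj ε (switch-movedʳ εU (x-not-y refl refl ∘ sym) (nofix θ k′) (trans (εU-off (flipSide k′) (irrU y)) (invol θ k′))))

    ε-x : ∀ s → app ε (x , x , s) ≡ (y , y , not (s xor sg x y))
    ε-x false = εk
    ε-x true = εθk

    ε-y : ∀ s → app ε (y , y , s) ≡ (x , x , not (s xor sg x y))
    ε-y s = sym (adj ε (trans (ε-x _) (cong (λ b → y , y , b) (not-xor-twice s (sg x y)))))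

    ε-plain : ∀ t → flag U t ≡ true → app ε t ≡ crossEdge sg t
    ε-plain t p = trans (switch-outside (not ∘ flag U) εU (λ t → cong not (GU.edges-flag sg (sig-sym eU) t))
      (cong not (irrU x)) (cong not (irrU y)) t (cong not p)) (εU-on t p)

    U-D : ∀ η → (∀ t → flag U t ≡ false → app η t ≡ flipSide t) → (∀ t → flag U (app η t) ≡ flag U t) →
          ∀ t → flagD (app η t) ≡ flagD t
    U-D η off keep t = go (flag U t) refl
      where
      go : ∀ b → flag U t ≡ b → flagD (app η t) ≡ flagD t
      go true e = trans (U⇒D (app η t) (trans (keep t) e)) (sym (U⇒D t e))
      go false e = cong flagD (off t e)

    D-κ : ∀ t → flagD (app κ t) ≡ flagD t
    D-κ = U-D κ κ-off (GU.corners-flag eU)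

    D-εU : ∀ t → flagD (app εU t) ≡ flagD t
    D-εU = U-D εU εU-off (GU.edges-flag sg (sig-sym eU))

    Dk : flagD k ≡ true
    Dk = special-D (at-x false)

    Dk′ : flagD k′ ≡ true
    Dk′ = special-D (at-y (not (false xor sg x y)))

    D-ε : ∀ t → flagD (app ε t) ≡ flagD t
    D-ε = switch-label flagD εU (trans Dk (sym Dk′)) D-εU

    ε-off : ∀ t → flagD t ≡ false → app ε t ≡ flipSide t
    ε-off t e = trans (switch-outside flagD εU D-εU Dk Dk′ t e) (εU-off t (¬D⇒¬U t e))

    τ-ε : ∀ t → flag H (app ε t) ≡ flag H t
    τ-ε = switch-label (flag H) εU (trans (irrH x) (sym (irrH y))) (λ t → go t (flag U t) refl)
      where
      go : ∀ t b → flag U t ≡ b → flag H (app εU t) ≡ flag H t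
      go t@(u , w , s) true e = trans (cong (flag H) (εU-on t e)) (symH w u)
      go t false e = cong (flag H) (εU-off t e)

    h′ : State N
    h′ = app ε h

    h′-is : h′ ≡ (y , x , not (false xor sg x y))
    h′-is = ε-plain h (H⇒U h Hxy)

    Uh : flag U h ≡ true
    Uh = H⇒U h Hxy

    Uh′ : flag U h′ ≡ true
    Uh′ = trans (cong (flag U) h′-is) (trans (symU y x) Uh)

    module J = Join κ ε κ-vertex (cong vertexOf h′-is) (cong vertexOf εk) (flag U) (GU.corners-flag eU) (λ _ → refl)
                 Uh Uh′ (irrU x) (trans (cong (flag U) εk) (irrU y))
    κ₂ = J.κ₂

    Dh′≡ : flagD h′ ≡ flagD (app ε k)
    Dh′≡ = trans (U⇒D h′ Uh′) (sym (trans (D-ε k) Dk))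

    κ₂-vertex : ∀ t → vertexOf (app κ₂ t) ≡ vertexOf t
    κ₂-vertex = J.label vertexOf κ-vertex refl (trans (cong vertexOf h′-is) (sym (cong vertexOf εk)))

    κ₂-D : ∀ t → flagD (app κ₂ t) ≡ flagD t
    κ₂-D = J.label flagD D-κ (trans (U⇒D h Uh) (sym Dk)) Dh′≡

    κ₂-off : ∀ t → flagD t ≡ false → app κ₂ t ≡ flipSide t
    κ₂-off t e = trans (J.inert flagD D-κ (U⇒D h Uh) Dk (U⇒D h′ Uh′) (trans (D-ε k) Dk) t e) (κ-off t (¬D⇒¬U t e))

    D-connected : ∀ s t → flagD s ≡ true → flagD t ≡ true → vertexOf s ≡ vertexOf t → Comp κ₂ θ s t
    D-connected s t p q e = go s t (D⇒U s p) (D⇒U t q) e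
      where
      UU : ∀ s t → flag U s ≡ true → flag U t ≡ true → vertexOf s ≡ vertexOf t → Comp κ₂ θ s t
      UU (u , w , a) (_ , z , b) p q refl = J.lift (GU.corners-connected eU a b p q)
      sides : ∀ u w a b → Comp κ₂ θ (u , w , a) (u , w , b)
      sides u w true true = here
      sides u w true false = byε here
      sides u w false true = byε here
      sides u w false false = here
      US : ∀ s {t} → flag U s ≡ true → Special t → vertexOf s ≡ vertexOf t → Comp κ₂ θ s t
      US s p (at-x b) e = Comp-trans (UU s h p Uh e) (Comp-trans J.hk (sides x x false b))
      US s p (at-y b) e = Comp-trans (UU s h′ p Uh′ (trans e (sym (cong vertexOf h′-is)))) (Comp-trans J.εhk
        (subst (λ z → Comp κ₂ θ z (y , y , b)) (sym εk) (sides y y _ b)))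
      SS : ∀ {s t} → Special s → Special t → vertexOf s ≡ vertexOf t → Comp κ₂ θ s t
      SS (at-x a) (at-x b) e = sides x x a b
      SS (at-x a) (at-y b) e = contradiction e x≢y
      SS (at-y a) (at-x b) e = contradiction e y≢x
      SS (at-y a) (at-y b) e = sides y y a b
      go : ∀ s t → flag U s ≡ true ⊎ Special s → flag U t ≡ true ⊎ Special t → vertexOf s ≡ vertexOf t → Comp κ₂ θ s t
      go s t (inj₁ p) (inj₁ q) e = UU s t p q e
      go s t (inj₁ p) (inj₂ q) e = US s p q e
      go s t (inj₂ p) (inj₁ q) e = Comp-sym (US t q p (sym e))
      go s t (inj₂ p) (inj₂ q) e = SS p q e

    -- Turning the inert pairs into an edge costs at most two orbits, and laying that edge beside
    -- `xy` costs none.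
    inserted : orb₂ κ εU ≤ 2 + orb₂ κ₂ ε
    inserted = ℕₚ.≤-trans (switch-≥ κ εU (flipSide k) k′)
      (ℕₚ.+-monoʳ-≤ 2 (ℕₚ.≤-trans (ℕₚ.≤-reflexive (sym (switch-right κ εU (flipSide k) k′))) J.orb-κ₂))

    open Purifying (finState {N}) vertexOf (flag H) x y using (Mixed; Pure; purify; badness; isDead)

    mixed : Mixed κ₂ ε θ
    mixed = record { vκ = κ₂-vertex ; τε = τ-ε ; vθ = λ _ → refl ; τθ = λ _ → refl
                   ; mix = λ t ne → go t (flag H t) (flag H (app κ₂ t)) refl refl ne }
      where
      at : ∀ s t → vertexOf s ≡ vertexOf t → flag H s ≡ true → flagD t ≡ true → flag H t ≡ false → vertexOf s ≡ x ⊎ vertexOf s ≡ y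
      at (u , w , _) t refl p q r = shared u w _ p (D∧¬H⇒K t q r)
      move : ∀ {u u′ : Fin N} → u ≡ u′ → u ≡ x ⊎ u ≡ y → u′ ≡ x ⊎ u′ ≡ y
      move refl z = z
      go : ∀ t a b → flag H t ≡ a → flag H (app κ₂ t) ≡ b → flag H (app κ₂ t) ≢ flag H t → vertexOf t ≡ x ⊎ vertexOf t ≡ y
      go t true true p q ne = contradiction (trans q (sym p)) ne
      go t false false p q ne = contradiction (trans q (sym p)) ne
      go t true false p q ne = at t (app κ₂ t) (sym (κ₂-vertex t)) p (trans (κ₂-D t) (H⇒D t p)) q
      go t false true p q ne = move (κ₂-vertex t) (at (app κ₂ t) t (κ₂-vertex t) q (trans (sym (κ₂-D t)) (H⇒D (app κ₂ t) q)) p)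

    opaque
      pure : Pure κ₂ ε θ
      pure = purify (badness κ₂ ε θ) κ₂ ε θ mixed ℕₚ.≤-refl

    module P = Pure pure

    pure-off : ∀ t → flagD t ≡ false → app P.κ⁺ t ≡ flipSide t
    pure-off t e = trans (P.dead t (isDead (trans (ε-off t e) (sym (κ₂-off t e))) (sym (κ₂-off t e)))) (κ₂-off t e)

    off⇒D : ∀ η → (∀ t → flagD t ≡ false → app η t ≡ flipSide t) → ∀ t → flagD (app η t) ≡ flagD t
    off⇒D η off t = go (flagD t) (flagD (app η t)) refl refl
      where
      go : ∀ a b → flagD t ≡ a → flagD (app η t) ≡ b → flagD (app η t) ≡ flagD t
      go true true p q = trans q (sym p)
      go false _ p q = cong flagD (off t p)
      go true false p q = contradiction
        (trans (sym p) (trans (cong flagD (trans (sym (invol η t)) (off _ q))) q)) true≢false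

    Label : Set
    Label = Bool × Bool × Fin N × Fin N

    _≟ᴸ_ : (a b : Label) → Dec (a ≡ b)
    _≟ᴸ_ = Productₚ.≡-dec _≟ᵇ_ (Productₚ.≡-dec _≟ᵇ_ (Productₚ.≡-dec _≟_ _≟_))

    -- Recording w for inert flags keeps each of their pairs in a class of its own.
    ℓ : State N → Label
    ℓ t@(u , w , _) = flagD t , flag H t , u , (if flagD t then x else w)

    ℓ-≡ : ∀ s t → flagD s ≡ true → flagD t ≡ true → flag H s ≡ flag H t → vertexOf s ≡ vertexOf t → ℓ s ≡ ℓ t
    ℓ-≡ s t p q e f = cong₂ _,_ (trans p (sym q)) (cong₂ _,_ e (cong₂ _,_ f
      (trans (cong (λ b → if b then x else proj₁ (proj₂ s)) p) (sym (cong (λ b → if b then x else proj₁ (proj₂ t)) q)))))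

    ℓ-pure : ∀ t → ℓ (app P.κ⁺ t) ≡ ℓ t
    ℓ-pure t = go (flagD t) refl
      where
      go : ∀ b → flagD t ≡ b → ℓ (app P.κ⁺ t) ≡ ℓ t
      go true e = ℓ-≡ (app P.κ⁺ t) t (trans (off⇒D P.κ⁺ pure-off t) e) e (P.τκ⁺ t) (P.vκ⁺ t)
      go false e = cong ℓ (pure-off t e)

    open Connecting (finState {N}) _≟ᴸ_ ℓ using (Connected-by; connect)

    opaque
      joined : Connected-by ε θ P.κ⁺
      joined = connect ε θ (λ _ → refl) (orb₂ P.κ⁺ θ) P.κ⁺ ℓ-pure ℕₚ.≤-refl

    module C = Connected-by joined
    κ″ = C.κ⁺

    D″ : ∀ t → flagD (app κ″ t) ≡ flagD t
    D″ t = cong proj₁ (C.label t)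

    H″ : ∀ t → flag H (app κ″ t) ≡ flag H t
    H″ t = cong (proj₁ ∘ proj₂) (C.label t)

    vertex″ : ∀ t → vertexOf (app κ″ t) ≡ vertexOf t
    vertex″ t = cong (proj₁ ∘ proj₂ ∘ proj₂) (C.label t)

    K-of : ∀ η → (∀ t → flagD (app η t) ≡ flagD t) → (∀ t → flag H (app η t) ≡ flag H t) →
           ∀ t → flagK t ≡ true → flagK (app η t) ≡ true
    K-of η D-η H-η t e = D∧¬H⇒K (app η t) (trans (D-η t) (K⇒D t e)) (trans (H-η t) (K⇒¬H t e))

    -- The label confines the partner of an inert flag to the two sides of its dart, and a matching
    -- has no choice there.
    off″ : ∀ t → flagD t ≡ false → app κ″ t ≡ flipSide t
    off″ t@(u , w , s) e = same (app κ″ t) (vertex″ t) (last (app κ″ t) (D″ t) (cong (proj₂ ∘ proj₂ ∘ proj₂) (C.label t))) (nofix κ″ t)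
      where
      last : ∀ t′ → flagD t′ ≡ flagD t → (if flagD t′ then x else proj₁ (proj₂ t′)) ≡ (if flagD t then x else w) → proj₁ (proj₂ t′) ≡ w
      last t′ p q = trans (cong (λ b → if b then x else proj₁ (proj₂ t′)) (sym (trans p e))) (trans q (cong (λ b → if b then x else w) e))
      flip-≢ : ∀ a b → a ≢ b → a ≡ not b
      flip-≢ true true ne = contradiction refl ne
      flip-≢ true false ne = refl
      flip-≢ false true ne = refl
      flip-≢ false false ne = contradiction refl ne
      same : ∀ t′ → vertexOf t′ ≡ u → proj₁ (proj₂ t′) ≡ w → t′ ≢ t → t′ ≡ (u , w , not s)
      same (_ , _ , s′) refl refl ne = cong (λ b → u , w , b) (flip-≢ s′ s (λ z → ne (cong (λ b → u , w , b) z)))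

    -- Joining the two parts at x and at y turns κ″ into a matching no more connected than κ₂.
    separated : 4 + orb₂ κ₂ θ ≤ orb₂ κ″ θ
    separated = ℕₚ.≤-trans (ℕₚ.+-monoʳ-≤ 4 (orb-comp-≤ κ₂ κb θ finer))
      (ℕₚ.≤-trans (ℕₚ.+-monoʳ-≤ 2 (switch-merge κa θ h″ k″ (far κa mark κa-mark (λ _ → refl) mark≢) (farκ κa mark κa-mark (λ _ → refl) mark≢)))
        (switch-merge κ″ θ h k (far κ″ (flag H) H″ (λ _ → refl) H≢) (farκ κ″ (flag H) H″ (λ _ → refl) H≢)))
      where
      h″ k″ : State N
      h″ = y , x , false
      k″ = y , y , false
      κa = switch h k κ″
      κb = switch h″ k″ κa
      far : ∀ η {a b} (f : State N → Bool) → (∀ t → f (app η t) ≡ f t) → (∀ t → f (flipSide t) ≡ f t) →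
            f a ≢ f b → ¬ (η ∙ θ ⊢ a ≈ b)
      far η f p q ne r = ne (~invariant f (λ t → trans (p _) (q t)) r)
      farκ : ∀ η {a b} (f : State N → Bool) → (∀ t → f (app η t) ≡ f t) → (∀ t → f (flipSide t) ≡ f t) →
            f a ≢ f b → ¬ (η ∙ θ ⊢ a ≈ app η b)
      farκ η f p q ne r = ne (trans (~invariant f (λ t → trans (p _) (q t)) r) (p _))
      H≢ : flag H h ≢ flag H k
      H≢ e = true≢false (trans (sym Hxy) (trans e (irrH x)))
      mark : State N → Bool
      mark t = if ⌊ vertexOf t ≟ x ⌋ then true else flag H t
      mark-x : ∀ t → vertexOf t ≡ x → mark t ≡ true
      mark-x t e = cong (λ b → if b then true else flag H t) (⌊⌋-true {a? = vertexOf t ≟ x} e)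
      mark-y : ∀ t → vertexOf t ≡ y → mark t ≡ flag H t
      mark-y t e = cong (λ b → if b then true else flag H t) (⌊⌋-false {a? = vertexOf t ≟ x} (λ e′ → y≢x (trans (sym e) e′)))
      κa-mark : ∀ t → mark (app κa t) ≡ mark t
      κa-mark = switch-label mark κ″ (trans (mark-x h refl) (sym (mark-x k refl)))
        (λ t → cong₂ (λ p q → if ⌊ p ≟ x ⌋ then true else q) (vertex″ t) (H″ t))
      mark≢ : mark h″ ≢ mark k″
      mark≢ e = true≢false (trans (sym (trans (mark-y h″ refl) Hyx)) (trans e (trans (mark-y k″ refl) (irrH y))))
      -- Forgets the part, so that the mergers at `x` and at `y` respect it. Each class lies on a
      -- single cycle of `κ₂ ∪ θ`.
      class : State N → Label
      class t@(u , w , _) = flagD t , true , u , (if flagD t then x else w)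
      class-≡ : ∀ s t → flagD s ≡ true → flagD t ≡ true → vertexOf s ≡ vertexOf t → class s ≡ class t
      class-≡ s t p q f = cong₂ _,_ (trans p (sym q)) (cong (true ,_) (cong₂ _,_ f
        (trans (cong (λ b → if b then x else proj₁ (proj₂ s)) p) (sym (cong (λ b → if b then x else proj₁ (proj₂ t)) q)))))
      κb-class : ∀ t → class (app κb t) ≡ class t
      κb-class = switch-label class κa (class-≡ h″ k″ (H⇒D h″ Hyx) (special-D (at-y false)) refl)
        (switch-label class κ″ (class-≡ h k (H⇒D h Hxy) Dk refl)
          (λ t → cong (λ (d , _ , r) → d , true , r) (C.label t)))
      finer : ∀ s t → Comp κb θ s t → Comp κ₂ θ s t
      finer s t r = go s t (flagD s) refl (Comp-label class κb-class (λ _ → refl) r)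
        where
        go : ∀ s t b → flagD s ≡ b → class s ≡ class t → Comp κ₂ θ s t
        go s t true p e = D-connected s t p (trans (sym (cong proj₁ e)) p) (cong (proj₁ ∘ proj₂ ∘ proj₂) e)
        go s@(u , w , a) t@(u′ , w′ , b) false p e = dart (cong (proj₁ ∘ proj₂ ∘ proj₂) e)
            (trans (sym (cong (λ b → if b then x else w) p)) (trans (cong (proj₂ ∘ proj₂ ∘ proj₂) e)
              (cong (λ b → if b then x else w′) (trans (sym (cong proj₁ e)) p)))) a b
          where
          dart : u ≡ u′ → w ≡ w′ → ∀ a b → Comp κ₂ θ (u , w , a) (u′ , w′ , b)
          dart refl refl true true = here
          dart refl refl true false = byε here
          dart refl refl false true = byε here
          dart refl refl false false = here

    -- The 4 conceded by `P.bound` is made good by the four extra vertex orbits of `separated`;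
    -- `C.bound` carries the balance from `P.κ⁺` to `κ″`.
    orb-grows : orb₂ κ₂ ε ≤ orb₂ κ″ ε
    orb-grows = go (orb₂ κ₂ ε) (orb₂ P.κ⁺ θ) (orb₂ P.κ⁺ ε) (orb₂ κ₂ θ) (orb₂ κ″ θ) (orb₂ κ″ ε) P.bound C.bound separated
      where
      go : ∀ a b c d e f → a + b ≤ c + d + 4 → c + e ≤ f + b → 4 + d ≤ e → a ≤ f
      go a b c d e f p q r = ℕₚ.+-cancelʳ-≤ (b + (c + e)) a f (begin
        a + (b + (c + e)) ≡⟨ ℕₚ.+-assoc a b (c + e) ⟨
        (a + b) + (c + e) ≤⟨ ℕₚ.+-mono-≤ p q ⟩
        (c + d + 4) + (f + b) ≡⟨ cong (_+ (f + b)) (ℕₚ.+-assoc c d 4) ⟩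
        (c + (d + 4)) + (f + b) ≡⟨ cong (λ z → (c + z) + (f + b)) (ℕₚ.+-comm d 4) ⟩
        (c + (4 + d)) + (f + b) ≤⟨ ℕₚ.+-monoˡ-≤ (f + b) (ℕₚ.+-monoʳ-≤ c r) ⟩
        (c + e) + (f + b) ≡⟨ ℕₚ.+-comm (c + e) (f + b) ⟩
        (f + b) + (c + e) ≡⟨ ℕₚ.+-assoc f b (c + e) ⟩
        f + (b + (c + e)) ∎)
        where open ℕₚ.≤-Reasoning

    κK εK : Match (State N)
    κK = conjugate κ″
    εK = conjugate ε

    εK-flag : ∀ t → flag K t ≡ true → app εK t ≡ crossEdge sg t
    εK-flag (u , w , s) e = go (edgeK e)
      where
      fixed : E H u w ≡ false → Edge w u → β (crossEdge sg (u , w , s)) ≡ crossEdge sg (u , w , s)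
      fixed noH (is-xy refl refl) = contradiction (trans (sym Hyx) noH) true≢false
      fixed noH (is-yx refl refl) = contradiction (trans (sym Hxy) noH) true≢false
      fixed noH (plain f _) = f _
      go : Edge u w → app εK (u , w , s) ≡ crossEdge sg (u , w , s)
      go (is-xy refl refl) = trans (cong (β ∘ app ε) (βxy s)) (trans (cong β (ε-x s)) (βyy _))
      go (is-yx refl refl) = trans (cong (β ∘ app ε) (βyx s)) (trans (cong β (ε-y s))
            (trans (βxx _) (cong (λ b → x , y , not (s xor b)) (sig-sym eU x y))))
      go (plain fix noH) = trans (cong (β ∘ app ε) (fix s)) (trans (cong β (ε-plain (u , w , s) (trans (EU u w) (∨-trueʳ {E H u w} e))))
            (fixed noH (edgeK (trans (symK w u) e))))

    H-connected : ∀ u w z → E H u w ≡ true → E H u z ≡ true → Comp κ″ θ (u , w , false) (u , z , false)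
    H-connected u w z p q = C.connected _ _ (ℓ-≡ (u , w , false) (u , z , false) (∨-trueˡ p) (∨-trueˡ q) (trans p (sym q)) refl)

    K-connected : ∀ u w z → E K u w ≡ true → E K u z ≡ true → Comp κK θ (u , w , false) (u , z , false)
    K-connected u w z p q = subst (λ r → Comp κK θ r (u , z , false)) (β-β (u , w , false)) (subst (Comp κK θ (β (β (u , w , false)))) (β-β (u , z , false))
      (Comp-map β (λ _ → A₀) (λ _ a → a) (λ _ a → a) (λ t _ → cong (β ∘ app κ″) (sym (β-β t))) (λ _ _ → refl) refl
        (C.connected (β (u , w , false)) (β (u , z , false))
          (ℓ-≡ (β (u , w , false)) (β (u , z , false)) (K⇒D (β (u , w , false)) p′) (K⇒D (β (u , z , false)) q′)
            (trans (K⇒¬H (β (u , w , false)) p′) (sym (K⇒¬H (β (u , z , false)) q′))) refl))))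
      where
      A₀ = true ≡ true
      p′ : flagK (β (u , w , false)) ≡ true
      p′ = trans (cong (flag K) (β-β (u , w , false))) p
      q′ : flagK (β (u , z , false)) ≡ true
      q′ = trans (cong (flag K) (β-β (u , z , false))) q

    K″ : ∀ t → flag K t ≡ true → flag K (app κK t) ≡ true
    K″ t e = K-of κ″ D″ H″ (β t) (trans (cong (flag K) (β-β t)) e)

    module RH = Realize H symH irrH κ″ ε sg (sig-sym eU) vertex″ (λ t e → trans (H″ t) e)
                  (λ t e → ε-plain t (H⇒U t e)) H-connected
    module RK = Realize K symK irrK κK εK sg (sig-sym eU) (λ t → vertex″ (β t)) K″ εK-flag K-connected

  splitH : Embedding H
  splitH = RH.realized

  splitK : Embedding K
  splitK = RK.realized

  private
    K-ε : ∀ t → flagK t ≡ true → flagK (app ε t) ≡ true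
    K-ε = K-of ε D-ε τ-ε

    orb-K : orbOn flagK (perm κ″ ε) ≡ numOrbits splitK
    orb-K = trans (orbOn-conj flagK (flag K) (perm κ″ ε) (perm κK εK) β β-β (λ _ e → e) (λ t e → trans (cong (flag K) (β-β t)) e)
      (λ t e → K″ _ (K-ε (β t) (trans (cong (flag K) (β-β t)) e)))
      (λ t _ → trans (β-β _) (cong (app κ″) (β-β _))))
      (sym RK.numOrbits-realized)

    orb-split : orb₂ κ″ ε ≡ numOrbits splitH + numOrbits splitK + size (not ∘ flagD)
    orb-split = trans (orb-D κ″ ε (λ t e → trans (H″ _) (trans (τ-ε t) e)) (λ t e → K-of κ″ D″ H″ _ (K-ε t e))
        (λ t e → trans (cong (app κ″) (ε-off t e)) (trans (off″ _ e) (invol θ t))))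
      (cong (_+ size (not ∘ flagD)) (cong₂ _+_ (sym RH.numOrbits-realized) orb-K))

    orb-eU : orb₂ κ εU ≡ numOrbits eU + (4 + size (not ∘ flagD))
    orb-eU = trans (orb-U κ εU (λ t e → trans (GU.corners-flag eU _) (trans (GU.edges-flag sg (sig-sym eU) t) e))
        (λ t e → trans (cong (app κ) (εU-off t e)) (trans (κ-off _ e) (invol θ t))))
      (cong₂ _+_ (sym (GU.numOrbits-orbOn eU)) size-U)

  split-orbits : 2 + numOrbits eU ≤ numOrbits splitH + numOrbits splitK
  split-orbits = ℕₚ.+-cancelˡ-≤ 2 _ _ (ℕₚ.+-cancelʳ-≤ (size (not ∘ flagD)) _ _
    (ℕₚ.≤-trans (ℕₚ.≤-reflexive (sym (trans orb-eU (trans (sym (ℕₚ.+-assoc (numOrbits eU) 4 _))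
        (cong (_+ size (not ∘ flagD)) (ℕₚ.+-comm (numOrbits eU) 4))))))
      (ℕₚ.≤-trans inserted (ℕₚ.≤-trans (ℕₚ.+-monoʳ-≤ 2 orb-grows) (ℕₚ.≤-reflexive (cong (2 +_) orb-split))))))

-- The remaining terms of Euler's formula

any-allFin : ∀ {n} (p : Fin n → Bool) i → p i ≡ true → any p (allFin n) ≡ true
any-allFin p i h = go id i h
  where
  go : ∀ {m} (f : Fin m → _) i → p (f i) ≡ true → any p (tabulate f) ≡ true
  go f zero h = ∨-trueˡ h
  go f (suc i) h = ∨-trueʳ {p (f zero)} (go (f ∘ suc) i h)

any-allFin⁻ : ∀ {n} (p : Fin n → Bool) → any p (allFin n) ≡ true → ∃ λ i → p i ≡ true
any-allFin⁻ p h = go id h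
  where
  go : ∀ {m} (f : Fin m → _) → any p (tabulate f) ≡ true → ∃ λ i → p i ≡ true
  go {suc m} f h with ∨-true {p (f zero)} h
  ... | inj₁ e = f zero , e
  ... | inj₂ e = go (f ∘ suc) e

cnt-false : ∀ {n} (p : Fin n → Bool) → (∀ i → p i ≡ false) → cnt p ≡ 0
cnt-false {n} p h = trans (cnt-cong h) (Sum-0 {n})

cnt-single : ∀ {n} (a : Fin n) → cnt (λ i → ⌊ i ≟ a ⌋) ≡ 1
cnt-single a = trans (cnt-∖ _ a (⌊⌋-true {a? = a ≟ a} refl)) (cong suc (cnt-false _ (λ i → none ⌊ i ≟ a ⌋)))
  where
  none : ∀ b → b ∧ not b ≡ false
  none true = refl
  none false = refl

module Reach {N} (G : Graph N) where

  _↝_ : Fin N → Fin N → Set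
  u ↝ w = ∃ λ k → reach G k u w ≡ true

  reach-keep : ∀ k {u w} → reach G k u w ≡ true → reach G (suc k) u w ≡ true
  reach-keep k h = ∨-trueˡ h

  reach-step : ∀ k {u w z} → reach G k u w ≡ true → E G w z ≡ true → reach G (suc k) u z ≡ true
  reach-step k {u} {w} {z} h e = ∨-trueʳ {reach G k u z} (any-allFin _ w (∧-true h e))

  reach-suc⁻ : ∀ k {u z} → reach G (suc k) u z ≡ true →
               reach G k u z ≡ true ⊎ (∃ λ w → reach G k u w ≡ true × E G w z ≡ true)
  reach-suc⁻ k {u} {z} h with ∨-true {reach G k u z} h
  ... | inj₁ e = inj₁ e
  ... | inj₂ e = let w , p = any-allFin⁻ _ e in inj₂ (w , ∧-true⁻ p)

  reach-zero⁻ : ∀ {u w} → reach G 0 u w ≡ true → u ≡ w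
  reach-zero⁻ {u} {w} h = ⌊⌋-true⁻ {a? = u ≟ w} h

  reach-refl : ∀ u → reach G 0 u u ≡ true
  reach-refl u = ⌊⌋-true {a? = u ≟ u} refl

  reach-≤ : ∀ {j k u w} → j ≤ k → reach G j u w ≡ true → reach G k u w ≡ true
  reach-≤ {j} {k} {u} {w} le h = subst (λ m → reach G m u w ≡ true) (ℕₚ.m∸n+n≡m le) (go (k ∸ j))
    where
    go : ∀ d → reach G (d + j) u w ≡ true
    go zero = h
    go (suc d) = reach-keep (d + j) (go d)

  ↝-trans : ∀ {u w z} → u ↝ w → w ↝ z → u ↝ z
  ↝-trans {u} {w} {z} (j , p) (k , q) = go k q
    where
    go : ∀ k {z} → reach G k w z ≡ true → u ↝ z
    go zero q = j , subst (λ z → reach G j u z ≡ true) (reach-zero⁻ q) p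
    go (suc k) q with reach-suc⁻ k q
    ... | inj₁ q′ = go k q′
    ... | inj₂ (v , q′ , e) = let m , r = go k q′ in suc m , reach-step m r e

  ↝-edge : ∀ {u w} → E G u w ≡ true → u ↝ w
  ↝-edge {u} e = 1 , reach-step 0 (reach-refl u) e

  ↝-sym : Symmetric G → ∀ {u w} → u ↝ w → w ↝ u
  ↝-sym symG (k , p) = go k p
    where
    go : ∀ k {u w} → reach G k u w ≡ true → w ↝ u
    go zero p = 0 , ⌊⌋-true (sym (reach-zero⁻ p))
    go (suc k) p with reach-suc⁻ k p
    ... | inj₁ p′ = go k p′
    ... | inj₂ (v , p′ , e) = ↝-trans (↝-edge (trans (symG _ _) e)) (go k p′)

  module _ (u : Fin N) where
    Closed : ℕ → Set
    Closed k = ∀ w → reach G (suc k) u w ≡ true → reach G k u w ≡ true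

    closed? : ∀ k → Dec (Closed k)
    closed? k = Finₚ.all? (λ w → (reach G (suc k) u w ≟ᵇ true) →-dec (reach G k u w ≟ᵇ true))

    -- The sets of vertices within distance k grow strictly until they stabilise.
    growth : ∀ k → (∃ λ j → j < k × Closed j) ⊎ k < cnt (reach G k u)
    growth zero = inj₂ (ℕₚ.≤-trans (ℕₚ.≤-reflexive (sym (cnt-single u)))
      (cnt-mono (λ i → ⌊ i ≟ u ⌋) (reach G 0 u) (λ i h → ⌊⌋-true {a? = u ≟ i} (sym (⌊⌋-true⁻ {a? = i ≟ u} h)))))
    growth (suc k) with growth k
    ... | inj₁ (j , j<k , c) = inj₁ (j , ℕₚ.m≤n⇒m≤1+n j<k , c)
    ... | inj₂ big with closed? k
    ... | yes c = inj₁ (k , ℕₚ.n<1+n k , c)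
    ... | no ¬c with Finₚ.¬∀⟶∃¬ N _ (λ w → (reach G (suc k) u w ≟ᵇ true) →-dec (reach G k u w ≟ᵇ true)) ¬c
    ... | w , ¬w = inj₂ (ℕₚ.≤-<-trans big (cnt-mono-< (reach G k u) (reach G (suc k) u) w (λ i → reach-keep k)
            (new (reach G (suc k) u w) (λ e → ¬w (λ e′ → contradiction (trans (sym e′) e) true≢false)))
            (¬true⇒false (λ e → ¬w (λ _ → e)))))
      where
      new : ∀ b → (b ≡ false → ⊥) → b ≡ true
      new true _ = refl
      new false h = ⊥-elim (h refl)

  -- If the reachable sets were still growing at `N`, they would contain more than `N` vertices. So
  -- they stabilise earlier, and `N` rounds suffice.
  connectedTo-complete : ∀ {u w} → u ↝ w → connectedTo G u w ≡ true
  connectedTo-complete {u} {w} (k , p) with growth u N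
  ... | inj₂ big = contradiction (cnt-≤ (reach G N u)) (ℕₚ.<⇒≱ big)
  ... | inj₁ (j , j<N , c) = reach-≤ (ℕₚ.<⇒≤ j<N) (go k p)
    where
    go : ∀ k {w} → reach G k u w ≡ true → reach G j u w ≡ true
    go zero p = reach-≤ {0} {j} z≤n p
    go (suc k) p with reach-suc⁻ k p
    ... | inj₁ p′ = go k p′
    ... | inj₂ (v , p′ , e) = c _ (reach-step j (go k p′) e)

  connectedTo-sound : ∀ {u w} → connectedTo G u w ≡ true → u ↝ w
  connectedTo-sound h = N , h

  components : Symmetric G → Part N
  components symG = record
    { P = V G ; _≈_ = _↝_
    ; _≈?_ = λ u w → map′ connectedTo-sound connectedTo-complete (connectedTo G u w ≟ᵇ true)
    ; ≈refl = 0 , reach-refl _ ; ≈sym = ↝-sym symG ; ≈trans = ↝-trans }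

  numComponents-classes : (symG : Symmetric G) → numComponents G ≡ classes (components symG)
  numComponents-classes symG = trans (count≡cnt first) (classes-spec (components symG) first sound complete)
    where
    earlier : Fin N → Fin N → Bool
    earlier u w = V G w ∧ (toℕ w ≤ᵇ' toℕ u) ∧ not (w == u) ∧ connectedTo G u w
    first : Fin N → Bool
    first u = V G u ∧ not (any (earlier u) (allFin N))
    sound : ∀ u → first u ≡ true → IsRep (components symG) u
    sound u h = let vu , none = ∧-true⁻ {V G u} h in vu , λ w vw r → least vw r (not-false none) (toℕ u ℕ.≤? toℕ w) (w ≟ u)
      where
      least : ∀ {w} → V G w ≡ true → u ↝ w → any (earlier u) (allFin N) ≡ false →
              Dec (toℕ u ≤ toℕ w) → Dec (w ≡ u) → toℕ u ≤ toℕ w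
      least vw r none (yes le) _ = le
      least vw r none (no nle) (yes refl) = ℕₚ.≤-refl
      least {w} vw r none (no nle) (no ne) = contradiction (trans (sym (any-allFin (earlier u) w
        (∧-true vw (∧-true (≤⇒≤ᵇ′ (ℕₚ.<⇒≤ (ℕₚ.≰⇒> nle))) (∧-true (cong not (⌊⌋-false {a? = w ≟ u} ne)) (connectedTo-complete r)))))) none) true≢false
    complete : ∀ u → IsRep (components symG) u → first u ≡ true
    complete u (vu , least) = ∧-true vu (cong not (¬true⇒false bad))
      where
      bad : any (earlier u) (allFin N) ≢ true
      bad h =
        let w , e = any-allFin⁻ (earlier u) h
            vw , e₁ = ∧-true⁻ {V G w} e
            le , e₂ = ∧-true⁻ {toℕ w ≤ᵇ' toℕ u} e₁
            ne , r = ∧-true⁻ {not (w == u)} e₂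
        in true≢false (trans (sym (⌊⌋-true {a? = w ≟ u} (Finₚ.toℕ-injective (ℕₚ.≤-antisym (≤ᵇ′⇒≤ _ _ le) (least w vw (connectedTo-sound r))))))
             (not-false ne))

classes-one : ∀ {n} (C : Part n) k → P C k ≡ true → (∀ i j → P C i ≡ true → P C j ≡ true → _≈_ C i j) → classes C ≡ 1
classes-one C k pk all≈ = ℕₚ.≤-antisym
  (cnt-inj {n = 1} _ (λ _ → true) (λ _ → zero) (λ _ _ → refl)
    (λ i j hi hj _ → let ci = ⌊⌋-true⁻ {a? = isRep? C i} hi ; cj = ⌊⌋-true⁻ {a? = isRep? C j} hj in
      rep-unique C ci cj (all≈ i j (proj₁ ci) (proj₁ cj))))
  (cnt-inj {m = 1} (λ _ → true) _ (λ _ → proj₁ (rep C k pk))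
    (λ _ _ → ⌊⌋-true {a? = isRep? C _} (proj₁ (proj₂ (rep C k pk)))) (λ { zero zero _ _ _ → refl }))

degrees : ∀ {N} → Graph N → ℕ
degrees G = Sum (λ u → cnt (E G u))

numEdges-degrees : ∀ {N} (G : Graph N) → numEdges G ≡ degrees G ℕ./ 2
numEdges-degrees {N} G = cong (ℕ._/ 2) (sum-allFin₂ (λ u w → bit (E G u w)))

half : ∀ k → (k + k) ℕ./ 2 ≡ k
half k = trans (cong (ℕ._/ 2) (trans (cong (k +_) (sym (ℕₚ.+-identityʳ k))) (ℕₚ.*-comm 2 k))) (DivMod.m*n/n≡m k 2)

-- An edge has one dart to a larger and one to a smaller vertex. This makes the halving in
-- `numEdges` exact.
degrees-even : ∀ {N} (G : Graph N) → Symmetric G → Irreflexive G → ∃ λ k → degrees G ≡ k + k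
degrees-even G symG irrG = Sum (λ u → cnt (up u)) ,
  trans (Sum-cong (λ u → trans (Sum-cong (split u)) (Sum-+ (bit ∘ up u) (bit ∘ down u))))
    (trans (Sum-+ (λ u → cnt (up u)) (λ u → cnt (down u))) (cong (Sum (λ u → cnt (up u)) +_)
      (trans (Sum-swap (λ u w → bit (down u w))) (Sum-cong (λ w → cnt-cong (λ u → cong (_∧ ⌊ w Finₚ.<? u ⌋) (symG u w)))))))
  where
  up down : _ → _ → Bool
  up u w = E G u w ∧ ⌊ u Finₚ.<? w ⌋
  down u w = E G u w ∧ ⌊ w Finₚ.<? u ⌋
  split : ∀ u w → bit (E G u w) ≡ bit (up u w) + bit (down u w)
  split u w = go (E G u w) refl (u Finₚ.<? w) (w Finₚ.<? u)
    where
    go : ∀ b → E G u w ≡ b → (p : Dec (toℕ u < toℕ w)) (q : Dec (toℕ w < toℕ u)) → bit b ≡ bit (b ∧ ⌊ p ⌋) + bit (b ∧ ⌊ q ⌋)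
    go false _ _ _ = refl
    go true e (yes p) (yes q) = contradiction q (ℕₚ.<-asym p)
    go true e (yes p) (no q) = refl
    go true e (no p) (yes q) = refl
    go true e (no p) (no q) with Finₚ.<-cmp u w
    ... | tri< a _ _ = contradiction a p
    ... | tri> _ _ a = contradiction a q
    ... | tri≈ _ refl _ = contradiction (trans (sym e) (irrG u)) true≢false

record VertexAmalgam {N} (x y : Fin N) (H K U : Graph N) : Set where
  field
    amalgam : Amalgam x y H K U
    EVH : ∀ u w → E H u w ≡ true → V H u ≡ true
    EVK : ∀ u w → E K u w ≡ true → V K u ≡ true
    VU  : ∀ u → V U u ≡ V H u ∨ V K u
    meet : ∀ u → V H u ≡ true → V K u ≡ true → u ≡ x ⊎ u ≡ y
    connK : Connected K

module EulerTerms {N} {x y : Fin N} {H K U : Graph N} (va : VertexAmalgam x y H K U) where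
  open VertexAmalgam va
  open Amalgam amalgam
  open AmalgamFlags amalgam using (symU; irrU; Hyx; Kyx; y≢x)
  module RH = Reach H
  module RK = Reach K
  module RU = Reach U

  Vx : V H x ≡ true × V K x ≡ true
  Vx = EVH x y Hxy , EVK x y Kxy

  Vy : V H y ≡ true × V K y ≡ true
  Vy = EVH y x Hyx , EVK y x Kyx

  vertices-U : numVertices U + 2 ≡ numVertices H + numVertices K
  vertices-U = begin
    numVertices U + 2 ≡⟨ cong₂ _+_ (count≡cnt (V U)) (sym (cong₂ _+_ (cnt-single x) (cnt-single y))) ⟩
    cnt (V U) + (cnt (λ u → ⌊ u ≟ x ⌋) + cnt (λ u → ⌊ u ≟ y ⌋)) ≡⟨ cong (cnt (V U) +_) (Sum-+ _ (λ u → bit ⌊ u ≟ y ⌋)) ⟨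
    cnt (V U) + Sum (λ u → bit ⌊ u ≟ x ⌋ + bit ⌊ u ≟ y ⌋) ≡⟨ Sum-+ (bit ∘ V U) _ ⟨
    Sum (λ u → bit (V U u) + (bit ⌊ u ≟ x ⌋ + bit ⌊ u ≟ y ⌋)) ≡⟨ Sum-cong (λ u → trans (cong (λ b → bit b + _) (VU u)) (pointwise u (u ≟ x) (u ≟ y) (V H u) (V K u) refl refl)) ⟩
    Sum (λ u → bit (V H u) + bit (V K u)) ≡⟨ Sum-+ (bit ∘ V H) (bit ∘ V K) ⟩
    cnt (V H) + cnt (V K) ≡⟨ cong₂ _+_ (count≡cnt (V H)) (count≡cnt (V K)) ⟨
    numVertices H + numVertices K ∎
    where
    open ≡-Reasoning
    case : ∀ {u} → u ≢ x → u ≢ y → u ≡ x ⊎ u ≡ y → ⊥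
    case p q (inj₁ e) = p e
    case p q (inj₂ e) = q e
    pointwise : ∀ u (p : Dec (u ≡ x)) (q : Dec (u ≡ y)) a b → V H u ≡ a → V K u ≡ b →
      bit (a ∨ b) + (bit ⌊ p ⌋ + bit ⌊ q ⌋) ≡ bit a + bit b
    pointwise u (yes refl) (yes e) a b f g = contradiction e x≢y
    pointwise u (yes refl) (no _) a b f g rewrite trans (sym f) (proj₁ Vx) | trans (sym g) (proj₂ Vx) = refl
    pointwise u (no _) (yes refl) a b f g rewrite trans (sym f) (proj₁ Vy) | trans (sym g) (proj₂ Vy) = refl
    pointwise u (no p) (no q) true true f g = ⊥-elim (case p q (meet u f g))
    pointwise u (no p) (no q) true false f g = refl
    pointwise u (no p) (no q) false true f g = refl
    pointwise u (no p) (no q) false false f g = refl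

  dart : Fin N → Fin N → Fin N → Fin N → Bool
  dart a b u w = ⌊ u ≟ a ⌋ ∧ ⌊ w ≟ b ⌋

  degrees-dart : ∀ a b → Sum (λ u → cnt (dart a b u)) ≡ 1
  degrees-dart a b = trans (Sum-cong (λ u → row (u ≟ a))) (cnt-single a)
    where
    row : ∀ {u} (d : Dec (u ≡ a)) → cnt (λ w → ⌊ d ⌋ ∧ ⌊ w ≟ b ⌋) ≡ bit ⌊ d ⌋
    row (yes _) = cnt-single b
    row (no _) = Sum-0 {N}

  -- The darts from `x` to `y` and back occur in both summands and in no other way do the edges
  -- overlap.
  degrees-U : degrees U + 2 ≡ degrees H + degrees K
  degrees-U = begin
    degrees U + 2 ≡⟨ cong (degrees U +_) (sym (cong₂ _+_ (degrees-dart x y) (degrees-dart y x))) ⟩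
    degrees U + (Sum (λ u → cnt (dart x y u)) + Sum (λ u → cnt (dart y x u))) ≡⟨ cong (degrees U +_) (Sum-+ _ (λ u → cnt (dart y x u))) ⟨
    degrees U + Sum (λ u → cnt (dart x y u) + cnt (dart y x u)) ≡⟨ Sum-+ (λ u → cnt (E U u)) _ ⟨
    Sum (λ u → cnt (E U u) + (cnt (dart x y u) + cnt (dart y x u))) ≡⟨ Sum-cong row ⟩
    Sum (λ u → cnt (E H u) + cnt (E K u)) ≡⟨ Sum-+ (λ u → cnt (E H u)) (λ u → cnt (E K u)) ⟩
    degrees H + degrees K ∎
    where
    open ≡-Reasoning
    pointwise : ∀ u w (p : Dec (u ≡ x)) (q : Dec (w ≡ y)) (r : Dec (u ≡ y)) (s : Dec (w ≡ x)) a b →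
      E H u w ≡ a → E K u w ≡ b → bit (a ∨ b) + (bit (⌊ p ⌋ ∧ ⌊ q ⌋) + bit (⌊ r ⌋ ∧ ⌊ s ⌋)) ≡ bit a + bit b
    both : ∀ u w → E H u w ≡ true → E K u w ≡ true → (u ≡ x × w ≡ y) ⊎ (u ≡ y × w ≡ x)
    both u w f g with shared u w w f g | shared w u u (trans (symH w u) f) (trans (symK w u) g)
    ... | inj₁ p | inj₂ q = inj₁ (p , q)
    ... | inj₂ p | inj₁ q = inj₂ (p , q)
    ... | inj₁ refl | inj₁ refl = contradiction (trans (sym f) (irrH x)) true≢false
    ... | inj₂ refl | inj₂ refl = contradiction (trans (sym f) (irrH y)) true≢false
    pointwise u w (yes refl) (yes refl) (yes e) _ a b f g = contradiction e x≢y
    pointwise u w (yes refl) (yes refl) (no _) _ a b f g rewrite trans (sym f) Hxy | trans (sym g) Kxy = refl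
    pointwise u w (yes p) (no _) (yes refl) _ a b f g = contradiction p y≢x
    pointwise u w (no _) _ (yes refl) (yes refl) a b f g rewrite trans (sym f) Hyx | trans (sym g) Kyx = refl
    pointwise u w (yes p) (no q) (no r) _ true true f g with both u w f g
    ... | inj₁ (_ , e) = contradiction e q
    ... | inj₂ (e , _) = contradiction e r
    pointwise u w (no p) _ (yes r) (no s) true true f g with both u w f g
    ... | inj₁ (e , _) = contradiction e p
    ... | inj₂ (_ , e) = contradiction e s
    pointwise u w (no p) _ (no r) _ true true f g with both u w f g
    ... | inj₁ (e , _) = contradiction e p
    ... | inj₂ (e , _) = contradiction e r
    pointwise u w (yes p) (no q) (no r) _ true false f g = refl
    pointwise u w (yes p) (no q) (no r) _ false true f g = refl
    pointwise u w (yes p) (no q) (no r) _ false false f g = refl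
    pointwise u w (no p) _ (yes r) (no s) true false f g = refl
    pointwise u w (no p) _ (yes r) (no s) false true f g = refl
    pointwise u w (no p) _ (yes r) (no s) false false f g = refl
    pointwise u w (no p) _ (no r) _ true false f g = refl
    pointwise u w (no p) _ (no r) _ false true f g = refl
    pointwise u w (no p) _ (no r) _ false false f g = refl
    row : ∀ u → cnt (E U u) + (cnt (dart x y u) + cnt (dart y x u)) ≡ cnt (E H u) + cnt (E K u)
    row u = trans (cong (cnt (E U u) +_) (sym (Sum-+ (bit ∘ dart x y u) (bit ∘ dart y x u))))
      (trans (sym (Sum-+ (bit ∘ E U u) _)) (trans (Sum-cong (λ w → trans (cong (λ b → bit b + _) (EU u w))
        (pointwise u w (u ≟ x) (w ≟ y) (u ≟ y) (w ≟ x) (E H u w) (E K u w) refl refl))) (Sum-+ (bit ∘ E H u) (bit ∘ E K u))))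

  edges-U : numEdges U + 1 ≡ numEdges H + numEdges K
  edges-U = trans (cong (_+ 1) (trans (numEdges-degrees U) (trans (cong (ℕ._/ 2) (proj₂ U₂)) (half (proj₁ U₂)))))
    (trans (double (proj₁ U₂) (proj₁ H₂) (proj₁ K₂) (trans (cong (_+ 2) (sym (proj₂ U₂))) (trans degrees-U (cong₂ _+_ (proj₂ H₂) (proj₂ K₂)))))
      (sym (cong₂ _+_ (trans (numEdges-degrees H) (trans (cong (ℕ._/ 2) (proj₂ H₂)) (half (proj₁ H₂))))
                      (trans (numEdges-degrees K) (trans (cong (ℕ._/ 2) (proj₂ K₂)) (half (proj₁ K₂)))))))
    where
    U₂ = degrees-even U symU irrU
    H₂ = degrees-even H symH irrH
    K₂ = degrees-even K symK irrK
    double : ∀ a b c → a + a + 2 ≡ (b + b) + (c + c) → a + 1 ≡ b + c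
    double a b c e = trans (sym (half (a + 1))) (trans (cong (ℕ._/ 2) (trans (interchange a 1 a 1) (trans e (interchange b b c c)))) (half (b + c)))

  mono-U : ∀ {u w} → u RH.↝ w → u RU.↝ w
  mono-U (k , p) = go k p
    where
    go : ∀ k {u w} → reach H k u w ≡ true → u RU.↝ w
    go zero p = 0 , p
    go (suc k) p with RH.reach-suc⁻ k p
    ... | inj₁ p′ = go k p′
    ... | inj₂ (v , p′ , e) = RU.↝-trans (go k p′) (RU.↝-edge (trans (EU v _) (∨-trueˡ e)))

  mono-U′ : ∀ {u w} → u RK.↝ w → u RU.↝ w
  mono-U′ (k , p) = go k p
    where
    go : ∀ k {u w} → reach K k u w ≡ true → u RU.↝ w
    go zero p = 0 , p
    go (suc k) p with RK.reach-suc⁻ k p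
    ... | inj₁ p′ = go k p′
    ... | inj₂ (v , p′ , e) = RU.↝-trans (go k p′) (RU.↝-edge (trans (EU v _) (∨-trueʳ {E H v _} e)))

  -- A walk of U from a vertex of H is followed in H, any excursion into K being replaced by a stay at x.
  project : ∀ {u} → V H u ≡ true → ∀ k {w} → reach U k u w ≡ true →
            (V H w ≡ true → u RH.↝ w) × (V H w ≡ false → u RH.↝ x)
  project {u} vu zero p = (λ _ → 0 , p) , λ f → contradiction (trans (sym vu) (trans (cong (V H) (RU.reach-zero⁻ p)) f)) true≢false
  project {u} vu (suc k) {w} p with RU.reach-suc⁻ k p
  ... | inj₁ p′ = project vu k p′
  ... | inj₂ (v , p′ , e) with ∨-true {E H v w} (trans (sym (EU v w)) e)
  ... | inj₁ eH = (λ _ → RH.↝-trans (proj₁ (project vu k p′) (EVH v w eH)) (RH.↝-edge eH))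
                , λ f → contradiction (trans (sym (EVH w v (trans (symH w v) eH))) f) true≢false
  ... | inj₂ eK = (λ vw → land (meet w vw (EVK w v (trans (symK w v) eK)))) , λ _ → via (V H v) refl
    where
    toX : v ≡ x ⊎ v ≡ y → u RH.↝ v → u RH.↝ x
    toX (inj₁ refl) r = r
    toX (inj₂ refl) r = RH.↝-trans r (RH.↝-edge Hyx)
    via : ∀ b → V H v ≡ b → u RH.↝ x
    via true f = toX (meet v f (EVK v w eK)) (proj₁ (project vu k p′) f)
    via false f = proj₂ (project vu k p′) f
    land : ∀ {w} → w ≡ x ⊎ w ≡ y → u RH.↝ w
    land (inj₁ refl) = via (V H v) refl
    land (inj₂ refl) = RH.↝-trans (via (V H v) refl) (RH.↝-edge Hxy)

  components-K : numComponents K ≡ 1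
  components-K = trans (RK.numComponents-classes symK)
    (classes-one (RK.components symK) x (proj₂ Vx) (λ u w vu vw → RK.connectedTo-sound (connK u w vu vw)))

  -- All of `K` hangs together with `x`, so sending its private vertices to `x` matches the
  -- components of `U` with those of `H`.
  components-U : numComponents U ≡ numComponents H
  components-U = trans (RU.numComponents-classes symU) (trans (ℕₚ.≤-antisym U≤H H≤U) (sym (RH.numComponents-classes symH)))
    where
    g : Fin N → Fin N
    g u = if V H u then u else x
    g-V : ∀ u → V H (g u) ≡ true
    g-V u = go (V H u) refl
      where
      go : ∀ b → V H u ≡ b → V H (if b then u else x) ≡ true
      go true e = e
      go false e = proj₁ Vx
    near : ∀ u → V U u ≡ true → u RU.↝ g u
    near u h = go (V H u) refl
      where
      go : ∀ b → V H u ≡ b → u RU.↝ (if b then u else x)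
      go true e = 0 , RU.reach-refl u
      go false e = mono-U′ (RK.connectedTo-sound (connK u x (inK (∨-true {V H u} (trans (sym (VU u)) h))) (proj₂ Vx)))
        where
        inK : V H u ≡ true ⊎ V K u ≡ true → V K u ≡ true
        inK (inj₁ f) = contradiction (trans (sym f) e) true≢false
        inK (inj₂ f) = f
    U≤H : classes (RU.components symU) ≤ classes (RH.components symH)
    U≤H = classes-≤ (RU.components symU) (RH.components symH) g (λ u _ → g-V u)
      (λ u w hu hw r → RU.↝-trans (near u hu) (RU.↝-trans (mono-U r) (RU.↝-sym symU (near w hw))))
    H≤U : classes (RH.components symH) ≤ classes (RU.components symU)
    H≤U = classes-≤ (RH.components symH) (RU.components symU) id (λ u h → trans (VU u) (∨-trueˡ h))
      (λ u w hu hw (k , p) → proj₁ (project hu k p) hw)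

  -- A walk from `u` to `x` has a first edge unless `u` is `x`, which has `xy`. This matters because
  -- `numFaces` adds a face for every isolated vertex.
  isolated-K : ∀ u → isolated K u ≡ false
  isolated-K u = ¬true⇒false (λ h → let vu , none = ∧-true⁻ {V K u} h in bad (not-false none) (leave N (connK u x vu (proj₂ Vx))))
    where
    leave : ∀ k {w} → reach K k u w ≡ true → u ≡ w ⊎ (∃ λ z → E K u z ≡ true)
    leave zero p = inj₁ (RK.reach-zero⁻ p)
    leave (suc k) p with RK.reach-suc⁻ k p
    ... | inj₁ p′ = leave k p′
    ... | inj₂ (v , p′ , e) with leave k p′
    ... | inj₁ refl = inj₂ (_ , e)
    ... | inj₂ z = inj₂ z
    bad : any (E K u) (allFin N) ≡ false → u ≡ x ⊎ (∃ λ z → E K u z ≡ true) → ⊥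
    bad none (inj₁ refl) = true≢false (trans (sym (any-allFin (E K x) y Kxy)) none)
    bad none (inj₂ (z , e)) = true≢false (trans (sym (any-allFin (E K u) z e)) none)

  isolated-U : ∀ u → isolated U u ≡ isolated H u
  isolated-U u = bool-ext to from
    where
    to : isolated U u ≡ true → isolated H u ≡ true
    to h = let vu , none = ∧-true⁻ {V U u} h in
      ∧-true (inH (not-false none) (∨-true {V H u} (trans (sym (VU u)) vu)))
        (cong not (¬true⇒false (λ a → let w , e = any-allFin⁻ (E H u) a in
          true≢false (trans (sym (any-allFin (E U u) w (trans (EU u w) (∨-trueˡ e)))) (not-false none)))))
      where
      inH : any (E U u) (allFin N) ≡ false → V H u ≡ true ⊎ V K u ≡ true → V H u ≡ true
      inH none (inj₁ f) = f
      inH none (inj₂ f) = contradiction (trans (sym (∧-true f (cong not (¬true⇒false (λ a → let w , e = any-allFin⁻ (E K u) a in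
        true≢false (trans (sym (any-allFin (E U u) w (trans (EU u w) (∨-trueʳ {E H u w} e)))) none)))))) (isolated-K u)) true≢false
    from : isolated H u ≡ true → isolated U u ≡ true
    from h = let vu , none = ∧-true⁻ {V H u} h in
      ∧-true (trans (VU u) (∨-trueˡ vu)) (cong not (¬true⇒false (λ a → let w , e = any-allFin⁻ (E U u) a in
        bad vu (not-false none) (∨-true {E H u w} (trans (sym (EU u w)) e)))))
      where
      end : ∀ {u} → u ≡ x ⊎ u ≡ y → any (E H u) (allFin N) ≡ true
      end (inj₁ refl) = any-allFin (E H x) y Hxy
      end (inj₂ refl) = any-allFin (E H y) x Hyx
      bad : ∀ {w} → V H u ≡ true → any (E H u) (allFin N) ≡ false → E H u w ≡ true ⊎ E K u w ≡ true → ⊥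
      bad {w} vu none (inj₁ e) = true≢false (trans (sym (any-allFin (E H u) w e)) none)
      bad {w} vu none (inj₂ e) = true≢false (trans (sym (end (meet u vu (EVK u w e)))) none)

  numFaces-U : (e : Embedding U) → numFaces e ≡ numOrbits e ℕ./ 2 + count (isolated H)
  numFaces-U e = cong (numOrbits e ℕ./ 2 +_) (trans (count≡cnt (isolated U)) (trans (cnt-cong isolated-U) (sym (count≡cnt (isolated H)))))

  numFaces-K : (e : Embedding K) → numFaces e ≡ numOrbits e ℕ./ 2
  numFaces-K e = trans (cong (numOrbits e ℕ./ 2 +_) (trans (count≡cnt (isolated K)) (cnt-false _ isolated-K))) (ℕₚ.+-identityʳ _)

-- Makes the halving in `numFaces` exact, so that inequalities between orbits pass to faces without
-- loss.
numOrbits-even : ∀ {N} (G : Graph N) → Symmetric G → Irreflexive G → (e : Embedding G) → ∃ λ k → numOrbits e ≡ k + k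
numOrbits-even {N} G symG irrG e = let k , h = orbOn-even (flag G) (corners e) (edges (sig e) (sig-sym e))
                                        (λ t f → trans (edges-flag (sig e) (sig-sym e) t) f)
                               in k , trans (numOrbits-orbOn e) h
  where
  open Gem G symG irrG
  open Matchings (finState {N})

-- Additivity of the Euler genus

halve-≤ : ∀ {m n} → m + m ≤ n + n → m ≤ n
halve-≤ {m} {n} h = ℕₚ.≤-trans (ℕₚ.≤-reflexive (sym (half m))) (ℕₚ.≤-trans (DivMod./-monoˡ-≤ 2 h) (ℕₚ.≤-reflexive (half n)))

-- Written as a difference of two naturals, the genus can be estimated by inequalities in ℕ.
difference : ∀ c v e f → ((ℤ.+ c ℤ.- ℤ.+ v) ℤ.+ ℤ.+ e) ℤ.- ℤ.+ f ≡ ℤ.+ (c + e) ℤ.- ℤ.+ (v + f)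
difference c v e f = solve 4 (λ c v e f → ((c :- v) :+ e) :- f := (c :+ e) :- (v :+ f)) refl (ℤ.+ c) (ℤ.+ v) (ℤ.+ e) (ℤ.+ f)
  where open ℤ-Solver.+-*-Solver

difference-+ : ∀ a b c d → (ℤ.+ a ℤ.- ℤ.+ b) ℤ.+ (ℤ.+ c ℤ.- ℤ.+ d) ≡ ℤ.+ (a + c) ℤ.- ℤ.+ (b + d)
difference-+ a b c d = solve 4 (λ a b c d → (a :- b) :+ (c :- d) := (a :+ c) :- (b :+ d)) refl (ℤ.+ a) (ℤ.+ b) (ℤ.+ c) (ℤ.+ d)
  where open ℤ-Solver.+-*-Solver

difference-≤ : ∀ a b c d → a + d ≤ c + b → ℤ.+ a ℤ.- ℤ.+ b ℤ.≤ ℤ.+ c ℤ.- ℤ.+ d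
difference-≤ a b c d h = begin
  ℤ.+ a ℤ.- ℤ.+ b            ≡⟨ pad a b d ⟩
  ℤ.+ (a + d) ℤ.- ℤ.+ (b + d) ≤⟨ ℤₚ.+-monoˡ-≤ (ℤ.- ℤ.+ (b + d)) (ℤ.+≤+ h) ⟩
  ℤ.+ (c + b) ℤ.- ℤ.+ (b + d) ≡⟨ cong (λ z → ℤ.+ (c + b) ℤ.- ℤ.+ z) (ℕₚ.+-comm b d) ⟩
  ℤ.+ (c + b) ℤ.- ℤ.+ (d + b) ≡⟨ pad c d b ⟨
  ℤ.+ c ℤ.- ℤ.+ d            ∎
  where
  open ℤₚ.≤-Reasoning
  pad : ∀ a b d → ℤ.+ a ℤ.- ℤ.+ b ≡ ℤ.+ (a + d) ℤ.- ℤ.+ (b + d)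
  pad a b d = solve 3 (λ a b d → a :- b := (a :+ d) :- (b :+ d)) refl (ℤ.+ a) (ℤ.+ b) (ℤ.+ d)
    where open ℤ-Solver.+-*-Solver

module Additivity {N} {x y : Fin N} {H K U : Graph N} (va : VertexAmalgam x y H K U) where
  open VertexAmalgam va
  open Amalgam amalgam
  open AmalgamFlags amalgam using (symU; irrU)
  open EulerTerms va

  private
    plusMinus : ∀ {G : Graph N} → Embedding G → ℕ × ℕ
    plusMinus {G} e = 2 * numComponents G + numEdges G , numVertices G + numFaces e

    genus-≡ : ∀ {G : Graph N} (e : Embedding G) → let p , m = plusMinus e in eulerGenusOf e ≡ ℤ.+ p ℤ.- ℤ.+ m
    genus-≡ {G} e = difference (2 * numComponents G) (numVertices G) (numEdges G) (numFaces e)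

    genus-+ : (eH : Embedding H) (eK : Embedding K) →
      let p , m = plusMinus eH ; p′ , m′ = plusMinus eK in
      eulerGenusOf eH ℤ.+ eulerGenusOf eK ≡ ℤ.+ (p + p′) ℤ.- ℤ.+ (m + m′)
    genus-+ eH eK = trans (cong₂ ℤ._+_ (genus-≡ eH) (genus-≡ eK)) (difference-+ (2 * numComponents H + numEdges H) (numVertices H + numFaces eH)
      (2 * numComponents K + numEdges K) (numVertices K + numFaces eK))

    -- The 3 consists of 2 for the component of `K` and 1 for `xy`, an edge of both graphs.
    plus-U : (2 * numComponents H + numEdges H) + (2 * numComponents K + numEdges K) ≡ (2 * numComponents U + numEdges U) + 3
    plus-U = begin
      (2 * cH + numEdges H) + (2 * numComponents K + numEdges K) ≡⟨ cong (λ c → (2 * cH + numEdges H) + (2 * c + numEdges K)) components-K ⟩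
      (2 * cH + numEdges H) + (2 + numEdges K) ≡⟨ solve 3 (λ c a b → (c :+ a) :+ (con 2 :+ b) := (c :+ con 2) :+ (a :+ b)) refl (2 * cH) (numEdges H) (numEdges K) ⟩
      (2 * cH + 2) + (numEdges H + numEdges K) ≡⟨ cong₂ (λ c e → (2 * c + 2) + e) components-U edges-U ⟨
      (2 * numComponents U + 2) + (numEdges U + 1) ≡⟨ solve 2 (λ c a → (c :+ con 2) :+ (a :+ con 1) := (c :+ a) :+ con 3) refl (2 * numComponents U) (numEdges U) ⟩
      (2 * numComponents U + numEdges U) + 3 ∎
      where
      open ≡-Reasoning
      open ℕ-Solver.+-*-Solver
      cH = numComponents H

    minus-U : ∀ f g → (numVertices H + f) + (numVertices K + g) ≡ numVertices U + 2 + (f + g)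
    minus-U f g = trans (interchange (numVertices H) f (numVertices K) g) (cong (_+ (f + g)) (sym vertices-U))

    faces-HK : (eH : Embedding H) (eK : Embedding K) (eU : Embedding U) →
      ∃ λ a → ∃ λ b → ∃ λ c → ∃ λ i → (numOrbits eH ≡ a + a × numFaces eH ≡ a + i)
        × (numOrbits eK ≡ b + b × numFaces eK ≡ b) × (numOrbits eU ≡ c + c × numFaces eU ≡ c + i)
    faces-HK eH eK eU =
      let a , p = numOrbits-even H symH irrH eH
          b , q = numOrbits-even K symK irrK eK
          c , r = numOrbits-even U symU irrU eU
          i = count (isolated H)
          half-of : ∀ {m} k → m ≡ k + k → m ℕ./ 2 ≡ k
          half-of = λ k e → trans (cong (ℕ._/ 2) e) (half k)
      in a , b , c , i , (p , cong (_+ i) (half-of a p)) , (q , trans (numFaces-K eK) (half-of b q))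
         , (r , trans (numFaces-U eU) (cong (_+ i) (half-of c r)))

  genus-≤-+ : (eH : Embedding H) (eK : Embedding K) (eU : Embedding U) → numOrbits eH + numOrbits eK ≤ 2 + numOrbits eU →
    eulerGenusOf eU ℤ.≤ eulerGenusOf eH ℤ.+ eulerGenusOf eK
  genus-≤-+ eH eK eU orbits with faces-HK eH eK eU
  ... | a , b , c , i , (p , fH) , (q , fK) , (r , fU) =
    subst (ℤ._≤ eulerGenusOf eH ℤ.+ eulerGenusOf eK) (sym (genus-≡ eU)) (subst (ℤ.+ pU ℤ.- ℤ.+ (vU + numFaces eU) ℤ.≤_) (sym (genus-+ eH eK)) (difference-≤ pU (vU + numFaces eU) pHK ((numVertices H + numFaces eH) + (numVertices K + numFaces eK)) (begin
      pU + ((numVertices H + numFaces eH) + (numVertices K + numFaces eK)) ≡⟨ cong (pU +_) (minus-U (numFaces eH) (numFaces eK)) ⟩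
      pU + (vU + 2 + (numFaces eH + numFaces eK)) ≡⟨ cong₂ (λ f g → pU + (vU + 2 + (f + g))) fH fK ⟩
      pU + (vU + 2 + ((a + i) + b)) ≡⟨ solve 5 (λ p v a i b → p :+ (v :+ con 2 :+ ((a :+ i) :+ b)) := (p :+ v :+ con 2 :+ i) :+ (a :+ b)) refl pU vU a i b ⟩
      (pU + vU + 2 + i) + (a + b) ≤⟨ ℕₚ.+-monoʳ-≤ (pU + vU + 2 + i) ab≤c ⟩
      (pU + vU + 2 + i) + (1 + c) ≡⟨ solve 4 (λ p v i c → (p :+ v :+ con 2 :+ i) :+ (con 1 :+ c) := (p :+ con 3) :+ (v :+ (c :+ i))) refl pU vU i c ⟩
      (pU + 3) + (vU + (c + i)) ≡⟨ cong₂ (λ p f → p + (vU + f)) plus-U fU ⟨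
      pHK + (vU + numFaces eU) ∎)))
    where
    open ℕₚ.≤-Reasoning
    open ℕ-Solver.+-*-Solver
    pU = 2 * numComponents U + numEdges U
    vU = numVertices U
    pHK = (2 * numComponents H + numEdges H) + (2 * numComponents K + numEdges K)
    ab≤c : a + b ≤ 1 + c
    ab≤c = halve-≤ (subst (_≤ (1 + c) + (1 + c)) (interchange a a b b) (subst ((a + a) + (b + b) ≤_) (interchange 1 1 c c)
      (subst (λ z → (a + a) + (b + b) ≤ 2 + z) r (ℕₚ.≤-trans (ℕₚ.≤-reflexive (sym (cong₂ _+_ p q))) orbits))))

  genus-+-≤ : (eH : Embedding H) (eK : Embedding K) (eU : Embedding U) → 2 + numOrbits eU ≤ numOrbits eH + numOrbits eK →
    eulerGenusOf eH ℤ.+ eulerGenusOf eK ℤ.≤ eulerGenusOf eU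
  genus-+-≤ eH eK eU orbits with faces-HK eH eK eU
  ... | a , b , c , i , (p , fH) , (q , fK) , (r , fU) =
    subst (ℤ._≤ eulerGenusOf eU) (sym (genus-+ eH eK)) (subst (ℤ.+ pHK ℤ.- ℤ.+ ((numVertices H + numFaces eH) + (numVertices K + numFaces eK)) ℤ.≤_) (sym (genus-≡ eU)) (difference-≤ pHK ((numVertices H + numFaces eH) + (numVertices K + numFaces eK)) pU (vU + numFaces eU) (begin
      pHK + (vU + numFaces eU) ≡⟨ cong₂ (λ p f → p + (vU + f)) plus-U fU ⟩
      (pU + 3) + (vU + (c + i)) ≡⟨ solve 4 (λ p v i c → (p :+ v :+ con 2 :+ i) :+ (con 1 :+ c) := (p :+ con 3) :+ (v :+ (c :+ i))) refl pU vU i c ⟨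
      (pU + vU + 2 + i) + (1 + c) ≤⟨ ℕₚ.+-monoʳ-≤ (pU + vU + 2 + i) c≤ab ⟩
      (pU + vU + 2 + i) + (a + b) ≡⟨ solve 5 (λ p v a i b → p :+ (v :+ con 2 :+ ((a :+ i) :+ b)) := (p :+ v :+ con 2 :+ i) :+ (a :+ b)) refl pU vU a i b ⟨
      pU + (vU + 2 + ((a + i) + b)) ≡⟨ cong₂ (λ f g → pU + (vU + 2 + (f + g))) fH fK ⟨
      pU + (vU + 2 + (numFaces eH + numFaces eK)) ≡⟨ cong (pU +_) (minus-U (numFaces eH) (numFaces eK)) ⟨
      pU + ((numVertices H + numFaces eH) + (numVertices K + numFaces eK)) ∎)))
    where
    open ℕₚ.≤-Reasoning
    open ℕ-Solver.+-*-Solver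
    pU = 2 * numComponents U + numEdges U
    vU = numVertices U
    pHK = (2 * numComponents H + numEdges H) + (2 * numComponents K + numEdges K)
    c≤ab : 1 + c ≤ a + b
    c≤ab = halve-≤ (subst ((1 + c) + (1 + c) ≤_) (interchange a a b b) (subst (_≤ (a + a) + (b + b)) (interchange 1 1 c c)
      (subst (λ z → 2 + z ≤ (a + a) + (b + b)) r (ℕₚ.≤-trans orbits (ℕₚ.≤-reflexive (cong₂ _+_ p q))))))

  genus-combine : (eH : Embedding H) (eK : Embedding K) →
    Σ (Embedding U) λ eU → eulerGenusOf eU ℤ.≤ eulerGenusOf eH ℤ.+ eulerGenusOf eK
  genus-combine eH eK = C.combined , genus-≤-+ eH eK C.combined C.combined-orbits
    where module C = Combine amalgam eH eK

  genus-split : (eU : Embedding U) →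
    Σ (Embedding H) λ eH → Σ (Embedding K) λ eK → eulerGenusOf eH ℤ.+ eulerGenusOf eK ℤ.≤ eulerGenusOf eU
  genus-split eU = S.splitH , S.splitK , genus-+-≤ S.splitH S.splitK eU S.split-orbits
    where module S = Split amalgam eU

-- Embeddings of minimum genus

module MinimumGenus {N} (G : Graph N) (symG : Symmetric G) (irrG : Irreflexive G) where
  open Orbits (finState {N})
  open Matchings (finState {N})
  open Gem G symG irrG

  private
    Label : Set
    Label = Bool × Fin N × Fin N

    _≟ᴸ_ : (a b : Label) → Dec (a ≡ b)
    _≟ᴸ_ = Productₚ.≡-dec _≟ᵇ_ (Productₚ.≡-dec _≟_ _≟_)

    ℓ : State N → Label
    ℓ t@(u , w , _) = flag G t , u , (if flag G t then u else w)

    flat : Fin N → Fin N → Bool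
    flat _ _ = false

    ε₀ : Match (State N)
    ε₀ = edges flat (λ _ _ → refl)

    open Connecting (finState {N}) _≟ᴸ_ ℓ using (Connected-by; connect)

    opaque
      -- With `θ` as the initial corners every dart is a vertex cycle of its own; merging equal
      -- labels leaves one cycle at each vertex that has neighbours.
      star : Connected-by ε₀ θ θ
      star = connect ε₀ θ (λ _ → refl) (orb₂ θ θ) θ (λ _ → refl) ℕₚ.≤-refl

    module C = Connected-by star

    ℓ-≡ : ∀ u w z → E G u w ≡ true → E G u z ≡ true → ℓ (u , w , false) ≡ ℓ (u , z , false)
    ℓ-≡ u w z p q = cong₂ (λ a b → a , u , b) (trans p (sym q))
      (trans (cong (λ b → if b then u else w) p) (sym (cong (λ b → if b then u else z) q)))

  someEmbedding : Embedding G
  someEmbedding = Realize.realized G symG irrG C.κ⁺ ε₀ flat (λ _ _ → refl) (λ t → cong (proj₁ ∘ proj₂) (C.label t))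
    (λ t e → trans (cong proj₁ (C.label t)) e) (onFlags-yes G (crossEdge flat))
    (λ u w z p q → C.connected _ _ (ℓ-≡ u w z p q))

  private
    -- An entry holds `rot`, `rotInv` and `sig` at one pair of vertices; it has the type of a state,
    -- so the encoding of states serves again.
    Table : Set
    Table = Fin N → Fin N → State N

    module Columns (T : Table) where
      r r⁻ : Fin N → Fin N → Fin N
      r u w = proj₁ (T u w)
      r⁻ u w = proj₁ (proj₂ (T u w))
      s : Fin N → Fin N → Bool
      s u w = proj₂ (proj₂ (T u w))

    record Valid (T : Table) : Set where
      open Columns T
      field
        r-nb   : ∀ u w → E G u w ≡ true → E G u (r u w) ≡ true
        r⁻-nb  : ∀ u w → E G u w ≡ true → E G u (r⁻ u w) ≡ true
        r⁻-r   : ∀ u w → E G u w ≡ true → r⁻ u (r u w) ≡ w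
        r-r⁻   : ∀ u w → E G u w ≡ true → r u (r⁻ u w) ≡ w
        r-cyc  : ∀ u w z → E G u w ≡ true → E G u z ≡ true → ∃ λ (k : Fin N) → iter (r u) (toℕ k) w ≡ z
        s-sym  : ∀ u w → s u w ≡ s w u

    embed : ∀ T → Valid T → Embedding G
    embed T v = record { rot = r ; rotInv = r⁻ ; sig = s ; rot-nb = r-nb ; rotInv-nb = r⁻-nb ; inv₁ = r⁻-r ; inv₂ = r-r⁻
                       ; cyclic = λ u w z p q → let k , e = r-cyc u w z p q in toℕ k , e ; sig-sym = s-sym }
      where
      open Columns T
      open Valid v

    all₂ : {P : Fin N → Fin N → Set} → (∀ u w → Dec (P u w)) → Dec (∀ u w → P u w)
    all₂ P? = Finₚ.all? (λ u → Finₚ.all? (P? u))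

    edge→ : ∀ {P : Set} u w → Dec P → Dec (E G u w ≡ true → P)
    edge→ u w P? = (E G u w ≟ᵇ true) →-dec P?

    valid? : ∀ T → Dec (Valid T)
    valid? T = map′
      (λ (a , b , c , d , e , f) → record { r-nb = a ; r⁻-nb = b ; r⁻-r = c ; r-r⁻ = d ; r-cyc = e ; s-sym = f })
      (λ v → let open Valid v in r-nb , r⁻-nb , r⁻-r , r-r⁻ , r-cyc , s-sym)
      (all₂ (λ u w → edge→ u w (E G u (r u w) ≟ᵇ true)) ×-dec
       all₂ (λ u w → edge→ u w (E G u (r⁻ u w) ≟ᵇ true)) ×-dec
       all₂ (λ u w → edge→ u w (r⁻ u (r u w) ≟ w)) ×-dec
       all₂ (λ u w → edge→ u w (r u (r⁻ u w) ≟ w)) ×-dec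
       all₂ (λ u w → Finₚ.all? (λ z → edge→ u w (edge→ u z (Finₚ.any? (λ k → iter (r u) (toℕ k) w ≟ z))))) ×-dec
       all₂ (λ u w → s u w ≟ᵇ s w u))
      where open Columns T

    -- Bounds the exponent in `cyclic`, which makes validity of a table decidable. `rot` may fail to
    -- be injective outside the neighbours, so no period is at hand; a loop between two equal
    -- iterates is cut out instead.
    short : ∀ (f : Fin N → Fin N) a k → ∃ λ j → j < N × iter f j a ≡ iter f k a
    short f a zero = 0 , ℕₚ.≤-<-trans z≤n (Finₚ.toℕ<n a) , refl
    short f a (suc k) with short f a k
    ... | j , j<N , e with suc j ℕₚ.<? N
    ... | yes lt = suc j , lt , cong f e
    ... | no ¬lt with Finₚ.pigeonhole (ℕₚ.n<1+n N) (λ i → iter f (toℕ i) a)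
    ... | p , q , p<q , c = toℕ p + (suc j ∸ toℕ q) , lt , trans same (cong f e)
      where
      j+1 : suc j ≡ N
      j+1 = ℕₚ.≤-antisym j<N (ℕₚ.≮⇒≥ ¬lt)
      q≤ : toℕ q ≤ suc j
      q≤ = subst (toℕ q ≤_) (sym j+1) (ℕₚ.≤-pred (Finₚ.toℕ<n q))
      lt : toℕ p + (suc j ∸ toℕ q) < N
      lt = ℕₚ.<-≤-trans (ℕₚ.+-monoˡ-< (suc j ∸ toℕ q) p<q) (ℕₚ.≤-reflexive (trans (ℕₚ.m+[n∸m]≡n q≤) j+1))
      same : iter f (toℕ p + (suc j ∸ toℕ q)) a ≡ iter f (suc j) a
      same = trans (cong (λ m → iter f m a) (ℕₚ.+-comm (toℕ p) _)) (trans (iter-+ f (suc j ∸ toℕ q) (toℕ p) a)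
        (trans (cong (iter f (suc j ∸ toℕ q)) c) (trans (sym (iter-+ f (suc j ∸ toℕ q) (toℕ q) a))
          (cong (λ m → iter f m a) (ℕₚ.m∸n+n≡m q≤)))))

    module _ (e : Embedding G) (T : Table) (agree : ∀ u w → T u w ≡ (rot e u w , rotInv e u w , sig e u w)) where
      private
        r≡ : ∀ u w → proj₁ (T u w) ≡ rot e u w
        r≡ u w = cong proj₁ (agree u w)
        r⁻≡ : ∀ u w → proj₁ (proj₂ (T u w)) ≡ rotInv e u w
        r⁻≡ u w = cong (proj₁ ∘ proj₂) (agree u w)
        s≡ : ∀ u w → proj₂ (proj₂ (T u w)) ≡ sig e u w
        s≡ u w = cong (proj₂ ∘ proj₂) (agree u w)
        iter≡ : ∀ u k w → iter (λ w → proj₁ (T u w)) k w ≡ iter (rot e u) k w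
        iter≡ u zero w = refl
        iter≡ u (suc k) w = trans (r≡ u _) (cong (rot e u) (iter≡ u k w))

      valid : Valid T
      valid = record
        { r-nb = λ u w h → trans (cong (E G u) (r≡ u w)) (rot-nb e u w h)
        ; r⁻-nb = λ u w h → trans (cong (E G u) (r⁻≡ u w)) (rotInv-nb e u w h)
        ; r⁻-r = λ u w h → trans (r⁻≡ u _) (trans (cong (rotInv e u) (r≡ u w)) (inv₁ e u w h))
        ; r-r⁻ = λ u w h → trans (r≡ u _) (trans (cong (rot e u) (r⁻≡ u w)) (inv₂ e u w h))
        ; r-cyc = λ u w z p q → let k , c = cyclic e u w z p q ; j , j<N , d = short (rot e u) w k in
            fromℕ< j<N , trans (iter≡ u (toℕ (fromℕ< j<N)) w) (trans (cong (λ m → iter (rot e u) m w) (Finₚ.toℕ-fromℕ< j<N)) (trans d c))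
        ; s-sym = λ u w → trans (s≡ u w) (trans (sig-sym e u w) (sym (s≡ w u))) }

      numOrbits-agree : ∀ v → numOrbits (embed T v) ≡ numOrbits e
      numOrbits-agree v = trans (numOrbits-orbOn (embed T v)) (trans
        (orbOn-conj (flag G) (flag G) (perm (corners e′) (edges (sig e′) (sig-sym e′))) (perm (corners e) (edges (sig e) (sig-sym e)))
          id (λ _ → refl) (λ _ h → h) (λ _ h → h)
          (λ t h → trans (corners-flag e _) (trans (edges-flag (sig e) (sig-sym e) t) h))
          (λ t _ → trans (corner (app (edges (sig e) (sig-sym e)) t)) (cong (app (corners e′)) (edge t))))
        (sym (numOrbits-orbOn e)))
        where
        e′ = embed T v
        corner : ∀ t → app (corners e) t ≡ app (corners e′) t
        corner (u , w , s) = cong (λ z → if E G u w then z else (u , w , not s)) (side s)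
          where
          side : ∀ s → turn (rot e) (rotInv e) (u , w , s) ≡ turn (rot e′) (rotInv e′) (u , w , s)
          side true = cong (λ z → u , z , false) (sym (r≡ u w))
          side false = cong (λ z → u , z , true) (sym (r⁻≡ u w))
        edge : ∀ t → app (edges (sig e) (sig-sym e)) t ≡ app (edges (sig e′) (sig-sym e′)) t
        edge (u , w , s) = cong (λ g → if E G u w then (w , u , not (s xor g)) else (u , w , not s)) (sym (s≡ u w))

    tables : ℕ
    tables = (N * (N * 2)) ℕ.^ (N * N)

    opaque
      table : Fin tables → Table
      table c u w = decState (finToFun {N * (N * 2)} {N * N} c (combine u w))

      tabulated : Table → Fin tables
      tabulated T = funToFin {N * N} {N * (N * 2)} (λ i → let u , w = remQuot {N} N i in encState (T u w))

      table-tabulated : ∀ T u w → table (tabulated T) u w ≡ T u w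
      table-tabulated T u w = trans (cong decState (Finₚ.finToFun-funToFin (λ i → let u , w = remQuot {N} N i in encState (T u w)) (combine u w)))
        (trans (cong (λ (u , w) → decState (encState (T u w))) (Finₚ.remQuot-combine u w)) (decState-encState (T u w)))

    -- An embedding is given by a finite table, and there are finitely many of these to try.
    better? : ∀ (e : Embedding G) → Dec (∃ λ (e′ : Embedding G) → numOrbits {G = G} e < numOrbits {G = G} e′)
    better? e = map′ (λ (c , v , lt) → embed (table c) v , lt) found (Finₚ.any? candidate?)
      where
      Candidate : Fin tables → Set
      Candidate c = Σ (Valid (table c)) λ v → numOrbits {G = G} e < numOrbits {G = G} (embed (table c) v)
      encode : Embedding G → Table
      encode e u w = rot e u w , rotInv e u w , sig e u w
      found : (∃ λ (e′ : Embedding G) → numOrbits {G = G} e < numOrbits {G = G} e′) → ∃ Candidate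
      found (e′ , lt) = c , v , subst (numOrbits {G = G} e <_) (sym (numOrbits-agree e′ (table c) agree v)) lt
        where
        c = tabulated (encode e′)
        agree : ∀ u w → table c u w ≡ encode e′ u w
        agree = table-tabulated (encode e′)
        v = valid e′ (table c) agree
      candidate? : ∀ c → Dec (Candidate c)
      candidate? c = decide (valid? (table c))
        where
        decide : Dec (Valid (table c)) → Dec (Candidate c)
        decide (no ¬v) = no (¬v ∘ proj₁)
        decide (yes v) = map′ (λ lt → v , lt)
          (λ (v′ , lt) → subst (numOrbits {G = G} e <_) (sym (numOrbits-agree (embed (table c) v′) (table c) (λ _ _ → refl) v)) lt)
          (numOrbits {G = G} e ℕₚ.<? numOrbits {G = G} (embed (table c) v))

    Best : Set
    Best = Σ (Embedding G) λ e → ∀ e′ → numOrbits {G = G} e′ ≤ numOrbits {G = G} e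

    -- Every improvement raises the number of orbits, which cannot exceed the number of states; `m`
    -- is the room left.
    climb : ∀ m e → N * (N * 2) ≤ numOrbits {G = G} e + m → Best
    climb m e fuel = go m fuel (better? e)
      where
      go : ∀ m → N * (N * 2) ≤ numOrbits {G = G} e + m → Dec (∃ λ (e′ : Embedding G) → numOrbits {G = G} e < numOrbits {G = G} e′) → Best
      go _ h (no none) = e , λ e′ → ℕₚ.≮⇒≥ (λ lt → none (e′ , lt))
      go zero h (yes (e′ , lt)) = contradiction (ℕₚ.<-≤-trans lt (ℕₚ.≤-trans (ℕₚ.≤-trans (ℕₚ.≤-reflexive (numOrbits-orbOn e′))
          (orbOn-bounded (flag G) (perm (corners e′) (edges (sig e′) (sig-sym e′))))) (ℕₚ.≤-trans h (ℕₚ.≤-reflexive (ℕₚ.+-identityʳ (numOrbits {G = G} e)))))) (ℕₚ.<-irrefl refl)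
      go (suc m) h (yes (e′ , lt)) = climb m e′ (ℕₚ.≤-trans h (ℕₚ.≤-trans (ℕₚ.≤-reflexive (ℕₚ.+-suc (numOrbits {G = G} e) m)) (ℕₚ.+-monoˡ-≤ m lt)))

    opaque
      best : Best
      best = climb (N * (N * 2)) someEmbedding (ℕₚ.m≤n+m (N * (N * 2)) (numOrbits {G = G} someEmbedding))

  -- All terms of the genus except the orbits depend on `G` alone, so the most orbits give the least
  -- genus.
  minimumGenus : Σ (Embedding G) λ e → ∀ (e′ : Embedding G) → eulerGenusOf e ℤ.≤ eulerGenusOf e′
  minimumGenus = proj₁ best , λ e′ → lower (proj₁ best) e′ (proj₂ best e′)
    where
    lower : (e e′ : Embedding G) → numOrbits e′ ≤ numOrbits e → eulerGenusOf e ℤ.≤ eulerGenusOf e′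
    lower e e′ h = ℤₚ.+-monoʳ-≤ ((ℤ.+ (2 * numComponents G) ℤ.- ℤ.+ numVertices G) ℤ.+ ℤ.+ numEdges G)
      (ℤₚ.neg-mono-≤ (ℤ.+≤+ (ℕₚ.+-monoˡ-≤ (count (isolated G)) (DivMod./-monoˡ-≤ 2 h))))

-- Minors of one summand

==-true : ∀ {N} {a b : Fin N} → (a == b) ≡ true → a ≡ b
==-true {a = a} {b} = ⌊⌋-true⁻ {a? = a ≟ b}

==-false : ∀ {N} {a b : Fin N} → a ≢ b → (a == b) ≡ false
==-false {a = a} {b} = ⌊⌋-false {a? = a ≟ b}

==-refl : ∀ {N} (a : Fin N) → (a == a) ≡ true
==-refl a = ⌊⌋-true {a? = a ≟ a} refl

==-sym : ∀ {N} (a b : Fin N) → (a == b) ≡ (b == a)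
==-sym a b = bool-ext (λ h → trans (cong (b ==_) (==-true h)) (==-refl b)) (λ h → trans (cong (a ==_) (==-true h)) (==-refl a))

samePair-true : ∀ {N} {a b u w : Fin N} → samePair a b u w ≡ true → (a ≡ u × b ≡ w) ⊎ (a ≡ w × b ≡ u)
samePair-true {a = a} {b} {u} {w} h with ∨-true {(a == u) ∧ (b == w)} h
... | inj₁ e = let p , q = ∧-true⁻ {a == u} e in inj₁ (==-true p , ==-true q)
... | inj₂ e = let p , q = ∧-true⁻ {a == w} e in inj₂ (==-true p , ==-true q)

samePair-sym : ∀ {N} (a b u w : Fin N) → samePair a b u w ≡ samePair b a u w
samePair-sym a b u w = trans (Boolₚ.∨-comm ((a == u) ∧ (b == w)) ((a == w) ∧ (b == u)))
  (cong₂ _∨_ (Boolₚ.∧-comm (a == w) (b == u)) (Boolₚ.∧-comm (a == u) (b == w)))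

samePair-xy : ∀ {N} (x y : Fin N) → samePair x y x y ≡ true
samePair-xy x y = ∨-trueˡ (∧-true (==-refl x) (==-refl y))

∨-∧-not : ∀ p q s → (q ≡ true → s ≡ false) → (p ∨ q) ∧ not s ≡ (p ∧ not s) ∨ q
∨-∧-not p true s f rewrite f refl = trans (Boolₚ.∧-identityʳ (p ∨ true)) (cong (_∨ true) (sym (Boolₚ.∧-identityʳ p)))
∨-∧-not p false s f = trans (cong (_∧ not s) (Boolₚ.∨-identityʳ p)) (sym (Boolₚ.∨-identityʳ (p ∧ not s)))

-- Covers a summand both before and after a minor operation. Deletion may disconnect `A` and
-- contraction may create the edge `xy` in it, so only what both preserve is recorded.
record Piece {N} (x y : Fin N) (A B U : Graph N) : Set where
  field
    symA : Symmetric A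
    irrA : Irreflexive A
    EVA  : ∀ u w → E A u w ≡ true → V A u ≡ true
    Ax   : V A x ≡ true
    Ay   : V A y ≡ true
    meet : ∀ u → V A u ≡ true → V B u ≡ true → u ≡ x ⊎ u ≡ y
    VU   : ∀ u → V U u ≡ V A u ∨ V B u
    EU   : ∀ u w → E U u w ≡ E A u w ∨ E B u w

module Summand {N} {x y : Fin N} {B : Graph N} (B° : IsGraphXY° x y B) (connB : Connected B) where
  x≢y : x ≢ y
  x≢y = proj₁ (proj₁ B°)

  Bx : V B x ≡ true
  Bx = proj₁ (proj₂ (proj₁ B°))

  By : V B y ≡ true
  By = proj₁ (proj₂ (proj₂ (proj₁ B°)))

  symB : Symmetric B
  symB = proj₁ (proj₂ (proj₂ (proj₂ (proj₁ B°))))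

  irrB : Irreflexive B
  irrB = proj₁ (proj₂ (proj₂ (proj₂ (proj₂ (proj₁ B°)))))

  EVB : ∀ u w → E B u w ≡ true → V B u ≡ true
  EVB = proj₂ (proj₂ (proj₂ (proj₂ (proj₂ (proj₁ B°)))))

  plus-sym : ∀ {A} → Symmetric A → Symmetric (plus x y A)
  plus-sym s a b = cong₂ _∨_ (s a b) (samePair-sym a b x y)

  plus-irr : ∀ {A} → Irreflexive A → Irreflexive (plus x y A)
  plus-irr {A} irr a = trans (cong (_∨ samePair a a x y) (irr a)) (¬true⇒false (λ h → bad (samePair-true h)))
    where
    bad : (a ≡ x × a ≡ y) ⊎ (a ≡ y × a ≡ x) → ⊥
    bad (inj₁ (refl , e)) = x≢y e
    bad (inj₂ (e , refl)) = x≢y e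

  plus-EV : ∀ {A} → (∀ u w → E A u w ≡ true → V A u ≡ true) → V A x ≡ true → V A y ≡ true →
            ∀ u w → E (plus x y A) u w ≡ true → V A u ≡ true
  plus-EV {A} ev vx vy u w h with ∨-true {E A u w} h
  ... | inj₁ e = ev u w e
  ... | inj₂ s with samePair-true {a = u} {w} {x} {y} s
  ... | inj₁ (refl , _) = vx
  ... | inj₂ (refl , _) = vy

  plus-xy : ∀ A → E (plus x y A) x y ≡ true
  plus-xy A = ∨-trueʳ {E A x y} (samePair-xy x y)

  plus-connected : Connected (plus x y B)
  plus-connected u w vu vw = Reach.connectedTo-complete (plus x y B) (go N (connB u w vu vw))
    where
    module R = Reach B
    module R⁺ = Reach (plus x y B)
    go : ∀ k {w} → reach B k u w ≡ true → u R⁺.↝ w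
    go zero p = 0 , p
    go (suc k) p with R.reach-suc⁻ k p
    ... | inj₁ p′ = go k p′
    ... | inj₂ (v , p′ , e) = R⁺.↝-trans (go k p′) (R⁺.↝-edge (∨-trueˡ e))

  vertexAmalgam : ∀ {A U} → Piece x y A B U → VertexAmalgam x y (plus x y A) (plus x y B) (plus x y U)
  vertexAmalgam {A} {U} p = record
    { amalgam = record
      { x≢y = x≢y ; symH = plus-sym {A} symA ; irrH = plus-irr {A} irrA ; symK = plus-sym {B} symB ; irrK = plus-irr {B} irrB
      ; Hxy = plus-xy A ; Kxy = plus-xy B
      ; shared = λ u w z h k → meet u (plus-EV {A} EVA Ax Ay u w h) (plus-EV {B} EVB Bx By u z k)
      ; EU = λ u w → trans (cong (_∨ samePair u w x y) (EU u w)) (distribute (E A u w) (E B u w) (samePair u w x y)) }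
    ; EVH = plus-EV {A} EVA Ax Ay ; EVK = plus-EV {B} EVB Bx By ; VU = VU ; meet = meet ; connK = plus-connected }
    where
    open Piece p
    distribute : ∀ a b s → (a ∨ b) ∨ s ≡ (a ∨ s) ∨ (b ∨ s)
    distribute true _ _ = refl
    distribute false b true = Boolₚ.∨-zeroʳ b
    distribute false b false = refl

  module WithA (A : Graph N) (A° : IsGraphXY° x y A) (disjoint : ∀ a → V A a ≡ true → V B a ≡ true → a ≡ x ⊎ a ≡ y) where
    Ax : V A x ≡ true
    Ax = proj₁ (proj₂ (proj₁ A°))

    Ay : V A y ≡ true
    Ay = proj₁ (proj₂ (proj₂ (proj₁ A°)))

    symA : Symmetric A
    symA = proj₁ (proj₂ (proj₂ (proj₂ (proj₁ A°))))

    irrA : Irreflexive A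
    irrA = proj₁ (proj₂ (proj₂ (proj₂ (proj₂ (proj₁ A°)))))

    EVA : ∀ u w → E A u w ≡ true → V A u ≡ true
    EVA = proj₂ (proj₂ (proj₂ (proj₂ (proj₂ (proj₁ A°)))))

    EVA′ : ∀ u w → E A u w ≡ true → V A w ≡ true
    EVA′ u w h = EVA w u (trans (symA w u) h)

    whole : Piece x y A B (xySum A B)
    whole = record { symA = symA ; irrA = irrA ; EVA = EVA ; Ax = Ax ; Ay = Ay ; meet = disjoint
                   ; VU = λ _ → refl ; EU = λ _ _ → refl }

    not-both-terminals : ∀ {u w} → E A u w ≡ true → u ≡ x ⊎ u ≡ y → w ≡ x ⊎ w ≡ y → ⊥
    not-both-terminals h (inj₁ refl) (inj₁ refl) = true≢false (trans (sym h) (irrA x))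
    not-both-terminals h (inj₁ refl) (inj₂ refl) = true≢false (trans (sym h) (proj₂ A°))
    not-both-terminals h (inj₂ refl) (inj₁ refl) = true≢false (trans (sym h) (trans (symA y x) (proj₂ A°)))
    not-both-terminals h (inj₂ refl) (inj₂ refl) = true≢false (trans (sym h) (irrA y))

    -- A common edge would have both ends in `{x , y}`, and `A` has no such edge.
    edge-disjoint : ∀ {u w} → E A u w ≡ true → E B u w ≡ true → ⊥
    edge-disjoint {u} {w} h k = not-both-terminals h (disjoint u (EVA u w h) (EVB u w k))
      (disjoint w (EVA′ u w h) (EVB w u (trans (symB w u) k)))

    deleted : ∀ u w → E A u w ≡ true → Piece x y (deleteEdge u w A) B (deleteEdge u w (xySum A B))
    deleted u w h = record
      { symA = λ a b → cong₂ (λ p q → p ∧ not q) (symA a b) (samePair-sym a b u w)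
      ; irrA = λ a → cong (_∧ not (samePair a a u w)) (irrA a)
      ; EVA = λ a b e → EVA a b (proj₁ (∧-true⁻ e)) ; Ax = Ax ; Ay = Ay ; meet = disjoint ; VU = λ _ → refl
      ; EU = λ a b → ∨-∧-not (E A a b) (E B a b) (samePair a b u w) (untouched a b) }
      where
      untouched : ∀ a b → E B a b ≡ true → samePair a b u w ≡ false
      untouched a b k = ¬true⇒false (λ s → bad (samePair-true {a = a} {b} {u} {w} s))
        where
        bad : (a ≡ u × b ≡ w) ⊎ (a ≡ w × b ≡ u) → ⊥
        bad (inj₁ (refl , refl)) = edge-disjoint h k
        bad (inj₂ (refl , refl)) = edge-disjoint h (trans (symB u w) k)

    -- The vanishing vertex is no terminal and hence lies outside `B`, so the contraction neither
    -- removes nor moves an edge of `B`.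
    contracted : ∀ keep gone → V A keep ≡ true → V A gone ≡ true → keep ≢ gone → gone ≢ x → gone ≢ y →
      Piece x y (contractInto keep gone A) B (contractInto keep gone (xySum A B))
    contracted keep gone vk vg k≢g g≢x g≢y = record
      { symA = λ a b → sym-go (not (a == gone)) (not (b == gone)) (cong not (==-sym a b)) (symA a b)
          (cong ((a == keep) ∧_) (symA gone b)) (cong ((b == keep) ∧_) (symA a gone))
      ; irrA = λ a → trans (cong (λ z → not (a == gone) ∧ not (a == gone) ∧ not z ∧ (E A a a ∨ (a == keep ∧ E A gone a) ∨ (a == keep ∧ E A a gone))) (==-refl a))
          (collapse (not (a == gone)))
      ; EVA = λ a b e → ends a b e
      ; Ax = ∧-true Ax (cong not (==-false (g≢x ∘ sym))) ; Ay = ∧-true Ay (cong not (==-false (g≢y ∘ sym)))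
      ; meet = λ a h k → disjoint a (proj₁ (∧-true⁻ h)) k
      ; VU = λ a → ∨-∧-not (V A a) (V B a) (a == gone) (λ vb → ==-false (λ { refl → gone∉B vb }))
      ; EU = λ a b → e-go (not (a == gone)) (not (b == gone)) (not (a == b)) (E A a b) (E B a b) (a == keep) (b == keep)
          (E A gone b) (E A a gone) (E B gone b) (E B a gone)
          (λ k → cong not (==-false (λ { refl → gone∉B (EVB _ _ k) })))
          (λ k → cong not (==-false (λ { refl → gone∉B (EVB _ _ (trans (symB _ _) k)) })))
          (λ k → cong not (==-false (λ { refl → true≢false (trans (sym k) (irrB _)) })))
          (¬true⇒false (λ k → gone∉B (EVB _ _ k)))
          (¬true⇒false (λ k → gone∉B (EVB _ _ (trans (symB _ _) k)))) }
      where
      gone∉B : V B gone ≡ true → ⊥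
      gone∉B vb = case (disjoint gone vg vb)
        where
        case : gone ≡ x ⊎ gone ≡ y → ⊥
        case (inj₁ e) = g≢x e
        case (inj₂ e) = g≢y e
      collapse : ∀ p → p ∧ p ∧ false ≡ false
      collapse true = refl
      collapse false = refl
      sym-go : ∀ p q {r r′ s s′ t t′ u u′} → r ≡ r′ → s ≡ s′ → t ≡ t′ → u ≡ u′ →
               p ∧ q ∧ r ∧ (s ∨ t ∨ u) ≡ q ∧ p ∧ r′ ∧ (s′ ∨ u′ ∨ t′)
      sym-go true q {r} {_} {s} {_} {t} {_} {u} refl refl refl refl = cong (λ z → q ∧ r ∧ (s ∨ z)) (Boolₚ.∨-comm t u)
      sym-go false q refl refl refl refl = sym (Boolₚ.∧-zeroʳ q)
      ends : ∀ a b → E (contractInto keep gone A) a b ≡ true → V A a ∧ not (a == gone) ≡ true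
      ends a b h with ∧-true⁻ {not (a == gone)} h
      ... | a≢ , h₁ with ∧-true⁻ {not (b == gone)} h₁
      ... | _ , h₂ with ∨-true {E A a b} (proj₂ (∧-true⁻ {not (a == b)} h₂))
      ... | inj₁ e = ∧-true (EVA a b e) a≢
      ... | inj₂ h₃ with ∨-true {(a == keep) ∧ E A gone b} h₃
      ... | inj₁ e = ∧-true (trans (cong (V A) (==-true (proj₁ (∧-true⁻ {a == keep} e)))) vk) a≢
      ... | inj₂ e = ∧-true (EVA a gone (proj₂ (∧-true⁻ {b == keep} e))) a≢
      e-go : ∀ n₁ n₂ n₃ p q i j a b c d → (q ≡ true → n₁ ≡ true) → (q ≡ true → n₂ ≡ true) → (q ≡ true → n₃ ≡ true) →
             c ≡ false → d ≡ false →
             n₁ ∧ n₂ ∧ n₃ ∧ ((p ∨ q) ∨ (i ∧ (a ∨ c)) ∨ (j ∧ (b ∨ d))) ≡ (n₁ ∧ n₂ ∧ n₃ ∧ (p ∨ (i ∧ a) ∨ (j ∧ b))) ∨ q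
      e-go n₁ n₂ n₃ p true i j a b _ _ f g h refl refl rewrite f refl | g refl | h refl =
        trans (cong (_∨ _) (Boolₚ.∨-zeroʳ p)) (sym (Boolₚ.∨-zeroʳ (p ∨ (i ∧ a) ∨ (j ∧ b))))
      e-go n₁ n₂ n₃ p false i j a b _ _ f g h refl refl =
        trans (cong (λ z → n₁ ∧ n₂ ∧ n₃ ∧ z) (cong₂ _∨_ (Boolₚ.∨-identityʳ p)
          (cong₂ (λ a b → (i ∧ a) ∨ (j ∧ b)) (Boolₚ.∨-identityʳ a) (Boolₚ.∨-identityʳ b))))
          (sym (Boolₚ.∨-identityʳ (n₁ ∧ n₂ ∧ n₃ ∧ (p ∨ (i ∧ a) ∨ (j ∧ b)))))

    minor : (μ : MinorOp x y A) → Piece x y (applyOp μ A) B (applyOp μ (xySum A B))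
    minor (del u w h) = deleted u w h
    minor (con u w h _) = go ((w == x) ∨ (w == y)) refl
      where
      u≢w : u ≢ w
      u≢w refl = true≢false (trans (sym h) (irrA u))
      terminal : ∀ {v} → (v == x) ∨ (v == y) ≡ true → v ≡ x ⊎ v ≡ y
      terminal {v} e with ∨-true {v == x} e
      ... | inj₁ p = inj₁ (==-true p)
      ... | inj₂ p = inj₂ (==-true p)
      nonterminal : ∀ {v} → (v == x) ∨ (v == y) ≡ false → v ≢ x × v ≢ y
      nonterminal {v} e = (λ { refl → true≢false (trans (sym (∨-trueˡ (==-refl v))) e) })
                        , (λ { refl → true≢false (trans (sym (∨-trueʳ {v == x} (==-refl v))) e) })
      go : ∀ b → (w == x) ∨ (w == y) ≡ b →
        Piece x y (if b then contractInto w u A else contractInto u w A) B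
                  (if b then contractInto w u (xySum A B) else contractInto u w (xySum A B))
      -- Here `w` is a terminal and keeps its name. The other end `u` is not one, because `A` lacks
      -- the edge `xy` and has no loops.
      go true e = contracted w u (EVA′ u w h) (EVA u w h) (u≢w ∘ sym)
        (λ f → not-both-terminals h (inj₁ f) (terminal e)) (λ f → not-both-terminals h (inj₂ f) (terminal e))
      go false e = contracted u w (EVA u w h) (EVA′ u w h) u≢w (proj₁ (nonterminal e)) (proj₂ (nonterminal e))

    +-cancelʳ-<-ℤ : ∀ i j k → i ℤ.+ k ℤ.< j ℤ.+ k → i ℤ.< j
    +-cancelʳ-<-ℤ i j k h = subst₂ ℤ._<_ (undo i) (undo j) (ℤₚ.+-monoˡ-< (ℤ.- k) h)
      where
      undo : ∀ i → (i ℤ.+ k) ℤ.+ ℤ.- k ≡ i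
      undo i = trans (ℤₚ.+-assoc i k (ℤ.- k)) (trans (cong (λ z → i ℤ.+ z) (ℤₚ.+-inverseʳ k)) (ℤₚ.+-identityʳ i))

    -- The embedding of the reduced sum splits into `eH` and `eK`. Every embedding of `plus x y A`
    -- can be combined with the same `eK`, and the genus of `eK` cancels.
    tight⇒ : Tight x y (xySum A B) A → ∀ μ → genusPlusLT x y (applyOp μ A) A
    tight⇒ tight μ = go (tight μ)
      where
      module Whole = Additivity (vertexAmalgam whole)
      module Minor = Additivity (vertexAmalgam (minor μ))
      compare : ∀ eH eK → (∀ (e′ : Embedding (plus x y (xySum A B))) → eulerGenusOf eH ℤ.+ eulerGenusOf eK ℤ.< eulerGenusOf e′) →
                ∀ e′ → eulerGenusOf eH ℤ.< eulerGenusOf e′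
      compare eH eK h e′ = +-cancelʳ-<-ℤ (eulerGenusOf eH) (eulerGenusOf e′) (eulerGenusOf eK)
        (ℤₚ.<-≤-trans (h (proj₁ (Whole.genus-combine e′ eK))) (proj₂ (Whole.genus-combine e′ eK)))
      go : genusPlusLT x y (applyOp μ (xySum A B)) (xySum A B) → genusPlusLT x y (applyOp μ A) A
      go (e , e<) = let eH , eK , split≤ = Minor.genus-split e in
        eH , compare eH eK (λ e′ → ℤₚ.≤-<-trans split≤ (e< e′))

    -- The competitor splits into embeddings of both summands, and its second one is arbitrary. The
    -- embedding of `plus x y B` used for the reduced sum must therefore have minimum genus.
    tight⇐ : (∀ μ → genusPlusLT x y (applyOp μ A) A) → Tight x y (xySum A B) A
    tight⇐ critical μ = go (critical μ) (MinimumGenus.minimumGenus (plus x y B) (plus-sym {B} symB) (plus-irr {B} irrB))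
      where
      module Whole = Additivity (vertexAmalgam whole)
      module Minor = Additivity (vertexAmalgam (minor μ))
      go : genusPlusLT x y (applyOp μ A) A →
           (Σ (Embedding (plus x y B)) λ e → ∀ (e′ : Embedding (plus x y B)) → eulerGenusOf e ℤ.≤ eulerGenusOf e′) →
           genusPlusLT x y (applyOp μ (xySum A B)) (xySum A B)
      go (eH , eH<) (eK , eK≤) = let e , combine≤ = Minor.genus-combine eH eK in
        e , λ e′ → let eH′ , eK′ , split≤ = Whole.genus-split e′ in
          ℤₚ.≤-<-trans combine≤ (ℤₚ.<-≤-trans (ℤₚ.+-mono-<-≤ (eH< eH′) (eK≤ eK′)) split≤)

theorem4p9 : ∀ {N : ℕ} (x y : Fin N) (G₁ G₂ : Graph N) →
    IsGraphXY° x y G₁ → IsGraphXY° x y G₂ →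
    (∀ a → V G₁ a ≡ true → V G₂ a ≡ true → a ≡ x ⊎ a ≡ y) →
    Connected G₁ → Connected G₂ →
    Tight x y (xySum G₁ G₂) G₁ ⇔ InC° x y G₁
theorem4p9 x y G₁ G₂ G₁° G₂° disjoint _ connected₂ =
  mk⇔ (λ tight → G₁° , S.tight⇒ tight) (λ (_ , critical) → S.tight⇐ critical)
  where module S = Summand.WithA G₂° connected₂ G₁ G₁° disjoint
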